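{- Let $q=2^r$ ($r\ge1$) and let $\mathbb{G}_q$ be the Galois ring of characteristic $4$ with $q^2$ elements. Then there exists a projective $\bigl((q^4-q)/2,\,q^2/2\bigr)$-arc in $\mathrm{PHG}(2,\mathbb{G}_q)$ which meets every line in either $0$ or $q^2/2$ points. Moreover $\mathrm{m}_{q^2/2}(\mathbb{G}_q)=(q^4-q)/2$.
   Context: The Galois ring $\mathbb{G}_q$ ($q=2^r$) is $\mathbb{Z}_4[X]/(h)$ with $h\in\mathbb{Z}_4[X]$ monic of degree $r$ and irreducible modulo $2$; it is a chain ring of length $2$ with residue field $\mathbb{F}_q$. The projective Hjelmslev plane $\mathrm{PHG}(2,R)$ is the incidence structure whose points are the free rank-$1$ submodules of the right module $R_R^3$, whose lines are the free rank-$2$ submodules of $R_R^3$, with incidence given by inclusion. A projective $(k,n)$-arc is a set of $k$ points meeting every line in at most $n$ points. For $0\le n\le q^2+q$, $\mathrm{m}_n(R)$ denotes the largest $k$ such that a projective $(k,n)$-arc exists in $\mathrm{PHG}(2,R)$. -}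

module Defs where

open import Algebra.Bundles using (Semiring; Ring; CommutativeRing)
import Algebra.Definitions.RawMagma as Divisibility
import Algebra.Definitions.RawSemiring as SemiringDefinitions
open import Algebra.Module.Bundles using (RightModule)
import Algebra.Module.Construct.DirectProduct as DirectProduct
import Algebra.Module.Construct.TensorUnit as TensorUnit
import Algebra.Properties.CommutativeMonoid.Sum as Summation
import Algebra.Properties.CommutativeSemigroup as CommutativeSemigroupProperties
import Algebra.Properties.Ring as RingProperties
open import Data.Fin.Base using (Fin)
open import Data.Fin.Subset using (Subset; ∣_∣) renaming (_∈_ to _∈ˢ_)
open import Data.Integer.Base using (ℤ; +_)
import Data.Integer.Properties as ℤ
open import Data.List.Base using (List; []; _∷_; map)
open import Data.Nat.Base using (ℕ; zero; suc; _≤_; _<_)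
open import Data.Product.Base using (Σ; ∃; _×_; _,_; proj₁; proj₂)
open import Data.Vec.Functional using (Vector)
open import Function.Bundles using (_⇔_)
open import Function.Definitions using (Injective)
open import Level using (Level; _⊔_; 0ℓ)
open import Relation.Binary.Bundles using (Setoid)
open import Relation.Binary.PropositionalEquality.Core using (_≡_)
import Relation.Binary.Reasoning.Setoid as SetoidReasoning
open import Relation.Unary using (Pred; _∈_; _⊆_; _≐_)
open import Relation.Unary.Properties using (≐-refl; ≐-sym; ≐-trans)

private
  variable
    c ℓ m ℓm p : Level

-- The quotient R/(a).  It has the same carrier as R: elements are
-- represented by elements of R and only the equality changes.

module Quotient (R : CommutativeRing c ℓ) (a : CommutativeRing.Carrier R) where

  open CommutativeRing R
  open Divisibility *-rawMagma using (_∣_) renaming (_,_ to _,ᵈ_)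
  open RingProperties ring
    using (-‿distribˡ-*; -‿+-comm; -‿involutive; x[y-z]≈xy-xz)
  open CommutativeSemigroupProperties +-commutativeSemigroup using (interchange)

  record _≈ₐ_ (x y : Carrier) : Set (c ⊔ ℓ) where
    constructor congruent
    field
      a∣x-y : a ∣ x - y

  private
    ≈⇒≈ₐ : ∀ {x y} → x ≈ y → x ≈ₐ y
    ≈⇒≈ₐ {x} {y} x≈y = congruent (0# ,ᵈ
      trans (zeroˡ a) (sym (trans (+-congʳ x≈y) (-‿inverseʳ y))))

    telescope : ∀ x y z → (x - y) + (y - z) ≈ x - z
    telescope x y z = trans (+-assoc x (- y) (y - z)) (+-congˡ
      (trans (sym (+-assoc (- y) y (- z)))
      (trans (+-congʳ (-‿inverseˡ y)) (+-identityˡ (- z)))))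

    ≈ₐ-trans : ∀ {x y z} → x ≈ₐ y → y ≈ₐ z → x ≈ₐ z
    ≈ₐ-trans {x} {y} {z} (congruent (k ,ᵈ eq)) (congruent (l ,ᵈ eq′)) =
      congruent (k + l ,ᵈ
        trans (distribʳ a k l) (trans (+-cong eq eq′) (telescope x y z)))

    -‿congₐ : ∀ {x y} → x ≈ₐ y → (- x) ≈ₐ (- y)
    -‿congₐ {x} {y} (congruent (k ,ᵈ eq)) = congruent (- k ,ᵈ
      trans (sym (-‿distribˡ-* k a)) (trans (-‿cong eq) (sym (-‿+-comm x (- y)))))

    ≈ₐ-sym : ∀ {x y} → x ≈ₐ y → y ≈ₐ x
    ≈ₐ-sym {x} {y} x≈y with congruent (k ,ᵈ eq) ← -‿congₐ x≈y = congruent (k ,ᵈ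
      trans eq (trans (+-congˡ (-‿involutive y)) (+-comm (- x) y)))

    +-congₐ : ∀ {x y u v} → x ≈ₐ y → u ≈ₐ v → (x + u) ≈ₐ (y + v)
    +-congₐ {x} {y} {u} {v} (congruent (k ,ᵈ eq)) (congruent (l ,ᵈ eq′)) =
      congruent (k + l ,ᵈ
        trans (distribʳ a k l)
        (trans (+-cong eq eq′)
        (trans (interchange x (- y) u (- v)) (+-congˡ (-‿+-comm y v)))))

    *-congˡₐ : ∀ {u v} x → u ≈ₐ v → (x * u) ≈ₐ (x * v)
    *-congˡₐ {u} {v} x (congruent (k ,ᵈ eq)) = congruent (x * k ,ᵈ
      trans (*-assoc x k a) (trans (*-congˡ eq) (x[y-z]≈xy-xz x u v)))

    *-congₐ : ∀ {x y u v} → x ≈ₐ y → u ≈ₐ v → (x * u) ≈ₐ (y * v)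
    *-congₐ {x} {y} {u} {v} x≈y u≈v =
      ≈ₐ-trans (≈⇒≈ₐ (*-comm x u))
      (≈ₐ-trans (*-congˡₐ u x≈y)
      (≈ₐ-trans (≈⇒≈ₐ (*-comm u y)) (*-congˡₐ y u≈v)))

  commutativeRing : CommutativeRing c (c ⊔ ℓ)
  commutativeRing = record
    { Carrier = Carrier
    ; _≈_ = _≈ₐ_
    ; _+_ = _+_
    ; _*_ = _*_
    ; -_  = -_
    ; 0#  = 0#
    ; 1#  = 1#
    ; isCommutativeRing = record
      { isRing = record
        { +-isAbelianGroup = record
          { isGroup = record
            { isMonoid = record
              { isSemigroup = record
                { isMagma = record
                  { isEquivalence = record
                    { refl = ≈⇒≈ₐ refl ; sym = ≈ₐ-sym ; trans = ≈ₐ-trans }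
                  ; ∙-cong = +-congₐ
                  }
                ; assoc = λ x y z → ≈⇒≈ₐ (+-assoc x y z)
                }
              ; identity = (λ x → ≈⇒≈ₐ (+-identityˡ x)) , (λ x → ≈⇒≈ₐ (+-identityʳ x))
              }
            ; inverse = (λ x → ≈⇒≈ₐ (-‿inverseˡ x)) , (λ x → ≈⇒≈ₐ (-‿inverseʳ x))
            ; ⁻¹-cong = -‿congₐ
            }
          ; comm = λ x y → ≈⇒≈ₐ (+-comm x y)
          }
        ; *-cong = *-congₐ
        ; *-assoc = λ x y z → ≈⇒≈ₐ (*-assoc x y z)
        ; *-identity = (λ x → ≈⇒≈ₐ (*-identityˡ x)) , (λ x → ≈⇒≈ₐ (*-identityʳ x))
        ; distrib = (λ x y z → ≈⇒≈ₐ (distribˡ x y z)) , (λ x y z → ≈⇒≈ₐ (distribʳ x y z))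
        }
      ; *-comm = λ x y → ≈⇒≈ₐ (*-comm x y)
      }
    }

infix 9 _/⟨_⟩
_/⟨_⟩ : (R : CommutativeRing c ℓ) → CommutativeRing.Carrier R → CommutativeRing c (c ⊔ ℓ)
R /⟨ a ⟩ = Quotient.commutativeRing R a

-- The polynomial ring R[X].  A polynomial is a list of coefficients,
-- constant term first; trailing zeros are allowed, and two lists are
-- equal when all their coefficients agree.

module Polynomial (R : CommutativeRing c ℓ) where

  open CommutativeRing R
  open RingProperties ring using (-0#≈0#)
  open CommutativeSemigroupProperties +-commutativeSemigroup using (interchange)

  Poly : Set c
  Poly = List Carrier

  coeff : Poly → ℕ → Carrier
  coeff []      _       = 0#
  coeff (a ∷ f) zero    = a
  coeff (a ∷ f) (suc n) = coeff f n

  infix 4 _≈ₚ_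
  record _≈ₚ_ (f g : Poly) : Set ℓ where
    constructor coeffwise
    field
      coeff≈ : ∀ n → coeff f n ≈ coeff g n
  open _≈ₚ_

  infixl 6 _+ₚ_
  infixl 7 _*ₚ_ _·_

  _+ₚ_ : Poly → Poly → Poly
  []      +ₚ g       = g
  (a ∷ f) +ₚ []      = a ∷ f
  (a ∷ f) +ₚ (b ∷ g) = (a + b) ∷ (f +ₚ g)

  -ₚ_ : Poly → Poly
  -ₚ_ = map (-_)

  _·_ : Carrier → Poly → Poly
  a · f = map (a *_) f

  _*ₚ_ : Poly → Poly → Poly
  []      *ₚ g = []
  (a ∷ f) *ₚ g = a · g +ₚ (0# ∷ f *ₚ g)

  0ₚ 1ₚ : Poly
  0ₚ = []
  1ₚ = 1# ∷ []

  IsMonicOfDegree : ℕ → Poly → Set ℓ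
  IsMonicOfDegree r f = coeff f r ≈ 1# × (∀ n → r < n → coeff f n ≈ 0#)

  private
    coeff-+ : ∀ f g n → coeff (f +ₚ g) n ≈ coeff f n + coeff g n
    coeff-+ []      g       n       = sym (+-identityˡ _)
    coeff-+ (a ∷ f) []      n       = sym (+-identityʳ _)
    coeff-+ (a ∷ f) (b ∷ g) zero    = refl
    coeff-+ (a ∷ f) (b ∷ g) (suc n) = coeff-+ f g n

    coeff-neg : ∀ f n → coeff (-ₚ f) n ≈ - coeff f n
    coeff-neg []      n       = sym -0#≈0#
    coeff-neg (a ∷ f) zero    = refl
    coeff-neg (a ∷ f) (suc n) = coeff-neg f n

    coeff-· : ∀ a f n → coeff (a · f) n ≈ a * coeff f n
    coeff-· a []      n       = sym (zeroʳ a)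
    coeff-· a (b ∷ f) zero    = refl
    coeff-· a (b ∷ f) (suc n) = coeff-· a f n

    reflₚ : ∀ {f} → f ≈ₚ f
    reflₚ = coeffwise λ _ → refl

    symₚ : ∀ {f g} → f ≈ₚ g → g ≈ₚ f
    symₚ e = coeffwise λ n → sym (coeff≈ e n)

    transₚ : ∀ {f g h} → f ≈ₚ g → g ≈ₚ h → f ≈ₚ h
    transₚ e e′ = coeffwise λ n → trans (coeff≈ e n) (coeff≈ e′ n)

    setoidₚ : Setoid c ℓ
    setoidₚ = record
      { _≈_ = _≈ₚ_
      ; isEquivalence = record { refl = reflₚ ; sym = symₚ ; trans = transₚ }
      }

    open SetoidReasoning setoidₚ

    +-congₚ : ∀ {f g h k} → f ≈ₚ g → h ≈ₚ k → f +ₚ h ≈ₚ g +ₚ k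
    +-congₚ {f} {g} {h} {k} e e′ = coeffwise λ n →
      trans (coeff-+ f h n)
        (trans (+-cong (coeff≈ e n) (coeff≈ e′ n)) (sym (coeff-+ g k n)))

    +-assocₚ : ∀ f g h → (f +ₚ g) +ₚ h ≈ₚ f +ₚ (g +ₚ h)
    +-assocₚ f g h = coeffwise λ n →
      trans (coeff-+ (f +ₚ g) h n)
      (trans (+-congʳ (coeff-+ f g n))
      (trans (+-assoc _ _ _)
      (trans (+-congˡ (sym (coeff-+ g h n))) (sym (coeff-+ f (g +ₚ h) n)))))

    +-commₚ : ∀ f g → f +ₚ g ≈ₚ g +ₚ f
    +-commₚ f g = coeffwise λ n →
      trans (coeff-+ f g n) (trans (+-comm _ _) (sym (coeff-+ g f n)))

    +-identityʳₚ : ∀ f → f +ₚ [] ≈ₚ f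
    +-identityʳₚ f = coeffwise λ n → trans (coeff-+ f [] n) (+-identityʳ _)

    -‿congₚ : ∀ {f g} → f ≈ₚ g → -ₚ f ≈ₚ -ₚ g
    -‿congₚ {f} {g} e = coeffwise λ n →
      trans (coeff-neg f n) (trans (-‿cong (coeff≈ e n)) (sym (coeff-neg g n)))

    -‿inverseʳₚ : ∀ f → f +ₚ -ₚ f ≈ₚ []
    -‿inverseʳₚ f = coeffwise λ n →
      trans (coeff-+ f (-ₚ f) n)
        (trans (+-congˡ (coeff-neg f n)) (-‿inverseʳ _))

    interchangeₚ : ∀ f g h k → (f +ₚ g) +ₚ (h +ₚ k) ≈ₚ (f +ₚ h) +ₚ (g +ₚ k)
    interchangeₚ f g h k = coeffwise λ n →
      trans (coeff-+ (f +ₚ g) (h +ₚ k) n)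
      (trans (+-cong (coeff-+ f g n) (coeff-+ h k n))
      (trans (interchange _ _ _ _)
      (trans (+-cong (sym (coeff-+ f h n)) (sym (coeff-+ g k n)))
        (sym (coeff-+ (f +ₚ h) (g +ₚ k) n)))))

    swapₚ : ∀ f g h → f +ₚ (g +ₚ h) ≈ₚ g +ₚ (f +ₚ h)
    swapₚ f g h = transₚ (symₚ (+-assocₚ f g h))
      (transₚ (+-congₚ (+-commₚ f g) reflₚ) (+-assocₚ g f h))

    ∷-cong : ∀ {a b f g} → a ≈ b → f ≈ₚ g → (a ∷ f) ≈ₚ (b ∷ g)
    ∷-cong e e′ = coeffwise λ { zero → e ; (suc n) → coeff≈ e′ n }

    ·-cong : ∀ {a b f g} → a ≈ b → f ≈ₚ g → a · f ≈ₚ b · g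
    ·-cong {a} {b} {f} {g} e e′ = coeffwise λ n →
      trans (coeff-· a f n) (trans (*-cong e (coeff≈ e′ n)) (sym (coeff-· b g n)))

    ·-distrib : ∀ a f g → a · (f +ₚ g) ≈ₚ a · f +ₚ a · g
    ·-distrib a f g = coeffwise λ n →
      trans (coeff-· a (f +ₚ g) n)
      (trans (*-congˡ (coeff-+ f g n))
      (trans (distribˡ a _ _)
      (trans (+-cong (sym (coeff-· a f n)) (sym (coeff-· a g n)))
        (sym (coeff-+ (a · f) (a · g) n)))))

    ·-assoc : ∀ a b f → (a * b) · f ≈ₚ a · (b · f)
    ·-assoc a b f = coeffwise λ n →
      trans (coeff-· (a * b) f n)
      (trans (*-assoc a b _)
      (trans (*-congˡ (sym (coeff-· b f n))) (sym (coeff-· a (b · f) n))))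

    0∷[] : (0# ∷ []) ≈ₚ []
    0∷[] = coeffwise λ { zero → refl ; (suc n) → refl }

    0·f+0∷g : ∀ f g → 0# · f +ₚ (0# ∷ g) ≈ₚ (0# ∷ g)
    0·f+0∷g f g = coeffwise λ n →
      trans (coeff-+ (0# · f) (0# ∷ g) n)
        (trans (+-congʳ (trans (coeff-· 0# f n) (zeroˡ _))) (+-identityˡ _))

    0∷-distrib : ∀ f g → (0# ∷ (f +ₚ g)) ≈ₚ (0# ∷ f) +ₚ (0# ∷ g)
    0∷-distrib f g = ∷-cong (sym (+-identityˡ 0#)) reflₚ

    ·-0∷ : ∀ a f → a · (0# ∷ f) ≈ₚ (0# ∷ a · f)
    ·-0∷ a f = ∷-cong (zeroʳ a) reflₚ

    *-zeroʳₚ : ∀ f → f *ₚ [] ≈ₚ []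
    *-zeroʳₚ []      = reflₚ
    *-zeroʳₚ (a ∷ f) = transₚ (∷-cong refl (*-zeroʳₚ f)) 0∷[]

    *-∷ : ∀ f b g → f *ₚ (b ∷ g) ≈ₚ b · f +ₚ (0# ∷ f *ₚ g)
    *-∷ []      b g = symₚ 0∷[]
    *-∷ (a ∷ f) b g = ∷-cong (+-congʳ (*-comm a b))
      (transₚ (+-congₚ reflₚ (*-∷ f b g)) (swapₚ (a · g) (b · f) (0# ∷ f *ₚ g)))

    *-commₚ : ∀ f g → f *ₚ g ≈ₚ g *ₚ f
    *-commₚ []      g = symₚ (*-zeroʳₚ g)
    *-commₚ (a ∷ f) g = transₚ
      (+-congₚ (reflₚ {a · g}) (∷-cong refl (*-commₚ f g))) (symₚ (*-∷ g a f))

    *-congˡₚ : ∀ f {g h} → g ≈ₚ h → f *ₚ g ≈ₚ f *ₚ h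
    *-congˡₚ []      e = reflₚ
    *-congˡₚ (a ∷ f) e = +-congₚ (·-cong refl e) (∷-cong refl (*-congˡₚ f e))

    *-congₚ : ∀ {f g h k} → f ≈ₚ g → h ≈ₚ k → f *ₚ h ≈ₚ g *ₚ k
    *-congₚ {f} {g} {h} {k} e e′ = begin
      f *ₚ h ≈⟨ *-congˡₚ f e′ ⟩
      f *ₚ k ≈⟨ *-commₚ f k ⟩
      k *ₚ f ≈⟨ *-congˡₚ k e ⟩
      k *ₚ g ≈⟨ *-commₚ k g ⟩
      g *ₚ k ∎

    distribˡₚ : ∀ f g h → f *ₚ (g +ₚ h) ≈ₚ f *ₚ g +ₚ f *ₚ h
    distribˡₚ []      g h = reflₚ
    distribˡₚ (a ∷ f) g h = begin
      a · (g +ₚ h) +ₚ (0# ∷ f *ₚ (g +ₚ h))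
        ≈⟨ +-congₚ (·-distrib a g h)
             (transₚ (∷-cong refl (distribˡₚ f g h)) (0∷-distrib (f *ₚ g) (f *ₚ h))) ⟩
      (a · g +ₚ a · h) +ₚ ((0# ∷ f *ₚ g) +ₚ (0# ∷ f *ₚ h))
        ≈⟨ interchangeₚ (a · g) (a · h) (0# ∷ f *ₚ g) (0# ∷ f *ₚ h) ⟩
      (a ∷ f) *ₚ g +ₚ (a ∷ f) *ₚ h ∎

    distribʳₚ : ∀ h f g → (f +ₚ g) *ₚ h ≈ₚ f *ₚ h +ₚ g *ₚ h
    distribʳₚ h f g = begin
      (f +ₚ g) *ₚ h      ≈⟨ *-commₚ (f +ₚ g) h ⟩
      h *ₚ (f +ₚ g)      ≈⟨ distribˡₚ h f g ⟩
      h *ₚ f +ₚ h *ₚ g   ≈⟨ +-congₚ (*-commₚ h f) (*-commₚ h g) ⟩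
      f *ₚ h +ₚ g *ₚ h   ∎

    ·-*-assoc : ∀ a f g → (a · f) *ₚ g ≈ₚ a · (f *ₚ g)
    ·-*-assoc a []      g = reflₚ
    ·-*-assoc a (b ∷ f) g = begin
      (a * b) · g +ₚ (0# ∷ (a · f) *ₚ g)
        ≈⟨ +-congₚ (·-assoc a b g)
             (transₚ (∷-cong refl (·-*-assoc a f g)) (symₚ (·-0∷ a (f *ₚ g)))) ⟩
      a · (b · g) +ₚ a · (0# ∷ f *ₚ g)
        ≈⟨ ·-distrib a (b · g) (0# ∷ f *ₚ g) ⟨
      a · ((b ∷ f) *ₚ g) ∎

    *-assocₚ : ∀ f g h → (f *ₚ g) *ₚ h ≈ₚ f *ₚ (g *ₚ h)
    *-assocₚ []      g h = reflₚ
    *-assocₚ (a ∷ f) g h = begin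
      (a · g +ₚ (0# ∷ f *ₚ g)) *ₚ h
        ≈⟨ distribʳₚ h (a · g) (0# ∷ f *ₚ g) ⟩
      (a · g) *ₚ h +ₚ (0# ∷ f *ₚ g) *ₚ h
        ≈⟨ +-congₚ (·-*-assoc a g h)
             (transₚ (0·f+0∷g h ((f *ₚ g) *ₚ h)) (∷-cong refl (*-assocₚ f g h))) ⟩
      (a ∷ f) *ₚ (g *ₚ h) ∎

    *-identityˡₚ : ∀ f → 1ₚ *ₚ f ≈ₚ f
    *-identityˡₚ f = coeffwise λ n →
      trans (coeff-+ (1# · f) (0# ∷ []) n)
      (trans (+-cong (trans (coeff-· 1# f n) (*-identityˡ _)) (coeff≈ 0∷[] n))
        (+-identityʳ _))

  commutativeRing : CommutativeRing c ℓ
  commutativeRing = record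
    { Carrier = Poly
    ; _≈_ = _≈ₚ_
    ; _+_ = _+ₚ_
    ; _*_ = _*ₚ_
    ; -_  = -ₚ_
    ; 0#  = 0ₚ
    ; 1#  = 1ₚ
    ; isCommutativeRing = record
      { isRing = record
        { +-isAbelianGroup = record
          { isGroup = record
            { isMonoid = record
              { isSemigroup = record
                { isMagma = record
                  { isEquivalence = Setoid.isEquivalence setoidₚ
                  ; ∙-cong = +-congₚ
                  }
                ; assoc = +-assocₚ
                }
              ; identity = (λ _ → reflₚ) , +-identityʳₚ
              }
            ; inverse =
                (λ f → transₚ (+-commₚ (-ₚ f) f) (-‿inverseʳₚ f)) , -‿inverseʳₚ
            ; ⁻¹-cong = -‿congₚ
            }
          ; comm = +-commₚ
          }
        ; *-cong = *-congₚ
        ; *-assoc = *-assocₚ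
        ; *-identity =
            *-identityˡₚ , (λ f → transₚ (*-commₚ f 1ₚ) (*-identityˡₚ f))
        ; distrib = distribˡₚ , distribʳₚ
        }
      ; *-comm = *-commₚ
      }
    }

infix 9 _[X]
_[X] : CommutativeRing c ℓ → CommutativeRing c ℓ
R [X] = Polynomial.commutativeRing R

IsIrreducible : (R : CommutativeRing c ℓ) → CommutativeRing.Carrier R → Set (c ⊔ ℓ)
IsIrreducible R = SemiringDefinitions.Irreducible rawSemiring
  where open Semiring (CommutativeRing.semiring R) using (rawSemiring)

ℤ/_ : ℕ → CommutativeRing 0ℓ 0ℓ
ℤ/ n = ℤ.+-*-commutativeRing /⟨ + n ⟩

ℤ₄[X] 𝔽₂[X] : CommutativeRing 0ℓ 0ℓ
ℤ₄[X] = (ℤ/ 4) [X]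
𝔽₂[X] = (ℤ/ 2) [X]

-- Elements of ℤ₄ = ℤ/(4) and of 𝔽₂ = ℤ/(2) are both represented by integers, so the
-- canonical projection ℤ₄[X] → 𝔽₂[X] is the identity on representatives.

mod2 : CommutativeRing.Carrier ℤ₄[X] → CommutativeRing.Carrier 𝔽₂[X]
mod2 f = f

record IsGaloisModulus (r : ℕ) (h : CommutativeRing.Carrier ℤ₄[X]) : Set where
  field
    monic            : Polynomial.IsMonicOfDegree (ℤ/ 4) r h
    irreducible-mod2 : IsIrreducible 𝔽₂[X] (mod2 h)

GaloisRing : CommutativeRing.Carrier ℤ₄[X] → CommutativeRing 0ℓ 0ℓ
GaloisRing h = ℤ₄[X] /⟨ h ⟩

module _ {R : Ring c ℓ} (M : RightModule R m ℓm) where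

  open Ring R using (Carrier; _≈_; 0#)
  open RightModule M
  open Summation +ᴹ-commutativeMonoid using (sum)

  record Submodule p : Set (c ⊔ m ⊔ ℓm ⊔ Level.suc p) where
    field
      Member    : Pred Carrierᴹ p
      resp      : ∀ {x y} → x ≈ᴹ y → x ∈ Member → y ∈ Member
      0-closed  : 0ᴹ ∈ Member
      +-closed  : ∀ {x y} → x ∈ Member → y ∈ Member → x +ᴹ y ∈ Member
      *ᵣ-closed : ∀ {x} → x ∈ Member → ∀ a → x *ᵣ a ∈ Member

  linearCombination : ∀ {n} → Vector Carrierᴹ n → Vector Carrier n → Carrierᴹ
  linearCombination b a = sum λ i → b i *ᵣ a i

  record IsBasis {n} (N : Submodule p) (b : Vector Carrierᴹ n)
                 : Set (c ⊔ ℓ ⊔ m ⊔ ℓm ⊔ p) where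
    open Submodule N
    field
      contained   : ∀ i → b i ∈ Member
      spanning    : ∀ {x} → x ∈ Member → ∃ λ a → x ≈ᴹ linearCombination b a
      independent : ∀ a → linearCombination b a ≈ᴹ 0ᴹ → ∀ i → a i ≈ 0#

  IsFreeOfRank : ℕ → Submodule p → Set (c ⊔ ℓ ⊔ m ⊔ ℓm ⊔ p)
  IsFreeOfRank n N = ∃ λ (b : Vector Carrierᴹ n) → IsBasis N b

record IncidenceStructure a ℓa b i : Set (Level.suc (a ⊔ ℓa ⊔ b ⊔ i)) where
  infix 4 _I_
  field
    points : Setoid a ℓa
    Line   : Set b
  open Setoid points public using () renaming (Carrier to Point; _≈_ to _≈ᴾ_)
  field
    _I_ : Point → Line → Set i

module Arcs {a ℓa b i} (Π : IncidenceStructure a ℓa b i) where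

  open IncidenceStructure Π

  record PointSet (k : ℕ) : Set (a ⊔ ℓa) where
    field
      point    : Fin k → Point
      distinct : Injective _≡_ _≈ᴾ_ point

  -- Exactly n points of K lie on L: S is the set of (indices of) these points.
  -- Distinct indices give distinct points, so ∣ S ∣ counts points.

  MeetsInPoints : ∀ {k} → PointSet k → Line → ℕ → Set i
  MeetsInPoints {k} K L n =
    ∃ λ (S : Subset k) → (∀ j → j ∈ˢ S ⇔ PointSet.point K j I L) × ∣ S ∣ ≡ n

  IsArc : ∀ {k} → PointSet k → ℕ → Set (b ⊔ i)
  IsArc K n = ∀ L → ∃ λ s → MeetsInPoints K L s × s ≤ n

  ArcExists : ℕ → ℕ → Set (a ⊔ ℓa ⊔ b ⊔ i)
  ArcExists k n = ∃ λ (K : PointSet k) → IsArc K n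

  -- The relation "mₙ = k", where mₙ is the largest size of a (k,n)-arc.

  record MaxArcSize (n k : ℕ) : Set (a ⊔ ℓa ⊔ b ⊔ i) where
    field
      attained : ArcExists k n
      maximal  : ∀ k′ → ArcExists k′ n → k′ ≤ k

module _ (R : Ring c ℓ) where

  R³ : RightModule R c ℓ
  R³ = DirectProduct.rightModule R₁ (DirectProduct.rightModule R₁ R₁)
    where R₁ = TensorUnit.rightModule {R = R}

  FreeSubmodule : ℕ → Set (Level.suc (c ⊔ ℓ))
  FreeSubmodule n = Σ (Submodule R³ (c ⊔ ℓ)) (IsFreeOfRank R³ n)

  ⟦_⟧ : ∀ {n} → FreeSubmodule n → Pred (RightModule.Carrierᴹ R³) (c ⊔ ℓ)
  ⟦ N ⟧ = Submodule.Member (proj₁ N)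

  -- Points and lines are submodules together with a chosen basis; equality of
  -- points and incidence depend on the underlying submodules only.

  PHG₂ : IncidenceStructure (Level.suc (c ⊔ ℓ)) (c ⊔ ℓ) (Level.suc (c ⊔ ℓ)) (c ⊔ ℓ)
  PHG₂ = record
    { points = record
      { Carrier       = FreeSubmodule 1
      ; _≈_           = λ P Q → ⟦ P ⟧ ≐ ⟦ Q ⟧
      ; isEquivalence = record { refl = ≐-refl ; sym = ≐-sym ; trans = ≐-trans }
      }
    ; Line = FreeSubmodule 2
    ; _I_  = λ P L → ⟦ P ⟧ ⊆ ⟦ L ⟧
    }

{-# OPTIONS --safe #-}

-- Lines and points of the plane are both represented by unimodular vectors of R³, with incidence u ∙ w = 0.
-- Let F be the residue field.  For x in F³, let τ x be the vector of squares x² corrected by twice a quadratic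
-- map.  Since (x + y)² = x² + y² + 2xy, for x, y independent over F the determinant of τ x, τ y, τ (x + y) is 2
-- times a cubic form at x × y, and the quadratic map is chosen so that this form is the norm form of a cubic
-- extension of F.  It has no nontrivial zero, so the points τ x form a hyperoval: there is one in each of the
-- q² + q + 1 neighbour classes, and by counting over the pencil of a point every line meets it in 0 or 2 points.
-- The arc is dual to it: it consists of the u such that u^⊥ misses the hyperoval.  Its size and its line
-- intersections follow by counting pairs (u, t) with u ∙ t = 0.
--
-- For the upper bound, let u be the largest number of points of a (k, q²/2)-arc in a neighbour class.  If
-- u ≤ (q² - q)/2, sum over the classes.  Otherwise count the points on the q² + q lines through a point of
-- that class: k + (q - 1)u + q² ≤ (q² + q)q²/2.

module Submission where

open import Algebra.Bundles using (CommutativeRing)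
import Algebra.Definitions.RawMagma as Divisibility
import Algebra.Properties.Ring as RingProperties
import Algebra.Properties.Semiring.Mult.TCOptimised as Multiples
open import Data.Bool.Base using (true; false)
open import Data.Fin.Base using (Fin; zero; suc; combine)
open import Data.Fin.Patterns using (0F; 1F; 2F)
import Data.Fin.Properties as Fin
open import Data.Fin.Subset using (Subset; ∣_∣) renaming (_∈_ to _∈ˢ_)
open import Data.List.Base using (List; []; _∷_; _++_; length; map; filter; cartesianProductWith; lookup; allFin)
import Data.List.Properties as List
open import Data.List.Relation.Unary.All as All using (All; []; _∷_)
import Data.List.Relation.Unary.All.Properties as All
open import Data.List.Relation.Unary.Any as Any using (Any)
open import Data.Nat.Base as ℕ using (ℕ; zero; suc; _≤_; _<_; _≥_; z≤n; s≤s; _^_; _∸_; _/_)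
import Data.Nat.Divisibility as ℕ using (divides)
open import Data.Nat.DivMod using (m*n/n≡m; m/n*n≡m; /-monoˡ-≤)
import Data.Nat.Properties as ℕ
open import Data.Nat.Tactic.RingSolver using (solve-∀)
open import Data.Product.Base using (_×_; _,_; proj₁; proj₂; ∃)
open import Data.Sum.Base using (_⊎_; inj₁; inj₂; [_,_]′)
open import Data.Vec.Base as Vec using (Vec; []; _∷_; here; there)
import Data.Vec.Properties as Vec
open import Function.Base using (_∘_; id; const)
open import Function.Bundles using (_⇔_; mk⇔; Equivalence)
open import Level using (0ℓ)
open import Relation.Binary.Definitions using (Decidable)
open import Relation.Binary.PropositionalEquality as ≡ using (_≡_)
import Relation.Binary.Reasoning.Setoid as SetoidReasoning
open import Relation.Nullary.Decidable as Dec using (Dec; yes; no; does; _×-dec_; ¬?)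
open import Relation.Nullary.Negation using (¬_; contradiction)
open import Tactic.RingSolver.Core.Expression using (Expr)
open import Defs

-- Ring solver

-- For the plain squares x² the cubic form at b = x ⨯ y is b₁b₂b₃, which vanishes as soon as one
-- coordinate does: this is the obstacle. Modulo 2, the polar form of a product of two coordinates
-- is a coordinate of b, and the cross product of the two vectors of squares is the vector of the
-- bᵢ². A correction by twice a quadratic map therefore adds a form b₁²ℓ₁(b) + b₂²ℓ₂(b) + b₃²ℓ₃(b)
-- with arbitrary linear ℓᵢ. Every cubic form with coefficient 1 at b₁b₂b₃ arises in this way, among
-- them the norm form divided by its coefficient c at that monomial. Three noncollinear classes
-- cause no trouble, since the determinant is then a unit. So a line has at most two points of the
-- hyperoval; over the lines through one of its points the average is exactly 2, hence the bound is
-- attained on each of them. The threshold (q² - q)/2 in the upper bound is the value of u at which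
-- both estimates of k equal (q⁴ - q)/2. All counting identities are stated additively in ℕ, and
-- doubled where halves occur, so that no truncated subtraction enters before the end.

infix 4 _kills_
-- With this variant of multiples, `4 ×′ 1#` computes to `1# + 1# + 1# + 1#`, so the fields named
-- `4≈0` below are accepted as proofs of it.
_kills_ : ℕ → CommutativeRing 0ℓ 0ℓ → Set
m kills R = m ×′ 1# ≈ 0#
  where
  open CommutativeRing R
  open Multiples semiring using () renaming (_×_ to _×′_)

-- Coefficients are reduced modulo the characteristic, so that m has to be a literal in every application.
module CharacteristicSolver (R : CommutativeRing 0ℓ 0ℓ) (m : ℕ) (char : suc m kills R) where

  open import Algebra.Bundles using (RawRing)
  import Algebra.Properties.Semiring.Exp.TCOptimised as Exponentiation
  open import Data.Bool.Base using (Bool; T; true; false)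
  open import Data.Maybe.Base using (nothing)
  open import Data.Nat.DivMod using (_%_; _/_; m≡m%n+[m/n]*n)
  import Relation.Binary.Reflection as Reflection
  import Tactic.RingSolver.Core.AlmostCommutativeRing as Almost
  open import Tactic.RingSolver.Core.Expression using (Expr; Κ; Ι; _⊕_; _⊗_; _⊛_; ⊝_; module Eval)
  import Tactic.RingSolver.Core.Polynomial.Base as PolynomialBase
  import Tactic.RingSolver.Core.Polynomial.Homomorphism as PolynomialHomomorphism
  open import Tactic.RingSolver.Core.Polynomial.Parameters using (Homomorphism)
  import Tactic.RingSolver.Core.Polynomial.Semantics as PolynomialSemantics

  open CommutativeRing R
  open Exponentiation semiring using (^-congˡ)
  open Multiples semiring renaming (_×_ to _×′_)
  open import Relation.Binary.Reasoning.Setoid setoid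

  private
    ⟦_⟧ℕ : ℕ → Carrier
    ⟦ n ⟧ℕ = n ×′ 1#

    reduce : ∀ n → ⟦ n % suc m ⟧ℕ ≈ ⟦ n ⟧ℕ
    reduce n = sym (begin
      ⟦ n ⟧ℕ                                        ≡⟨ ≡.cong ⟦_⟧ℕ (m≡m%n+[m/n]*n n (suc m)) ⟩
      ⟦ n % suc m ℕ.+ n / suc m ℕ.* suc m ⟧ℕ        ≈⟨ ×-homo-+ 1# (n % suc m) _ ⟩
      ⟦ n % suc m ⟧ℕ + ⟦ n / suc m ℕ.* suc m ⟧ℕ     ≈⟨ +-congˡ (×1-homo-* (n / suc m) (suc m)) ⟩
      ⟦ n % suc m ⟧ℕ + ⟦ n / suc m ⟧ℕ * ⟦ suc m ⟧ℕ  ≈⟨ +-congˡ (*-congˡ char) ⟩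
      ⟦ n % suc m ⟧ℕ + ⟦ n / suc m ⟧ℕ * 0#          ≈⟨ +-congˡ (zeroʳ _) ⟩
      ⟦ n % suc m ⟧ℕ + 0#                           ≈⟨ +-identityʳ _ ⟩
      ⟦ n % suc m ⟧ℕ                                ∎)

    -- Negation is multiplication by m, which is -1 modulo m + 1. Coefficients that reduce to zero
    -- are recognised, so identities valid only in the given characteristic also hold by
    -- normalisation.
    coefficients : RawRing 0ℓ 0ℓ
    coefficients = record
      { Carrier = ℕ ; _≈_ = _≡_
      ; _+_ = λ k n → (k ℕ.+ n) % suc m ; _*_ = λ k n → (k ℕ.* n) % suc m
      ; -_ = λ n → (m ℕ.* n) % suc m ; 0# = 0 ; 1# = 1 }

    neg : ∀ n → ⟦ m ℕ.* n ⟧ℕ ≈ - ⟦ n ⟧ℕ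
    neg n = begin
      ⟦ m ℕ.* n ⟧ℕ                       ≈⟨ +-identityˡ _ ⟨
      0# + ⟦ m ℕ.* n ⟧ℕ                  ≈⟨ +-congʳ (-‿inverseˡ _) ⟨
      - ⟦ n ⟧ℕ + ⟦ n ⟧ℕ + ⟦ m ℕ.* n ⟧ℕ   ≈⟨ +-assoc _ _ _ ⟩
      - ⟦ n ⟧ℕ + (⟦ n ⟧ℕ + ⟦ m ℕ.* n ⟧ℕ) ≈⟨ +-congˡ (×-homo-+ 1# n (m ℕ.* n)) ⟨
      - ⟦ n ⟧ℕ + ⟦ suc m ℕ.* n ⟧ℕ        ≈⟨ +-congˡ (×1-homo-* (suc m) n) ⟩
      - ⟦ n ⟧ℕ + ⟦ suc m ⟧ℕ * ⟦ n ⟧ℕ     ≈⟨ +-congˡ (*-congʳ char) ⟩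
      - ⟦ n ⟧ℕ + 0# * ⟦ n ⟧ℕ             ≈⟨ +-congˡ (zeroˡ _) ⟩
      - ⟦ n ⟧ℕ + 0#                      ≈⟨ +-identityʳ _ ⟩
      - ⟦ n ⟧ℕ                           ∎

    isZero : ℕ → Bool
    isZero zero    = true
    isZero (suc _) = false

    isZero-sound : ∀ n → T (isZero n) → 0# ≈ ⟦ n ⟧ℕ
    isZero-sound zero _ = refl

    homomorphism : Homomorphism 0ℓ 0ℓ 0ℓ 0ℓ
    homomorphism = record
      { from     = record { rawRing = coefficients ; isZero = isZero }
      ; to       = Almost.fromCommutativeRing R (λ _ → nothing)
      ; morphism = record
        { ⟦_⟧    = ⟦_⟧ℕ
        ; +-homo = λ k n → trans (reduce (k ℕ.+ n)) (×-homo-+ 1# k n)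
        ; *-homo = λ k n → trans (reduce (k ℕ.* n)) (×1-homo-* k n)
        ; -‿homo = λ n → trans (reduce (m ℕ.* n)) (neg n)
        ; 0-homo = refl
        ; 1-homo = refl }
      ; Zero-C⟶Zero-R = isZero-sound }

  open PolynomialBase (Homomorphism.from homomorphism)
  open PolynomialSemantics homomorphism renaming (⟦_⟧ to ⟦_⟧ₚ)
  open PolynomialHomomorphism homomorphism
  open Eval (CommutativeRing.rawRing R) ⟦_⟧ℕ using () renaming (⟦_⟧ to ⟦_⟧ᴱ) public

  private
    norm : ∀ {n} → Expr ℕ n → Poly n
    norm (Κ x)   = κ x
    norm (Ι x)   = ι x
    norm (x ⊕ y) = norm x ⊞ norm y
    norm (x ⊗ y) = norm x ⊠ norm y
    norm (⊝ x)   = ⊟ norm x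
    norm (x ⊛ i) = norm x ⊡ i

  ⟦_⇓⟧ : ∀ {n} → Expr ℕ n → Vec Carrier n → Carrier
  ⟦ e ⇓⟧ = ⟦ norm e ⟧ₚ

  private
    correct : ∀ {n} (e : Expr ℕ n) ρ → ⟦ e ⇓⟧ ρ ≈ ⟦ e ⟧ᴱ ρ
    correct (Κ x)   ρ = κ-hom x ρ
    correct (Ι x)   ρ = ι-hom x ρ
    correct (x ⊕ y) ρ = trans (⊞-hom (norm x) (norm y) ρ) (+-cong (correct x ρ) (correct y ρ))
    correct (x ⊗ y) ρ = trans (⊠-hom (norm x) (norm y) ρ) (*-cong (correct x ρ) (correct y ρ))
    correct (⊝ x)   ρ = trans (⊟-hom (norm x) ρ) (-‿cong (correct x ρ))
    correct (x ⊛ i) ρ = trans (⊡-hom (norm x) i ρ) (^-congˡ i (correct x ρ))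

  open Reflection setoid Ι ⟦_⟧ᴱ ⟦_⇓⟧ correct public
    using (prove)

-- Counting in lists

module Counting where

  open import Data.Bool.Base using (if_then_else_)
  open import Data.List.Relation.Unary.Any using (here; there)
  open import Data.Nat.Base using (_+_; _*_)
  open import Level using (Level)
  open import Relation.Binary.PropositionalEquality
    using (_≢_; refl; sym; trans; cong; cong₂; module ≡-Reasoning)

  private
    variable
      a b c p q : Level
      A : Set a
      B : Set b
      C : Set c
      P : Set p
      Q : Set q

  ∑ : List A → (A → ℕ) → ℕ
  ∑ []       f = 0
  ∑ (x ∷ xs) f = f x + ∑ xs f

  syntax ∑ xs (λ x → e) = ∑[ x ∈ xs ] e

  infix 5 ∑

  𝟙 : Dec P → ℕ
  𝟙 P? = if does P? then 1 else 0

  𝟙-yes : (P? : Dec P) → P → 𝟙 P? ≡ 1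
  𝟙-yes (yes _) _ = refl
  𝟙-yes (no ¬p) p = contradiction p ¬p

  𝟙-no : (P? : Dec P) → ¬ P → 𝟙 P? ≡ 0
  𝟙-no (yes p) ¬p = contradiction p ¬p
  𝟙-no (no _)  _  = refl

  𝟙-cong : (P? : Dec P) (Q? : Dec Q) → (P → Q) → (Q → P) → 𝟙 P? ≡ 𝟙 Q?
  𝟙-cong (yes p) Q? to from = sym (𝟙-yes Q? (to p))
  𝟙-cong (no ¬p) Q? to from = sym (𝟙-no Q? (¬p ∘ from))

  𝟙-mono : (P? : Dec P) (Q? : Dec Q) → (P → Q) → 𝟙 P? ≤ 𝟙 Q?
  𝟙-mono (yes p) Q? to = ℕ.≤-reflexive (sym (𝟙-yes Q? (to p)))
  𝟙-mono (no _)  Q? to = z≤n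

  𝟙-⊎ : ∀ {R : Set c} (P? : Dec P) (Q? : Dec Q) (R? : Dec R) → (P → Q ⊎ R) → 𝟙 P? ≤ 𝟙 Q? + 𝟙 R?
  𝟙-⊎ (no _)  Q? R? to = z≤n
  𝟙-⊎ (yes p) Q? R? to with to p
  ... | inj₁ q = ℕ.≤-trans (ℕ.≤-reflexive (sym (𝟙-yes Q? q))) (ℕ.m≤m+n _ _)
  ... | inj₂ r = ℕ.≤-trans (ℕ.≤-reflexive (sym (𝟙-yes R? r))) (ℕ.m≤n+m _ _)

  𝟙-× : (P? : Dec P) (Q? : Dec Q) → 𝟙 (P? ×-dec Q?) ≡ 𝟙 P? * 𝟙 Q?
  𝟙-× (yes _) Q? = sym (ℕ.+-identityʳ _)
  𝟙-× (no _)  Q? = refl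

  ∑-congᴬ : ∀ {xs : List A} {f g : A → ℕ} → All (λ x → f x ≡ g x) xs → ∑ xs f ≡ ∑ xs g
  ∑-congᴬ []         = refl
  ∑-congᴬ (fx ∷ fxs) = cong₂ _+_ fx (∑-congᴬ fxs)

  ∑-cong : ∀ (xs : List A) {f g : A → ℕ} → (∀ x → f x ≡ g x) → ∑ xs f ≡ ∑ xs g
  ∑-cong []       f≡g = refl
  ∑-cong (x ∷ xs) f≡g = cong₂ _+_ (f≡g x) (∑-cong xs f≡g)

  ∑-mono : ∀ (xs : List A) {f g : A → ℕ} → (∀ x → f x ≤ g x) → ∑ xs f ≤ ∑ xs g
  ∑-mono []       f≤g = z≤n
  ∑-mono (x ∷ xs) f≤g = ℕ.+-mono-≤ (f≤g x) (∑-mono xs f≤g)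

  ∑-monoᴬ : ∀ {xs : List A} {f g : A → ℕ} → All (λ x → f x ≤ g x) xs → ∑ xs f ≤ ∑ xs g
  ∑-monoᴬ []         = z≤n
  ∑-monoᴬ (fx ∷ fxs) = ℕ.+-mono-≤ fx (∑-monoᴬ fxs)

  ∑-const : ∀ (xs : List A) n → ∑ xs (const n) ≡ length xs * n
  ∑-const []       n = refl
  ∑-const (x ∷ xs) n = cong (n +_) (∑-const xs n)

  ∑-zero : ∀ (xs : List A) → ∑ xs (const 0) ≡ 0
  ∑-zero []       = refl
  ∑-zero (x ∷ xs) = ∑-zero xs

  ∑-+ : ∀ (xs : List A) (f g : A → ℕ) → ∑[ x ∈ xs ] (f x + g x) ≡ ∑ xs f + ∑ xs g
  ∑-+ []       f g = refl
  ∑-+ (x ∷ xs) f g = trans (cong (f x + g x +_) (∑-+ xs f g)) (interchange (f x) (g x) _ _)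
    where
    interchange : ∀ i j k l → (i + j) + (k + l) ≡ (i + k) + (j + l)
    interchange = solve-∀

  ∑-*ˡ : ∀ (xs : List A) n (f : A → ℕ) → ∑[ x ∈ xs ] (n * f x) ≡ n * ∑ xs f
  ∑-*ˡ []       n f = sym (ℕ.*-zeroʳ n)
  ∑-*ˡ (x ∷ xs) n f = trans (cong (n * f x +_) (∑-*ˡ xs n f)) (sym (ℕ.*-distribˡ-+ n (f x) _))

  ∑-*ʳ : ∀ (xs : List A) n (f : A → ℕ) → ∑[ x ∈ xs ] (f x * n) ≡ ∑ xs f * n
  ∑-*ʳ []       n f = refl
  ∑-*ʳ (x ∷ xs) n f = trans (cong (f x * n +_) (∑-*ʳ xs n f)) (sym (ℕ.*-distribʳ-+ n (f x) _))

  ∑-++ : ∀ (xs ys : List A) (f : A → ℕ) → ∑ (xs ++ ys) f ≡ ∑ xs f + ∑ ys f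
  ∑-++ []       ys f = refl
  ∑-++ (x ∷ xs) ys f = trans (cong (f x +_) (∑-++ xs ys f)) (sym (ℕ.+-assoc (f x) _ _))

  ∑-map : ∀ (h : A → B) (xs : List A) (f : B → ℕ) → ∑ (map h xs) f ≡ ∑ xs (f ∘ h)
  ∑-map h []       f = refl
  ∑-map h (x ∷ xs) f = cong (f (h x) +_) (∑-map h xs f)

  ∑-cartesian : ∀ (h : A → B → C) (xs : List A) (ys : List B) (f : C → ℕ) →
    ∑ (cartesianProductWith h xs ys) f ≡ ∑[ x ∈ xs ] ∑[ y ∈ ys ] f (h x y)
  ∑-cartesian h []       ys f = refl
  ∑-cartesian h (x ∷ xs) ys f =
    trans (∑-++ (map (h x) ys) _ f) (cong₂ _+_ (∑-map (h x) ys f) (∑-cartesian h xs ys f))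

  length-cartesian : ∀ (h : A → B → C) (xs : List A) (ys : List B) →
    length (cartesianProductWith h xs ys) ≡ length xs * length ys
  length-cartesian h []       ys = refl
  length-cartesian h (x ∷ xs) ys = trans (List.length-++ (map (h x) ys))
    (cong₂ _+_ (List.length-map (h x) ys) (length-cartesian h xs ys))

  ∑-swap : ∀ (xs : List A) (ys : List B) (f : A → B → ℕ) →
    ∑[ x ∈ xs ] ∑[ y ∈ ys ] f x y ≡ ∑[ y ∈ ys ] ∑[ x ∈ xs ] f x y
  ∑-swap []       ys f = sym (∑-zero ys)
  ∑-swap (x ∷ xs) ys f =
    trans (cong (∑ ys (f x) +_) (∑-swap xs ys f)) (sym (∑-+ ys (f x) (λ y → ∑[ x ∈ xs ] f x y)))

  ∑-× : ∀ (xs : List A) (ys : List B) (f : A → ℕ) (g : B → ℕ) →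
    ∑[ x ∈ xs ] ∑[ y ∈ ys ] (f x * g y) ≡ ∑ xs f * ∑ ys g
  ∑-× xs ys f g = trans (∑-cong xs (λ x → ∑-*ˡ ys (f x) g)) (∑-*ʳ xs (∑ ys g) f)

  All×Any⇒∃ : ∀ {P : A → Set p} {Q : A → Set q} {xs} → All P xs → Any Q xs → ∃ λ x → P x × Q x
  All×Any⇒∃ (px ∷ _)   (here qx)  = _ , px , qx
  All×Any⇒∃ (_  ∷ pxs) (there ∃q) = All×Any⇒∃ pxs ∃q

  lookup⇒Any : ∀ {P : A → Set p} xs i → P (lookup xs i) → Any P xs
  lookup⇒Any (x ∷ xs) zero    px = here px
  lookup⇒Any (x ∷ xs) (suc i) px = there (lookup⇒Any xs i px)

  module _ {P : A → Set p} (P? : ∀ x → Dec (P x)) where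

    ∑-filter : ∀ xs (f : A → ℕ) → ∑ (filter P? xs) f ≡ ∑[ x ∈ xs ] (𝟙 (P? x) * f x)
    ∑-filter []       f = refl
    ∑-filter (x ∷ xs) f with P? x
    ... | yes _ = cong₂ _+_ (sym (ℕ.+-identityʳ _)) (∑-filter xs f)
    ... | no  _ = ∑-filter xs f

    count>0 : ∀ xs → 1 ≤ ∑[ x ∈ xs ] 𝟙 (P? x) → Any P xs
    count>0 (x ∷ xs) 1≤ with P? x
    ... | yes px = here px
    ... | no  _  = there (count>0 xs 1≤)

    Any⇒count>0 : ∀ {xs} → Any P xs → 1 ≤ ∑[ x ∈ xs ] 𝟙 (P? x)
    Any⇒count>0 (here {x} px)   = ℕ.≤-trans (ℕ.≤-reflexive (sym (𝟙-yes (P? x) px))) (ℕ.m≤m+n _ _)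
    Any⇒count>0 (there ∃p)  = ℕ.≤-trans (Any⇒count>0 ∃p) (ℕ.m≤n+m _ _)

    lookup⇒count>0 : ∀ xs i → P (lookup xs i) → 1 ≤ ∑[ x ∈ xs ] 𝟙 (P? x)
    lookup⇒count>0 xs i px = Any⇒count>0 (lookup⇒Any xs i px)

    count≤1⇒unique : ∀ xs → ∑[ x ∈ xs ] 𝟙 (P? x) ≤ 1 →
      ∀ i j → P (lookup xs i) → P (lookup xs j) → i ≡ j
    count≤1⇒unique (x ∷ xs) ≤1 zero    zero    px py = refl
    count≤1⇒unique (x ∷ xs) ≤1 zero    (suc j) px py = contradiction
      (ℕ.≤-trans (ℕ.+-mono-≤ (ℕ.≤-reflexive (sym (𝟙-yes (P? x) px))) (lookup⇒count>0 xs j py)) ≤1) λ { (s≤s ()) }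
    count≤1⇒unique (x ∷ xs) ≤1 (suc i) zero    px py = contradiction
      (ℕ.≤-trans (ℕ.+-mono-≤ (ℕ.≤-reflexive (sym (𝟙-yes (P? x) py))) (lookup⇒count>0 xs i px)) ≤1) λ { (s≤s ()) }
    count≤1⇒unique (x ∷ xs) ≤1 (suc i) (suc j) px py =
      cong suc (count≤1⇒unique xs (ℕ.≤-trans (ℕ.m≤n+m _ _) ≤1) i j px py)

  -- The equality case of `∑-mono`. It turns a bound that is attained on average into an equality
  -- for every term.
  ∑-≡⇒All-≡ : ∀ (xs : List A) {f g : A → ℕ} → (∀ x → f x ≤ g x) → ∑ xs f ≡ ∑ xs g → All (λ x → f x ≡ g x) xs
  ∑-≡⇒All-≡ []       f≤g eq = []
  ∑-≡⇒All-≡ (x ∷ xs) {f} {g} f≤g eq =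
    head-≡ ∷ ∑-≡⇒All-≡ xs f≤g (ℕ.+-cancelˡ-≡ (g x) _ _ (trans (cong (_+ ∑ xs f) (sym head-≡)) eq))
    where
    head-≡ : f x ≡ g x
    head-≡ = ℕ.≤-antisym (f≤g x) (ℕ.+-cancelʳ-≤ (∑ xs f) (g x) (f x)
      (ℕ.≤-trans (ℕ.+-monoʳ-≤ (g x) (∑-mono xs f≤g)) (ℕ.≤-reflexive (sym eq))))

  ∑-allFin-suc : ∀ n (f : Fin (suc n) → ℕ) → ∑ (allFin (suc n)) f ≡ f zero + ∑ (allFin n) (f ∘ suc)
  ∑-allFin-suc n f = cong (f zero +_)
    (trans (cong (λ js → ∑ js f) (sym (List.map-tabulate id suc))) (∑-map suc (allFin n) f))

  ∑-lookup : ∀ (xs : List A) (f : A → ℕ) → ∑ xs f ≡ ∑ (allFin (length xs)) (f ∘ lookup xs)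
  ∑-lookup []       f = refl
  ∑-lookup (x ∷ xs) f =
    trans (cong (f x +_) (∑-lookup xs f)) (sym (∑-allFin-suc (length xs) (f ∘ lookup (x ∷ xs))))

  allFin-count : ∀ {n} (i : Fin n) → ∑[ j ∈ allFin n ] 𝟙 (j Fin.≟ i) ≡ 1
  allFin-count {suc n} zero = trans (∑-allFin-suc n (λ j → 𝟙 (j Fin.≟ zero)))
    (cong suc (trans (∑-cong (allFin n) λ j → 𝟙-no (suc j Fin.≟ zero) λ ()) (∑-zero (allFin n))))
  allFin-count {suc n} (suc i) = trans (∑-allFin-suc n (λ j → 𝟙 (j Fin.≟ suc i)))
    (trans (∑-cong (allFin n) λ j → 𝟙-cong (suc j Fin.≟ suc i) (j Fin.≟ i) Fin.suc-injective (cong suc))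
    (allFin-count i))

  private
    variable
      n : ℕ

  -- A missed value could be punched out of the codomain, leaving an injection into a smaller set.
  injective⇒surjective : (f : Fin n → Fin n) → (∀ {i j} → f i ≡ f j → i ≡ j) → ∀ y → ∃ λ x → f x ≡ y
  injective⇒surjective {suc n} f f-inj y with Fin.any? (λ x → f x Fin.≟ y)
  ... | yes ∃x = ∃x
  ... | no ∄x  = contradiction
    (Fin.injective⇒≤ (λ {i} {j} → f-inj ∘ Fin.punchOut-injective (y≢f i) (y≢f j))) ℕ.1+n≰n
    where
    y≢f : ∀ x → y ≢ f x
    y≢f x y≡fx = ∄x (x , sym y≡fx)

  -- A section g of f is injective, hence surjective, so f is inverse to g on both sides.
  surjective⇒injective : (f : Fin n → Fin n) → (∀ y → ∃ λ x → f x ≡ y) → ∀ {i j} → f i ≡ f j → i ≡ j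
  surjective⇒injective {n} f f-surj {i} {j} fi≡fj = begin
    i             ≡⟨ proj₂ (g-surj i) ⟨
    g i′          ≡⟨ cong g (f∘g i′) ⟨
    g (f (g i′))  ≡⟨ cong (g ∘ f) (proj₂ (g-surj i)) ⟩
    g (f i)       ≡⟨ cong g fi≡fj ⟩
    g (f j)       ≡⟨ cong (g ∘ f) (proj₂ (g-surj j)) ⟨
    g (f (g j′))  ≡⟨ cong g (f∘g j′) ⟩
    g j′          ≡⟨ proj₂ (g-surj j) ⟩
    j             ∎
    where
    open ≡-Reasoning
    g : Fin n → Fin n
    g = proj₁ ∘ f-surj
    f∘g : ∀ y → f (g y) ≡ y
    f∘g = proj₂ ∘ f-surj
    g-surj : ∀ x → ∃ λ y → g y ≡ x
    g-surj = injective⇒surjective g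
      (λ {y} {z} gy≡gz → trans (sym (f∘g y)) (trans (cong f gy≡gz) (f∘g z)))
    i′ j′ : Fin n
    i′ = proj₁ (g-surj i)
    j′ = proj₁ (g-surj j)

open Counting

-- Vectors in R³

-- Only raw operations are assumed, so that the same formulas can be read in a ring and among the
-- expressions of the solver. Evaluating a formal vector expression then yields the intended vector
-- by computation.
module TripleOperations {A : Set} (_+_ _*_ : A → A → A) (-_ : A → A) where

  infixl 6 _+ᵥ_
  infixl 7 _*ᵥ_ _∘ᵥ_ _⨯_
  infix  8 _∙_

  Triple : Set
  Triple = A × A × A

  _+ᵥ_ _∘ᵥ_ _⨯_ : Triple → Triple → Triple
  (x , y , z) +ᵥ (x′ , y′ , z′) = x + x′ , y + y′ , z + z′
  (x , y , z) ∘ᵥ (x′ , y′ , z′) = x * x′ , y * y′ , z * z′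
  (x , y , z) ⨯ (x′ , y′ , z′) =
    (y * z′) + (- (z * y′)) , (z * x′) + (- (x * z′)) , (x * y′) + (- (y * x′))

  _*ᵥ_ : Triple → A → Triple
  (x , y , z) *ᵥ a = x * a , y * a , z * a

  _∙_ : Triple → Triple → A
  (x , y , z) ∙ (x′ , y′ , z′) = (x * x′) + ((y * y′) + (z * z′))

module Vectors (R : CommutativeRing 0ℓ 0ℓ) where

  open CommutativeRing R
  open TripleOperations _+_ _*_ (-_) public

  V : Set
  V = Triple

  0ᵥ : V
  0ᵥ = 0# , 0# , 0#

  infix 4 _≋_
  _≋_ : V → V → Set
  (x , y , z) ≋ (x′ , y′ , z′) = x ≈ x′ × y ≈ y′ × z ≈ z′

  ≋-refl : ∀ {u} → u ≋ u
  ≋-refl = refl , refl , refl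

  ≋-sym : ∀ {u v} → u ≋ v → v ≋ u
  ≋-sym (e , f , g) = sym e , sym f , sym g

  ≋-trans : ∀ {u v w} → u ≋ v → v ≋ w → u ≋ w
  ≋-trans (e , f , g) (e′ , f′ , g′) = trans e e′ , trans f f′ , trans g g′

  +ᵥ-cong : ∀ {u u′ v v′} → u ≋ u′ → v ≋ v′ → u +ᵥ v ≋ u′ +ᵥ v′
  +ᵥ-cong (e , f , g) (e′ , f′ , g′) = +-cong e e′ , +-cong f f′ , +-cong g g′

  ∘ᵥ-cong : ∀ {u u′ v v′} → u ≋ u′ → v ≋ v′ → u ∘ᵥ v ≋ u′ ∘ᵥ v′
  ∘ᵥ-cong (e , f , g) (e′ , f′ , g′) = *-cong e e′ , *-cong f f′ , *-cong g g′

  *ᵥ-cong : ∀ {u u′ a a′} → u ≋ u′ → a ≈ a′ → u *ᵥ a ≋ u′ *ᵥ a′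
  *ᵥ-cong (e , f , g) a≈ = *-cong e a≈ , *-cong f a≈ , *-cong g a≈

  ∙-cong : ∀ {u u′ v v′} → u ≋ u′ → v ≋ v′ → u ∙ v ≈ u′ ∙ v′
  ∙-cong (e , f , g) (e′ , f′ , g′) = +-cong (*-cong e e′) (+-cong (*-cong f f′) (*-cong g g′))

  ⨯-cong : ∀ {u u′ v v′} → u ≋ u′ → v ≋ v′ → u ⨯ v ≋ u′ ⨯ v′
  ⨯-cong (e , f , g) (e′ , f′ , g′) =
    +-cong (*-cong f g′) (-‿cong (*-cong g f′)) ,
    +-cong (*-cong g e′) (-‿cong (*-cong e g′)) ,
    +-cong (*-cong e f′) (-‿cong (*-cong f e′))

module VectorSolver (R : CommutativeRing 0ℓ 0ℓ) (m : ℕ) (char : suc m kills R) where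

  open CommutativeRing R
  open Vectors R
  open CharacteristicSolver R m char using (⟦_⟧ᴱ; ⟦_⇓⟧; prove)

  private
    module Formal {n} = TripleOperations {Expr ℕ n} Expr._⊕_ Expr._⊗_ Expr.⊝_

  open Formal public using () renaming
    (_+ᵥ_ to infixl 6 _⊞_; _*ᵥ_ to infixl 7 _⊡_; _∘ᵥ_ to infixl 7 _⊚_; _⨯_ to infixl 7 _⊠_; _∙_ to infix 8 _⊙_)
  open Expr public using (_⊕_; _⊗_; ⊝_; Κ)

  private
    flatten : ∀ {n} → Vec V n → Vec Carrier (n ℕ.* 3)
    flatten []                = []
    flatten ((x , y , z) ∷ ρ) = x ∷ y ∷ z ∷ flatten ρ

    Formula : ℕ → Set → Set
    Formula n A = Vec (Expr ℕ (n ℕ.* 3) × Expr ℕ (n ℕ.* 3) × Expr ℕ (n ℕ.* 3)) n → A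

    instantiate : ∀ {n A} → Formula n A → A
    instantiate {n} F = F (Vec.tabulate λ i → Expr.Ι (combine i 0F) , Expr.Ι (combine i 1F) , Expr.Ι (combine i 2F))

  -- Scalars occurring in an identity are passed as coordinates of triples.

  identity : ∀ {n} (ρ : Vec V n) (F : Formula n (Expr ℕ (n ℕ.* 3) × Expr ℕ (n ℕ.* 3))) →
    let lhs , rhs = instantiate F in
    ⟦ lhs ⇓⟧ (flatten ρ) ≈ ⟦ rhs ⇓⟧ (flatten ρ) → ⟦ lhs ⟧ᴱ (flatten ρ) ≈ ⟦ rhs ⟧ᴱ (flatten ρ)
  identity ρ F = prove (flatten ρ) (proj₁ (instantiate F)) (proj₂ (instantiate F))

  private
    evaluate evaluate↓ : ∀ {n} → Vec V n → Formal.Triple {n ℕ.* 3} → V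
    evaluate  ρ (p , q , r) = ⟦ p ⟧ᴱ (flatten ρ) , ⟦ q ⟧ᴱ (flatten ρ) , ⟦ r ⟧ᴱ (flatten ρ)
    evaluate↓ ρ (p , q , r) = ⟦ p ⇓⟧ (flatten ρ) , ⟦ q ⇓⟧ (flatten ρ) , ⟦ r ⇓⟧ (flatten ρ)

    evaluate-correct : ∀ {n} (ρ : Vec V n) s t → evaluate↓ ρ s ≋ evaluate↓ ρ t → evaluate ρ s ≋ evaluate ρ t
    evaluate-correct ρ (p , q , r) (p′ , q′ , r′) (e , f , g) =
      prove (flatten ρ) p p′ e , prove (flatten ρ) q q′ f , prove (flatten ρ) r r′ g

  identityᵥ : ∀ {n} (ρ : Vec V n) (F : Formula n (Formal.Triple × Formal.Triple)) →
    evaluate↓ ρ (proj₁ (instantiate F)) ≋ evaluate↓ ρ (proj₂ (instantiate F)) →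
    evaluate ρ (proj₁ (instantiate F)) ≋ evaluate ρ (proj₂ (instantiate F))
  identityᵥ ρ F = evaluate-correct ρ (proj₁ (instantiate F)) (proj₂ (instantiate F))

-- Cross products, unimodular vectors and frames

module VectorAlgebra (R : CommutativeRing 0ℓ 0ℓ) (4≈0 : 4 kills R) where

  open CommutativeRing R
  open Vectors R
  open VectorSolver R 3 4≈0
  open RingProperties ring using (-0#≈0#)
  open import Relation.Binary.Reasoning.Setoid setoid

  cramer : ∀ e a b x → x *ᵥ (e ∙ (a ⨯ b)) ≋ a *ᵥ (e ∙ (x ⨯ b)) +ᵥ b *ᵥ (e ∙ (a ⨯ x)) +ᵥ e *ᵥ (x ∙ (a ⨯ b))
  cramer e a b x = identityᵥ (e ∷ a ∷ b ∷ x ∷ [])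
    (λ { (e ∷ a ∷ b ∷ x ∷ []) →
      x ⊡ (e ⊙ (a ⊠ b)) , a ⊡ (e ⊙ (x ⊠ b)) ⊞ b ⊡ (e ⊙ (a ⊠ x)) ⊞ e ⊡ (x ⊙ (a ⊠ b)) })
    ≋-refl

  triple-product : ∀ e u v → u *ᵥ (e ∙ v) ≋ v *ᵥ (e ∙ u) +ᵥ e ⨯ (u ⨯ v)
  triple-product e u v = identityᵥ (e ∷ u ∷ v ∷ [])
    (λ { (e ∷ u ∷ v ∷ []) → u ⊡ (e ⊙ v) , v ⊡ (e ⊙ u) ⊞ e ⊠ (u ⊠ v) }) ≋-refl

  det-*ᵥ : ∀ a b c u → u *ᵥ (a ∙ (b ⨯ c)) ≋ (b ⨯ c) *ᵥ (a ∙ u) +ᵥ (c ⨯ a) *ᵥ (b ∙ u) +ᵥ (a ⨯ b) *ᵥ (c ∙ u)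
  det-*ᵥ a b c u = identityᵥ (a ∷ b ∷ c ∷ u ∷ [])
    (λ { (a ∷ b ∷ c ∷ u ∷ []) →
      u ⊡ (a ⊙ (b ⊠ c)) , (b ⊠ c) ⊡ (a ⊙ u) ⊞ (c ⊠ a) ⊡ (b ⊙ u) ⊞ (a ⊠ b) ⊡ (c ⊙ u) })
    ≋-refl

  ⨯-⨯ : ∀ t a b → t ⨯ (a ⨯ b) ≋ a *ᵥ (t ∙ b) +ᵥ b *ᵥ (- (t ∙ a))
  ⨯-⨯ t a b = identityᵥ (t ∷ a ∷ b ∷ [])
    (λ { (t ∷ a ∷ b ∷ []) → t ⊠ (a ⊠ b) , a ⊡ (t ⊙ b) ⊞ b ⊡ (⊝ (t ⊙ a)) }) ≋-refl

  ∙-comm : ∀ u v → u ∙ v ≈ v ∙ u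
  ∙-comm u v = identity (u ∷ v ∷ []) (λ { (u ∷ v ∷ []) → u ⊙ v , v ⊙ u }) refl

  ∙-*ᵥ : ∀ u v a → u ∙ (v *ᵥ a) ≈ u ∙ v * a
  ∙-*ᵥ u v a = identity (u ∷ v ∷ (a , a , a) ∷ [])
    (λ { (u ∷ v ∷ (a , _) ∷ []) → u ⊙ (v ⊡ a) , (u ⊙ v) ⊗ a }) refl

  *ᵥ-∙ : ∀ u v a → (u *ᵥ a) ∙ v ≈ u ∙ v * a
  *ᵥ-∙ u v a = identity (u ∷ v ∷ (a , a , a) ∷ [])
    (λ { (u ∷ v ∷ (a , _) ∷ []) → (u ⊡ a) ⊙ v , (u ⊙ v) ⊗ a }) refl

  *ᵥ-⨯ : ∀ u v a → (u *ᵥ a) ⨯ v ≋ (u ⨯ v) *ᵥ a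
  *ᵥ-⨯ u v a = identityᵥ (u ∷ v ∷ (a , a , a) ∷ [])
    (λ { (u ∷ v ∷ (a , _) ∷ []) → (u ⊡ a) ⊠ v , (u ⊠ v) ⊡ a }) ≋-refl

  ⨯-*ᵥ : ∀ u v a → u ⨯ (v *ᵥ a) ≋ (u ⨯ v) *ᵥ a
  ⨯-*ᵥ u v a = identityᵥ (u ∷ v ∷ (a , a , a) ∷ [])
    (λ { (u ∷ v ∷ (a , _) ∷ []) → u ⊠ (v ⊡ a) , (u ⊠ v) ⊡ a }) ≋-refl

  *ᵥ-assoc : ∀ v a b → v *ᵥ a *ᵥ b ≋ v *ᵥ (a * b)
  *ᵥ-assoc (x , y , z) a b = *-assoc x a b , *-assoc y a b , *-assoc z a b

  *ᵥ-identity : ∀ v → v *ᵥ 1# ≋ v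
  *ᵥ-identity (x , y , z) = *-identityʳ x , *-identityʳ y , *-identityʳ z

  *ᵥ-zero : ∀ v → v *ᵥ 0# ≋ 0ᵥ
  *ᵥ-zero (x , y , z) = zeroʳ x , zeroʳ y , zeroʳ z

  0ᵥ-*ᵥ : ∀ a → 0ᵥ *ᵥ a ≋ 0ᵥ
  0ᵥ-*ᵥ a = zeroˡ a , zeroˡ a , zeroˡ a

  +ᵥ-identityʳ : ∀ v → v +ᵥ 0ᵥ ≋ v
  +ᵥ-identityʳ (x , y , z) = +-identityʳ x , +-identityʳ y , +-identityʳ z

  ∙-zeroʳ : ∀ v → v ∙ 0ᵥ ≈ 0#
  ∙-zeroʳ v = trans (∙-cong (≋-refl {v}) (≋-sym (*ᵥ-zero v))) (trans (∙-*ᵥ v v 0#) (zeroʳ _))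

  ⨯-zeroʳ : ∀ v → v ⨯ 0ᵥ ≋ 0ᵥ
  ⨯-zeroʳ v = ≋-trans (⨯-cong (≋-refl {v}) (≋-sym (*ᵥ-zero v))) (≋-trans (⨯-*ᵥ v v 0#) (*ᵥ-zero _))

  ⨯-self : ∀ v → v ⨯ v ≋ 0ᵥ
  ⨯-self v = identityᵥ (v ∷ []) (λ { (v ∷ []) → v ⊠ v , Κ 0 , Κ 0 , Κ 0 }) ≋-refl

  *ᵥ-zero-cong : ∀ {v} a → v ≋ 0ᵥ → v *ᵥ a ≋ 0ᵥ
  *ᵥ-zero-cong a v≋0 = ≋-trans (*ᵥ-cong v≋0 refl) (0ᵥ-*ᵥ a)

  -- For unimodular u and v: they span the same point.  Over the residue field: the points are neighbours.
  infix 4 _∥_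
  _∥_ : V → V → Set
  u ∥ v = u ⨯ v ≋ 0ᵥ

  IsUnit : Carrier → Set
  IsUnit a = ∃ λ b → a * b ≈ 1#

  Unimodular : V → Set
  Unimodular v = ∃ λ e → e ∙ v ≈ 1#

  unit-cancelʳ : ∀ {a b} → IsUnit b → a * b ≈ 0# → a ≈ 0#
  unit-cancelʳ {a} {b} (c , bc≈1) ab≈0 = begin
    a           ≈⟨ *-identityʳ a ⟨
    a * 1#      ≈⟨ *-congˡ bc≈1 ⟨
    a * (b * c) ≈⟨ *-assoc a b c ⟨
    a * b * c   ≈⟨ *-congʳ ab≈0 ⟩
    0# * c      ≈⟨ zeroˡ c ⟩
    0#          ∎

  unit-cancelᵥ : ∀ {v b} → IsUnit b → v *ᵥ b ≋ 0ᵥ → v ≋ 0ᵥ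
  unit-cancelᵥ ub (e , f , g) = unit-cancelʳ ub e , unit-cancelʳ ub f , unit-cancelʳ ub g

  unit-∣1 : ∀ {a b} → IsUnit (a * b) → IsUnit a
  unit-∣1 {a} {b} (c , abc≈1) = b * c , trans (sym (*-assoc a b c)) abc≈1

  unit-* : ∀ {a b} → IsUnit a → IsUnit b → IsUnit (a * b)
  unit-* {a} {b} (c , ac≈1) (d , bd≈1) = c * d ,
    trans (identity ((a , b , c) ∷ (d , d , d) ∷ [])
             (λ { ((a , b , c) ∷ (d , _) ∷ []) → (a ⊗ b) ⊗ (c ⊗ d) , (a ⊗ c) ⊗ (b ⊗ d) }) refl)
    (trans (*-cong ac≈1 bd≈1) (*-identityʳ 1#))

  unit-resp : ∀ {a b} → a ≈ b → IsUnit a → IsUnit b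
  unit-resp a≈b (c , ac≈1) = c , trans (*-congʳ (sym a≈b)) ac≈1

  unit⇒unimodular : ∀ {e v} → IsUnit (e ∙ v) → Unimodular v
  unit⇒unimodular {e} {v} (c , evc≈1) = e *ᵥ c , trans (*ᵥ-∙ e v c) evc≈1

  unimodular-cancel : ∀ {v a} → Unimodular v → v *ᵥ a ≋ 0ᵥ → a ≈ 0#
  unimodular-cancel {v} {a} (e , ev≈1) va≋0 = begin
    a            ≈⟨ *-identityˡ a ⟨
    1# * a       ≈⟨ *-congʳ ev≈1 ⟨
    e ∙ v * a    ≈⟨ ∙-*ᵥ e v a ⟨
    e ∙ (v *ᵥ a) ≈⟨ ∙-cong (≋-refl {e}) va≋0 ⟩
    e ∙ 0ᵥ       ≈⟨ ∙-zeroʳ e ⟩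
    0#           ∎

  -- In `triple-product` the term with u ⨯ v vanishes and e ∙ v = 1, so the functional that
  -- certifies that v is unimodular also computes the factor.
  ∥⇒multiple : ∀ {e u v} → e ∙ v ≈ 1# → u ∥ v → u ≋ v *ᵥ (e ∙ u)
  ∥⇒multiple {e} {u} {v} ev≈1 u∥v =
    ≋-trans (≋-sym (*ᵥ-identity u))
    (≋-trans (*ᵥ-cong ≋-refl (sym ev≈1))
    (≋-trans (triple-product e u v)
    (≋-trans (+ᵥ-cong ≋-refl (≋-trans (⨯-cong (≋-refl {e}) u∥v) (⨯-zeroʳ e))) (+ᵥ-identityʳ _))))

  multiple⇒∥ : ∀ {a u v} → u ≋ v *ᵥ a → u ∥ v
  multiple⇒∥ {a} {u} {v} u≋va =
    ≋-trans (⨯-cong u≋va ≋-refl) (≋-trans (*ᵥ-⨯ v v a) (*ᵥ-zero-cong a (⨯-self v)))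

  ∥-sym : ∀ {u v} → u ∥ v → v ∥ u
  ∥-sym {u} {v} u∥v = ≋-trans
    (identityᵥ (u ∷ v ∷ []) (λ { (u ∷ v ∷ []) → v ⊠ u , (u ⊠ v) ⊡ (⊝ Κ 1) }) ≋-refl)
    (*ᵥ-zero-cong _ u∥v)

  ∥-trans : ∀ {u v w} → Unimodular v → u ∥ v → v ∥ w → u ∥ w
  ∥-trans {u} {v} {w} (e , ev≈1) u∥v v∥w =
    ≋-trans (⨯-cong (∥⇒multiple {e} ev≈1 u∥v) ≋-refl) (≋-trans (*ᵥ-⨯ v w _) (*ᵥ-zero-cong _ v∥w))

  ∥-resp-∙ : ∀ {u v w} → Unimodular v → u ∥ v → v ∙ w ≈ 0# → u ∙ w ≈ 0#
  ∥-resp-∙ {u} {v} {w} (e , ev≈1) u∥v vw≈0 =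
    trans (∙-cong (∥⇒multiple {e} ev≈1 u∥v) ≋-refl)
    (trans (*ᵥ-∙ v w _) (trans (*-congʳ vw≈0) (zeroˡ _)))

  -- By `det-*ᵥ`, the determinant times u is a combination whose coefficients are the three products
  -- with u. So the determinant annihilates a unimodular vector.
  concurrent⇒det≈0 : ∀ {a b c u} → Unimodular u → a ∙ u ≈ 0# → b ∙ u ≈ 0# → c ∙ u ≈ 0# → a ∙ (b ⨯ c) ≈ 0#
  concurrent⇒det≈0 {a} {b} {c} {u} uu au bu cu = unimodular-cancel uu
    (≋-trans (det-*ᵥ a b c u)
    (≋-trans (+ᵥ-cong (+ᵥ-cong (scaled au) (scaled bu)) (scaled cu))
    (≋-trans (+ᵥ-identityʳ _) (+ᵥ-identityʳ _))))
    where
    scaled : ∀ {v x} → x ≈ 0# → v *ᵥ x ≋ 0ᵥ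
    scaled x≈0 = ≋-trans (*ᵥ-cong ≋-refl x≈0) (*ᵥ-zero _)

  -- As μ is a unit, A and B form a basis of the orthogonal complement of v.
  record Frame (v : V) : Set where
    field
      A B    : V
      μ      : Carrier
      μ-unit : IsUnit μ
      A⨯B    : A ⨯ B ≋ v *ᵥ μ

    combination : Carrier → Carrier → V
    combination s t = A *ᵥ s +ᵥ B *ᵥ t

    combination-∙ : ∀ s t w → combination s t ∙ w ≈ s * (A ∙ w) + t * (B ∙ w)
    combination-∙ s t w = identity (A ∷ B ∷ w ∷ (s , t , t) ∷ [])
      (λ { (A ∷ B ∷ w ∷ (s , t , _) ∷ []) → (A ⊡ s ⊞ B ⊡ t) ⊙ w , s ⊗ (A ⊙ w) ⊕ t ⊗ (B ⊙ w) }) refl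

    A∙v : A ∙ v ≈ 0#
    A∙v = unit-cancelʳ μ-unit (trans (sym (∙-*ᵥ A v μ)) (trans (∙-cong (≋-refl {A}) (≋-sym A⨯B))
      (identity (A ∷ B ∷ []) (λ { (A ∷ B ∷ []) → A ⊙ (A ⊠ B) , Κ 0 }) refl)))

    B∙v : B ∙ v ≈ 0#
    B∙v = unit-cancelʳ μ-unit (trans (sym (∙-*ᵥ B v μ)) (trans (∙-cong (≋-refl {B}) (≋-sym A⨯B))
      (identity (A ∷ B ∷ []) (λ { (A ∷ B ∷ []) → B ⊙ (A ⊠ B) , Κ 0 }) refl)))

    combination-∙v : ∀ s t → combination s t ∙ v ≈ 0#
    combination-∙v s t = trans (combination-∙ s t v)
      (trans (+-cong (trans (*-congˡ A∙v) (zeroʳ s)) (trans (*-congˡ B∙v) (zeroʳ t))) (+-identityʳ 0#))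

    spanning : Unimodular v → ∀ {x} → x ∙ v ≈ 0# → ∃ λ s → ∃ λ t → x ≋ combination s t
    spanning (e , ev≈1) {x} xv≈0 with ν , μν≈1 ← μ-unit =
      -- Cramer's rule for the triple e, A, B. Its determinant is μ, and the coefficient of e is x ∙
      -- (A ⨯ B) = (x ∙ v) μ = 0.
      e ∙ (x ⨯ B) * ν , e ∙ (A ⨯ x) * ν ,
      ≋-trans (≋-sym (*ᵥ-identity x))
      (≋-trans (*ᵥ-cong ≋-refl (sym μν≈1))
      (≋-trans (≋-sym (*ᵥ-assoc x μ ν))
      (≋-trans (*ᵥ-cong xμ refl)
      (identityᵥ (A ∷ B ∷ (e ∙ (x ⨯ B) , e ∙ (A ⨯ x) , ν) ∷ [])
        (λ { (A ∷ B ∷ (s , t , ν) ∷ []) → (A ⊡ s ⊞ B ⊡ t) ⊡ ν , A ⊡ (s ⊗ ν) ⊞ B ⊡ (t ⊗ ν) }) ≋-refl))))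
      where
      e∙A⨯B : e ∙ (A ⨯ B) ≈ μ
      e∙A⨯B = trans (∙-cong (≋-refl {e}) A⨯B) (trans (∙-*ᵥ e v μ) (trans (*-congʳ ev≈1) (*-identityˡ μ)))
      x∙A⨯B : x ∙ (A ⨯ B) ≈ 0#
      x∙A⨯B = trans (∙-cong (≋-refl {x}) A⨯B) (trans (∙-*ᵥ x v μ) (trans (*-congʳ xv≈0) (zeroˡ μ)))
      xμ : x *ᵥ μ ≋ combination (e ∙ (x ⨯ B)) (e ∙ (A ⨯ x))
      xμ = ≋-trans (*ᵥ-cong ≋-refl (sym e∙A⨯B))
        (≋-trans (cramer e A B x)
        (≋-trans (+ᵥ-cong ≋-refl (≋-trans (*ᵥ-cong (≋-refl {e}) x∙A⨯B) (*ᵥ-zero e))) (+ᵥ-identityʳ _)))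

    combination-⨯B : ∀ s t → combination s t ⨯ B ≋ v *ᵥ (μ * s)
    combination-⨯B s t = ≋-trans
      (identityᵥ (A ∷ B ∷ (s , t , t) ∷ [])
        (λ { (A ∷ B ∷ (s , t , _) ∷ []) → (A ⊡ s ⊞ B ⊡ t) ⊠ B , (A ⊠ B) ⊡ s }) ≋-refl)
      (≋-trans (*ᵥ-cong A⨯B refl) (*ᵥ-assoc v μ s))

    A⨯combination : ∀ s t → A ⨯ combination s t ≋ v *ᵥ (μ * t)
    A⨯combination s t = ≋-trans
      (identityᵥ (A ∷ B ∷ (s , t , t) ∷ [])
        (λ { (A ∷ B ∷ (s , t , _) ∷ []) → A ⊠ (A ⊡ s ⊞ B ⊡ t) , (A ⊠ B) ⊡ t }) ≋-refl)
      (≋-trans (*ᵥ-cong A⨯B refl) (*ᵥ-assoc v μ t))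

    independent : Unimodular v → ∀ {s t} → combination s t ≋ 0ᵥ → s ≈ 0# × t ≈ 0#
    independent uv {s} {t} c≋0 = μ-cancel s (≋-trans (≋-sym (combination-⨯B s t))
        (≋-trans (∥-sym (≋-trans (⨯-cong (≋-refl {B}) c≋0) (⨯-zeroʳ B))) ≋-refl))
      , μ-cancel t (≋-trans (≋-sym (A⨯combination s t)) (≋-trans (⨯-cong (≋-refl {A}) c≋0) (⨯-zeroʳ A)))
      where
      μ-cancel : ∀ s → v *ᵥ (μ * s) ≋ 0ᵥ → s ≈ 0#
      μ-cancel s eq = unit-cancelʳ μ-unit (trans (*-comm s μ) (unimodular-cancel uv eq))

    -- The functional B ⨯ e vanishes on B and takes A to e ∙ (A ⨯ B) = μ, so its value at the
    -- combination is μs. In the same way e ⨯ A takes the value μt.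
    combination-unimodular : Unimodular v → ∀ {s t} → IsUnit s ⊎ IsUnit t → Unimodular (combination s t)
    combination-unimodular (e , ev≈1) {s} {t} (inj₁ us) = unit⇒unimodular {B ⨯ e}
      (unit-resp (sym (trans
        (identity (A ∷ B ∷ e ∷ (s , t , t) ∷ [])
          (λ { (A ∷ B ∷ e ∷ (s , t , _) ∷ []) → (B ⊠ e) ⊙ (A ⊡ s ⊞ B ⊡ t) , (e ⊙ (A ⊠ B)) ⊗ s }) refl)
        (*-congʳ (trans (∙-cong (≋-refl {e}) A⨯B) (trans (∙-*ᵥ e v μ) (trans (*-congʳ ev≈1) (*-identityˡ μ)))))))
        (unit-* μ-unit us))
    combination-unimodular (e , ev≈1) {s} {t} (inj₂ ut) = unit⇒unimodular {e ⨯ A}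
      (unit-resp (sym (trans
        (identity (A ∷ B ∷ e ∷ (s , t , t) ∷ [])
          (λ { (A ∷ B ∷ e ∷ (s , t , _) ∷ []) → (e ⊠ A) ⊙ (A ⊡ s ⊞ B ⊡ t) , (e ⊙ (A ⊠ B)) ⊗ t }) refl)
        (*-congʳ (trans (∙-cong (≋-refl {e}) A⨯B) (trans (∙-*ᵥ e v μ) (trans (*-congʳ ev≈1) (*-identityˡ μ)))))))
        (unit-* μ-unit ut))

    -- Up to the unit μ, w ⨯ v is w ⨯ (A ⨯ B), which expands into A (w ∙ B) and B (w ∙ A).
    orthogonal⇒∥ : ∀ {w} → A ∙ w ≈ 0# → B ∙ w ≈ 0# → w ∥ v
    orthogonal⇒∥ {w} Aw≈0 Bw≈0 = unit-cancelᵥ μ-unit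
      (≋-trans (≋-sym (⨯-*ᵥ w v μ))
      (≋-trans (⨯-cong (≋-refl {w}) (≋-sym A⨯B))
      (≋-trans (⨯-⨯ w A B)
      (≋-trans (+ᵥ-cong (≋-trans (*ᵥ-cong ≋-refl (trans (∙-comm w B) Bw≈0)) (*ᵥ-zero A))
        (≋-trans (*ᵥ-cong ≋-refl (trans (-‿cong (trans (∙-comm w A) Aw≈0)) -0#≈0#)) (*ᵥ-zero B)))
      (+ᵥ-identityʳ _)))))

    ∥⇒orthogonal : Unimodular v → ∀ {w} → w ∥ v → A ∙ w ≈ 0# × B ∙ w ≈ 0#
    ∥⇒orthogonal uv w∥v =
      trans (∙-comm A _) (∥-resp-∙ uv w∥v (trans (∙-comm v A) A∙v)) ,
      trans (∙-comm B _) (∥-resp-∙ uv w∥v (trans (∙-comm v B) B∙v))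

  -- Up to sign, A and B are the cross products of v with the two coordinate vectors that do not
  -- belong to the unit coordinate. The order and signs are chosen so that A ⨯ B is v times that
  -- coordinate.
  frame : ∀ {v : V} → let x , y , z = v in IsUnit x ⊎ IsUnit y ⊎ IsUnit z → Frame v
  frame {x , y , z} (inj₁ ux) = record
    { A = - y , x , 0# ; B = - z , 0# , x ; μ = x ; μ-unit = ux
    ; A⨯B = identityᵥ ((x , y , z) ∷ []) (λ { ((x , y , z) ∷ []) →
        (⊝ y , x , Κ 0) ⊠ (⊝ z , Κ 0 , x) , (x , y , z) ⊡ x }) ≋-refl }
  frame {x , y , z} (inj₂ (inj₁ uy)) = record
    { A = 0# , - z , y ; B = y , - x , 0# ; μ = y ; μ-unit = uy
    ; A⨯B = identityᵥ ((x , y , z) ∷ []) (λ { ((x , y , z) ∷ []) →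
        (Κ 0 , ⊝ z , y) ⊠ (y , ⊝ x , Κ 0) , (x , y , z) ⊡ y }) ≋-refl }
  frame {x , y , z} (inj₂ (inj₂ uz)) = record
    { A = z , 0# , - x ; B = 0# , z , - y ; μ = z ; μ-unit = uz
    ; A⨯B = identityᵥ ((x , y , z) ∷ []) (λ { ((x , y , z) ∷ []) →
        (z , Κ 0 , ⊝ x) ⊠ (Κ 0 , z , ⊝ y) , (x , y , z) ⊡ z }) ≋-refl }

-- The points of the projective plane over a finite local ring

record FiniteLocalRing (R : CommutativeRing 0ℓ 0ℓ) : Set₁ where
  open CommutativeRing R
  field
    4≈0 : 1# + 1# + 1# + 1# ≈ 0#
  open VectorAlgebra R 4≈0 using (IsUnit)
  field
    1≉0       : ¬ 1# ≈ 0#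
    _≟_       : Decidable _≈_
    unit?     : ∀ x → Dec (IsUnit x)
    nonunit-+ : ∀ {x y} → ¬ IsUnit x → ¬ IsUnit y → ¬ IsUnit (x + y)
    elements  : List Carrier
    nonunits  : List Carrier
    elements-count : ∀ x → ∑[ e ∈ elements ] 𝟙 (e ≟ x) ≡ 1
    nonunits-count : ∀ {x} → ¬ IsUnit x → ∑[ e ∈ nonunits ] 𝟙 (e ≟ x) ≡ 1
    nonunits-sound : All (¬_ ∘ IsUnit) nonunits

module ProjectivePlane (R : CommutativeRing 0ℓ 0ℓ) (local : FiniteLocalRing R) where

  open CommutativeRing R
  open FiniteLocalRing local
  open Vectors R
  open VectorAlgebra R 4≈0
  open VectorSolver R 3 4≈0

  _≋?_ : ∀ u v → Dec (u ≋ v)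
  (x , y , z) ≋? (x′ , y′ , z′) = (x ≟ x′) ×-dec (y ≟ y′) ×-dec (z ≟ z′)

  _∥?_ : ∀ u v → Dec (u ∥ v)
  u ∥? v = (u ⨯ v) ≋? 0ᵥ

  nonunit-* : ∀ {x} y → ¬ IsUnit x → ¬ IsUnit (x * y)
  nonunit-* y ¬ux uxy = ¬ux (unit-∣1 uxy)

  unit-1 : IsUnit 1#
  unit-1 = 1# , *-identityʳ 1#

  unit-coordinate : ∀ {v : V} → let x , y , z = v in Unimodular v → IsUnit x ⊎ IsUnit y ⊎ IsUnit z
  unit-coordinate {x , y , z} ((a , b , c) , ev≈1) with unit? x | unit? y | unit? z
  ... | yes ux | _      | _      = inj₁ ux
  ... | no _   | yes uy | _      = inj₂ (inj₁ uy)
  ... | no _   | no _   | yes uz = inj₂ (inj₂ uz)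
  ... | no ¬ux | no ¬uy | no ¬uz = contradiction (unit-resp (sym ev≈1) unit-1)
    (nonunit-+ (¬ux ∘ unit-∣1 ∘ unit-resp (*-comm a x))
      (nonunit-+ (¬uy ∘ unit-∣1 ∘ unit-resp (*-comm b y)) (¬uz ∘ unit-∣1 ∘ unit-resp (*-comm c z))))

  unimodular⇒frame : ∀ {v} → Unimodular v → Frame v
  unimodular⇒frame uv = frame (unit-coordinate uv)

  private
    solve-iff : ∀ {a w} ((w⁻¹ , _) : IsUnit w) e →
      𝟙 (a ≟ (e * w)) ≡ 𝟙 (e ≟ (a * w⁻¹))
    solve-iff {a} {w} (w⁻¹ , ww⁻¹≈1) e = 𝟙-cong (_ ≟ _) (_ ≟ _)
      (λ a≈ew → sym (trans (*-congʳ a≈ew) (trans (*-assoc e w w⁻¹) (trans (*-congˡ ww⁻¹≈1) (*-identityʳ e)))))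
      (λ e≈aw⁻¹ → sym (trans (*-congʳ e≈aw⁻¹)
        (trans (*-assoc a w⁻¹ w) (trans (*-congˡ (trans (*-comm w⁻¹ w) ww⁻¹≈1)) (*-identityʳ a)))))

  elements-solve : ∀ a {w} → IsUnit w → ∑[ e ∈ elements ] 𝟙 (a ≟ (e * w)) ≡ 1
  elements-solve a uw = ≡.trans (∑-cong elements (solve-iff {a} uw)) (elements-count _)

  elements-unsolvable : ∀ {a w} → IsUnit a → ¬ IsUnit w → ∑[ e ∈ elements ] 𝟙 (a ≟ (e * w)) ≡ 0
  elements-unsolvable {w = w} ua ¬uw = ≡.trans (∑-cong elements λ e → 𝟙-no (_ ≟ _)
    λ a≈ew → nonunit-* e ¬uw (unit-resp (trans a≈ew (*-comm e w)) ua)) (∑-zero elements)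

  nonunits-solve : ∀ {a w} → ¬ IsUnit a → IsUnit w → ∑[ e ∈ nonunits ] 𝟙 (a ≟ (e * w)) ≡ 1
  nonunits-solve {a} ¬ua uw =
    ≡.trans (∑-cong nonunits (solve-iff {a} uw)) (nonunits-count (nonunit-* (proj₁ uw) ¬ua))

  nonunits-unsolvable : ∀ {a} w → IsUnit a → ∑[ e ∈ nonunits ] 𝟙 (a ≟ (e * w)) ≡ 0
  nonunits-unsolvable w ua = ≡.trans (∑-congᴬ (All.map (λ ¬ue → 𝟙-no (_ ≟ _)
    λ a≈ew → nonunit-* w ¬ue (unit-resp a≈ew ua)) nonunits-sound)) (∑-zero nonunits)

  Pt : Set
  Pt = ∃ Unimodular

  private
    e₁ e₂ e₃ : V
    e₁ = 1# , 0# , 0#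
    e₂ = 0# , 1# , 0#
    e₃ = 0# , 0# , 1#

    chart₁ chart₂ chart₃ : Carrier → Carrier → Pt
    chart₁ y z = (1# , y , z) , e₁ ,
      identity ((y , y , z) ∷ []) (λ { ((y , _ , z) ∷ []) → (Κ 1 , Κ 0 , Κ 0) ⊙ (Κ 1 , y , z) , Κ 1 }) refl
    chart₂ x z = (x , 1# , z) , e₂ ,
      identity ((x , x , z) ∷ []) (λ { ((x , _ , z) ∷ []) → (Κ 0 , Κ 1 , Κ 0) ⊙ (x , Κ 1 , z) , Κ 1 }) refl
    chart₃ x y = (x , y , 1#) , e₃ ,
      identity ((x , y , y) ∷ []) (λ { ((x , y , _) ∷ []) → (Κ 0 , Κ 0 , Κ 1) ⊙ (x , y , Κ 1) , Κ 1 }) refl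

    chart₁-∥ : ∀ {a b c} y z → 𝟙 (proj₁ (chart₁ y z) ∥? (a , b , c)) ≡ 𝟙 (b ≟ (y * a)) ℕ.* 𝟙 (c ≟ (z * a))
    chart₁-∥ {a} {b} {c} y z = ≡.trans (𝟙-cong (_ ∥? _) ((b ≟ (y * a)) ×-dec (c ≟ (z * a)))
      (λ p∥v → let _ , e , f = ≋-trans (∥⇒multiple {e₁} (proj₂ (proj₂ (chart₁ y z))) (∥-sym p∥v)) (*ᵥ-cong ≋-refl
                         (identity ((a , b , c) ∷ []) (λ { ((a , b , c) ∷ []) → (Κ 1 , Κ 0 , Κ 0) ⊙ (a , b , c) , a }) refl))
               in e , f)
      (λ (e , f) → ∥-sym (multiple⇒∥ {a} (sym (*-identityˡ a) , e , f)))) (𝟙-× (_ ≟ _) (_ ≟ _))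

    chart₂-∥ : ∀ {a b c} x z → 𝟙 (proj₁ (chart₂ x z) ∥? (a , b , c)) ≡ 𝟙 (a ≟ (x * b)) ℕ.* 𝟙 (c ≟ (z * b))
    chart₂-∥ {a} {b} {c} x z = ≡.trans (𝟙-cong (_ ∥? _) ((a ≟ (x * b)) ×-dec (c ≟ (z * b)))
      (λ p∥v → let e , _ , f = ≋-trans (∥⇒multiple {e₂} (proj₂ (proj₂ (chart₂ x z))) (∥-sym p∥v)) (*ᵥ-cong ≋-refl
                         (identity ((a , b , c) ∷ []) (λ { ((a , b , c) ∷ []) → (Κ 0 , Κ 1 , Κ 0) ⊙ (a , b , c) , b }) refl))
               in e , f)
      (λ (e , f) → ∥-sym (multiple⇒∥ {b} (e , sym (*-identityˡ b) , f)))) (𝟙-× (_ ≟ _) (_ ≟ _))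

    chart₃-∥ : ∀ {a b c} x y → 𝟙 (proj₁ (chart₃ x y) ∥? (a , b , c)) ≡ 𝟙 (a ≟ (x * c)) ℕ.* 𝟙 (b ≟ (y * c))
    chart₃-∥ {a} {b} {c} x y = ≡.trans (𝟙-cong (_ ∥? _) ((a ≟ (x * c)) ×-dec (b ≟ (y * c)))
      (λ p∥v → let e , f , _ = ≋-trans (∥⇒multiple {e₃} (proj₂ (proj₂ (chart₃ x y))) (∥-sym p∥v)) (*ᵥ-cong ≋-refl
                         (identity ((a , b , c) ∷ []) (λ { ((a , b , c) ∷ []) → (Κ 0 , Κ 0 , Κ 1) ⊙ (a , b , c) , c }) refl))
               in e , f)
      (λ (e , f) → ∥-sym (multiple⇒∥ {c} (e , f , sym (*-identityˡ c))))) (𝟙-× (_ ≟ _) (_ ≟ _))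

  -- Normal forms of unimodular vectors up to units: the first unit coordinate is 1, the coordinates
  -- before it are nonunits and those after it are arbitrary.
  plane : List Pt
  plane = cartesianProductWith chart₁ elements elements
       ++ cartesianProductWith chart₂ nonunits elements
       ++ cartesianProductWith chart₃ nonunits nonunits

  length-plane : length plane ≡
    length elements ℕ.* length elements ℕ.+
    (length nonunits ℕ.* length elements ℕ.+ length nonunits ℕ.* length nonunits)
  length-plane = ≡.trans (List.length-++ (cartesianProductWith chart₁ elements elements))
    (≡.cong₂ ℕ._+_ (length-cartesian chart₁ elements elements)
    (≡.trans (List.length-++ (cartesianProductWith chart₂ nonunits elements))
    (≡.cong₂ ℕ._+_ (length-cartesian chart₂ nonunits elements)
                   (length-cartesian chart₃ nonunits nonunits))))

  private
    chart-count : ∀ (chart : Carrier → Carrier → Pt) ys zs {v} (f g : Carrier → ℕ) →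
      (∀ y z → 𝟙 (proj₁ (chart y z) ∥? v) ≡ f y ℕ.* g z) →
      ∑[ p ∈ cartesianProductWith chart ys zs ] 𝟙 (proj₁ p ∥? v) ≡ ∑ ys f ℕ.* ∑ zs g
    chart-count chart ys zs f g split =
      ≡.trans (∑-cartesian chart ys zs _)
      (≡.trans (∑-cong ys λ y → ∑-cong zs (split y)) (∑-× ys zs f g))

  -- Being parallel to a chart point amounts to two equations in separate unknowns, so every chart
  -- contributes a product of two numbers of solutions. The chart of the first unit coordinate of v
  -- contributes 1. In each other chart, one of the two equations has no solution.
  plane-count : ∀ {v} → Unimodular v → ∑[ p ∈ plane ] 𝟙 (proj₁ p ∥? v) ≡ 1
  plane-count {a , b , c} uv = ≡.trans
    (≡.trans (∑-++ (cartesianProductWith chart₁ elements elements) _ _)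
    (≡.cong₂ ℕ._+_ (chart-count chart₁ elements elements _ _ chart₁-∥)
    (≡.trans (∑-++ (cartesianProductWith chart₂ nonunits elements) _ _)
    (≡.cong₂ ℕ._+_ (chart-count chart₂ nonunits elements _ _ chart₂-∥)
                   (chart-count chart₃ nonunits nonunits _ _ chart₃-∥)))))
    (by-cases (unit? a) (unit? b) (unit-coordinate uv))
    where
    E J : Carrier → Carrier → ℕ
    E x w = ∑[ e ∈ elements ] 𝟙 (x ≟ (e * w))
    J x w = ∑[ e ∈ nonunits ] 𝟙 (x ≟ (e * w))
    by-cases : Dec (IsUnit a) → Dec (IsUnit b) → IsUnit a ⊎ IsUnit b ⊎ IsUnit c →
      E b a ℕ.* E c a ℕ.+ (J a b ℕ.* E c b ℕ.+ J a c ℕ.* J b c) ≡ 1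
    by-cases (yes ua) _ _ rewrite elements-solve b ua | elements-solve c ua
      | nonunits-unsolvable b ua | nonunits-unsolvable c ua = ≡.refl
    by-cases (no ¬ua) (yes ub) _ rewrite elements-unsolvable ub ¬ua | nonunits-solve ¬ua ub
      | elements-solve c ub | nonunits-unsolvable c ub | ℕ.*-zeroʳ (J a c) = ≡.refl
    by-cases (no ¬ua) (no ¬ub) (inj₂ (inj₂ uc)) rewrite elements-unsolvable uc ¬ua
      | elements-unsolvable uc ¬ub | nonunits-solve ¬ua uc | nonunits-solve ¬ub uc
      | ℕ.*-zeroʳ (E b a) | ℕ.*-zeroʳ (J a b) = ≡.refl
    by-cases (no ¬ua) _ (inj₁ ua) = contradiction ua ¬ua
    by-cases _ (no ¬ub) (inj₂ (inj₁ ub)) = contradiction ub ¬ub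

-- Chain rings of length 2 with residue field of even order

-- A chain ring of length 2 with maximal ideal (2) and residue field of order q;
-- rep enumerates representatives of the residue classes.

record IsDyadicChainRing (R : CommutativeRing 0ℓ 0ℓ) (q : ℕ) : Set where
  open CommutativeRing R
  field
    4≈0           : 1# + 1# + 1# + 1# ≈ 0#
    2≉0           : ¬ 1# + 1# ≈ 0#
    unit⊎even     : ∀ x → (∃ λ y → x * y ≈ 1#) ⊎ (∃ λ y → x ≈ y + y)
    rep           : Fin q → Carrier
    index         : Carrier → Fin q
    rep-index     : ∀ x → rep (index x) + rep (index x) ≈ x + x
    rep-injective : ∀ {i j} → rep i + rep i ≈ rep j + rep j → i ≡ j

module ResidueField (R : CommutativeRing 0ℓ 0ℓ) (q : ℕ) (chain : IsDyadicChainRing R q) where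

  open CommutativeRing R
  open IsDyadicChainRing chain
  open VectorAlgebra R 4≈0 using (IsUnit)
  open VectorSolver R 3 4≈0
  open RingProperties ring using (x∙y⁻¹≈ε⇒x≈y; x≈y⇒x∙y⁻¹≈ε; +-cancelˡ)
  open Quotient R (1# + 1#) using (congruent)
  open Divisibility *-rawMagma using () renaming (_,_ to _,ᵈ_)
  open import Relation.Binary.Reasoning.Setoid setoid

  -- The residue field has the carrier of R, so reduction is the identity on representatives. The
  -- same vectors are read over R and over `S`; only the relations between them change.
  S : CommutativeRing 0ℓ 0ℓ
  S = R /⟨ 1# + 1# ⟩

  private module S = CommutativeRing S

  infix 4 _≡₂_
  _≡₂_ : Carrier → Carrier → Set
  _≡₂_ = S._≈_

  1≉0 : ¬ 1# ≈ 0#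
  1≉0 1≈0 = 2≉0 (trans (+-cong 1≈0 1≈0) (+-identityʳ 0#))

  double-unit : ∀ {x} → IsUnit x → ¬ x + x ≈ 0#
  double-unit {x} (y , xy≈1) 2x≈0 = 2≉0 (begin
    1# + 1#       ≈⟨ +-cong xy≈1 xy≈1 ⟨
    x * y + x * y ≈⟨ distribʳ y x x ⟨
    (x + x) * y   ≈⟨ *-congʳ 2x≈0 ⟩
    0# * y        ≈⟨ zeroˡ y ⟩
    0#            ∎)

  double-even : ∀ {x y} → x ≈ y + y → x + x ≈ 0#
  double-even {x} {y} x≈2y = trans (+-cong x≈2y x≈2y)
    (identity ((y , y , y) ∷ []) (λ { ((y , _) ∷ []) → (y ⊕ y) ⊕ (y ⊕ y) , Κ 0 }) refl)

  double≈0⇒even : ∀ {x} → x + x ≈ 0# → ∃ λ y → x ≈ y + y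
  double≈0⇒even {x} 2x≈0 = [ (λ ux → contradiction 2x≈0 (double-unit ux)) , id ]′ (unit⊎even x)

  -- The annihilator of 2 is (2), so congruence modulo 2 is the same as equality of doubles;
  -- `double⇒≡₂` is the converse. This is why the fields of `IsDyadicChainRing` compare doubles.
  ≡₂⇒double : ∀ {x y} → x ≡₂ y → x + x ≈ y + y
  ≡₂⇒double {x} {y} (congruent (k ,ᵈ eq)) = x∙y⁻¹≈ε⇒x≈y _ _ (begin
    (x + x) - (y + y)
      ≈⟨ identity ((x , y , y) ∷ []) (λ { ((x , y , _) ∷ []) → (x ⊕ x) ⊕ (⊝ (y ⊕ y)) , (x ⊕ ⊝ y) ⊕ (x ⊕ ⊝ y) }) refl ⟩
    (x - y) + (x - y)
      ≈⟨ +-cong eq eq ⟨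
    k * (1# + 1#) + k * (1# + 1#)
      ≈⟨ identity ((k , k , k) ∷ []) (λ { ((k , _) ∷ []) → (k ⊗ (Κ 1 ⊕ Κ 1)) ⊕ (k ⊗ (Κ 1 ⊕ Κ 1)) , Κ 0 }) refl ⟩
    0# ∎)

  double⇒≡₂ : ∀ {x y} → x + x ≈ y + y → x ≡₂ y
  double⇒≡₂ {x} {y} 2x≈2y =
    let z , x-y≈2z = double≈0⇒even {x - y} (trans
          (identity ((x , y , y) ∷ []) (λ { ((x , y , _) ∷ []) → (x ⊕ ⊝ y) ⊕ (x ⊕ ⊝ y) , (x ⊕ x) ⊕ (⊝ (y ⊕ y)) }) refl)
          (x≈y⇒x∙y⁻¹≈ε 2x≈2y))
    in congruent (z ,ᵈ trans (trans (distribˡ z 1# 1#) (+-cong (*-identityʳ z) (*-identityʳ z))) (sym x-y≈2z))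

  ≈⇒≡₂ : ∀ {x y} → x ≈ y → x ≡₂ y
  ≈⇒≡₂ x≈y = double⇒≡₂ (+-cong x≈y x≈y)

  even⇒≡₂0 : ∀ {x y} → x ≈ y + y → x ≡₂ 0#
  even⇒≡₂0 x≈2y = double⇒≡₂ (trans (double-even x≈2y) (sym (+-identityʳ 0#)))

  double≈0⇒≡₂0 : ∀ {x} → x + x ≈ 0# → x ≡₂ 0#
  double≈0⇒≡₂0 2x≈0 = double⇒≡₂ (trans 2x≈0 (sym (+-identityʳ 0#)))

  ≡₂0⇒double≈0 : ∀ {x} → x ≡₂ 0# → x + x ≈ 0#
  ≡₂0⇒double≈0 x≡0 = trans (≡₂⇒double x≡0) (+-identityʳ 0#)

  unit⇒≢₂0 : ∀ {x} → IsUnit x → ¬ x ≡₂ 0#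
  unit⇒≢₂0 ux x≡0 = double-unit ux (≡₂0⇒double≈0 x≡0)

  unit⊎≡₂0 : ∀ x → IsUnit x ⊎ x ≡₂ 0#
  unit⊎≡₂0 x = [ inj₁ , (λ (y , x≈2y) → inj₂ (even⇒≡₂0 x≈2y)) ]′ (unit⊎even x)

  nonunit⇒≡₂0 : ∀ {x} → ¬ IsUnit x → x ≡₂ 0#
  nonunit⇒≡₂0 {x} ¬ux = [ (λ ux → contradiction ux ¬ux) , id ]′ (unit⊎≡₂0 x)

  index-≡₂ : ∀ {x i} → rep i ≡₂ x → i ≡ index x
  index-≡₂ {x} rep≡x = rep-injective (trans (≡₂⇒double rep≡x) (sym (rep-index x)))

  rep-index-≡₂ : ∀ x → rep (index x) ≡₂ x
  rep-index-≡₂ x = double⇒≡₂ (rep-index x)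

  private
    -- Splitting twice into units and doubles leaves a unit, twice a unit, or 4z = 0. Only the last
    -- is zero.
    zero? : ∀ x → Dec (x ≈ 0#)
    zero? x with unit⊎even x
    ... | inj₁ (y , xy≈1) = no λ x≈0 → 1≉0 (trans (sym xy≈1) (trans (*-congʳ x≈0) (zeroˡ y)))
    ... | inj₂ (y , x≈2y) with unit⊎even y
    ...   | inj₁ uy         = no λ x≈0 → double-unit uy (trans (sym x≈2y) x≈0)
    ...   | inj₂ (z , y≈2z) = yes (trans x≈2y (double-even y≈2z))

    _≟_ : Decidable _≈_
    x ≟ y = Dec.map′ (x∙y⁻¹≈ε⇒x≈y x y) x≈y⇒x∙y⁻¹≈ε (zero? (x - y))

    unit? : ∀ x → Dec (IsUnit x)
    unit? x = [ yes , (λ x≡0 → no λ ux → unit⇒≢₂0 ux x≡0) ]′ (unit⊎≡₂0 x)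

  infix 4 _≟ˢ_
  _≟ˢ_ : Decidable _≡₂_
  x ≟ˢ y = Dec.map′ double⇒≡₂ ≡₂⇒double ((x + x) ≟ (y + y))

  -- Expansions to base 2 with two digits. The second digit is unique because the half of an even
  -- element is determined modulo 2.
  digits : Fin q → Fin q → Carrier
  digits i j = rep i + (rep j + rep j)

  R-elements R-nonunits : List Carrier
  R-elements = cartesianProductWith digits (allFin q) (allFin q)
  R-nonunits = map (λ j → rep j + rep j) (allFin q)

  R-elements-count : ∀ x → ∑[ e ∈ R-elements ] 𝟙 (e ≟ x) ≡ 1
  R-elements-count x = ≡.trans (∑-cartesian digits (allFin q) (allFin q) _)
    (≡.trans (∑-cong (allFin q) λ i → ∑-cong (allFin q) λ j →
      ≡.trans (𝟙-cong (digits i j ≟ x) ((i Fin.≟ index x) ×-dec (j Fin.≟ index y)) to from)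
              (𝟙-× (i Fin.≟ index x) (j Fin.≟ index y)))
    (≡.trans (∑-× (allFin q) (allFin q) _ _)
      (≡.cong₂ ℕ._*_ (allFin-count (index x)) (allFin-count (index y)))))
    where
    remainder : ∃ λ y → x - rep (index x) ≈ y + y
    remainder = double≈0⇒even (trans
      (identity ((x , rep (index x) , x) ∷ [])
        (λ { ((x , r , _) ∷ []) → (x ⊕ ⊝ r) ⊕ (x ⊕ ⊝ r) , (x ⊕ x) ⊕ ⊝ (r ⊕ r) }) refl)
      (x≈y⇒x∙y⁻¹≈ε (sym (rep-index x))))
    y : Carrier
    y = proj₁ remainder
    x≈ : x ≈ rep (index x) + (y + y)
    x≈ = trans (identity ((x , rep (index x) , x) ∷ [])
        (λ { ((x , r , _) ∷ []) → x , r ⊕ (x ⊕ ⊝ r) }) refl) (+-congˡ (proj₂ remainder))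
    to : ∀ {i j} → digits i j ≈ x → i ≡ index x × j ≡ index y
    to {i} {j} eq = i≡ , rep-injective (trans
      (+-cancelˡ (rep (index x)) _ _ (trans (+-congʳ (reflexive (≡.cong rep (≡.sym i≡)))) (trans eq x≈)))
      (sym (rep-index y)))
      where
      i≡ : i ≡ index x
      i≡ = index-≡₂ (double⇒≡₂ (trans
        (identity ((rep i , rep j , x) ∷ []) (λ { ((r , s , _) ∷ []) → r ⊕ r , (r ⊕ (s ⊕ s)) ⊕ (r ⊕ (s ⊕ s)) }) refl)
        (+-cong eq eq)))
    from : ∀ {i j} → i ≡ index x × j ≡ index y → digits i j ≈ x
    from (≡.refl , ≡.refl) = trans (+-congˡ (rep-index y)) (sym x≈)

  R-nonunits-count : ∀ {x} → ¬ IsUnit x → ∑[ e ∈ R-nonunits ] 𝟙 (e ≟ x) ≡ 1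
  R-nonunits-count {x} ¬ux = [ (λ ux → contradiction ux ¬ux) , even ]′ (unit⊎even x)
    where
    even : (∃ λ y → x ≈ y + y) → ∑[ e ∈ R-nonunits ] 𝟙 (e ≟ x) ≡ 1
    even (y , x≈2y) = ≡.trans (∑-map _ (allFin q) _)
      (≡.trans (∑-cong (allFin q) λ j → 𝟙-cong ((rep j + rep j) ≟ x) (j Fin.≟ index y)
        (λ 2r≈x → rep-injective (trans 2r≈x (trans x≈2y (sym (rep-index y)))))
        (λ { ≡.refl → trans (rep-index y) (sym x≈2y) }))
      (allFin-count (index y)))

  R-nonunits-sound : All (¬_ ∘ IsUnit) R-nonunits
  R-nonunits-sound = All.map⁺ (All.universal (λ j u → unit⇒≢₂0 u (even⇒≡₂0 refl)) (allFin q))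

  R-elements-count-≡₂ : ∀ x → ∑[ e ∈ R-elements ] 𝟙 (e ≟ˢ x) ≡ q
  R-elements-count-≡₂ x = ≡.trans (∑-cartesian digits (allFin q) (allFin q) _)
    (≡.trans (∑-cong (allFin q) λ i → ∑-cong (allFin q) λ j →
      ≡.trans (𝟙-cong (digits i j ≟ˢ x) (i Fin.≟ index x)
        (λ eq → index-≡₂ (S.trans (S.sym (digit₀ i j)) eq)) (λ { ≡.refl → S.trans (digit₀ i j) (rep-index-≡₂ x) }))
      (≡.sym (ℕ.*-identityʳ _)))
    (≡.trans (∑-× (allFin q) (allFin q) (λ i → 𝟙 (i Fin.≟ index x)) (const 1))
    (≡.trans (≡.cong₂ ℕ._*_ (allFin-count (index x)) (∑-const (allFin q) 1))
    (≡.trans (ℕ.*-identityˡ _) (≡.trans (ℕ.*-identityʳ _) (List.length-tabulate {n = q} id))))))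
    where
    digit₀ : ∀ i j → digits i j ≡₂ rep i
    digit₀ i j = S.trans (S.+-congˡ (even⇒≡₂0 refl)) (S.+-identityʳ (rep i))

  R-local : FiniteLocalRing R
  R-local = record
    { 4≈0 = 4≈0 ; 1≉0 = 1≉0 ; _≟_ = _≟_ ; unit? = unit?
    ; nonunit-+ = λ ¬ux ¬uy ux+y → unit⇒≢₂0 ux+y
        (S.trans (S.+-cong (nonunit⇒≡₂0 ¬ux) (nonunit⇒≡₂0 ¬uy)) (S.+-identityʳ 0#))
    ; elements = R-elements ; nonunits = R-nonunits
    ; elements-count = R-elements-count ; nonunits-count = R-nonunits-count
    ; nonunits-sound = R-nonunits-sound }

  S-2≈0 : 1# + 1# ≡₂ 0#
  S-2≈0 = even⇒≡₂0 refl

  S-4≈0 : 1# + 1# + 1# + 1# ≡₂ 0#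
  S-4≈0 = ≈⇒≡₂ 4≈0

  open VectorAlgebra S S-4≈0 using () renaming (IsUnit to IsUnitˢ)

  unit⇒unitˢ : ∀ {x} → IsUnit x → IsUnitˢ x
  unit⇒unitˢ (y , xy≈1) = y , ≈⇒≡₂ xy≈1

  1≢₂0 : ¬ 1# ≡₂ 0#
  1≢₂0 1≡0 = unit⇒≢₂0 (1# , *-identityʳ 1#) 1≡0

  unitˢ⇒≢₂0 : ∀ {x} → IsUnitˢ x → ¬ x ≡₂ 0#
  unitˢ⇒≢₂0 {x} (y , xy≡1) x≡0 = 1≢₂0 (S.trans (S.sym xy≡1) (S.trans (S.*-congʳ {y} x≡0) (S.zeroˡ y)))

  unitˢ⇒unit : ∀ {x} → IsUnitˢ x → IsUnit x
  unitˢ⇒unit {x} ux = [ id , (λ x≡0 → contradiction x≡0 (unitˢ⇒≢₂0 ux)) ]′ (unit⊎≡₂0 x)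

  nonunitˢ⇒≡₂0 : ∀ {x} → ¬ IsUnitˢ x → x ≡₂ 0#
  nonunitˢ⇒≡₂0 ¬ux = nonunit⇒≡₂0 (¬ux ∘ unit⇒unitˢ)

  S-local : FiniteLocalRing S
  S-local = record
    { 4≈0 = S-4≈0 ; 1≉0 = 1≢₂0 ; _≟_ = _≟ˢ_
    ; unit? = λ x → Dec.map′ unit⇒unitˢ unitˢ⇒unit (unit? x)
    ; nonunit-+ = λ ¬ux ¬uy ux+y → unitˢ⇒≢₂0 ux+y
        (S.trans (S.+-cong (nonunitˢ⇒≡₂0 ¬ux) (nonunitˢ⇒≡₂0 ¬uy)) (S.+-identityʳ 0#))
    ; elements = map rep (allFin q) ; nonunits = 0# ∷ []
    ; elements-count = λ x → ≡.trans (∑-map rep (allFin q) _)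
        (≡.trans (∑-cong (allFin q) λ i → 𝟙-cong (rep i ≟ˢ x) (i Fin.≟ index x)
          index-≡₂ (λ { ≡.refl → rep-index-≡₂ x }))
        (allFin-count (index x)))
    ; nonunits-count = λ {x} ¬ux → ≡.trans (ℕ.+-identityʳ _) (𝟙-yes (0# ≟ˢ x) (S.sym (nonunitˢ⇒≡₂0 ¬ux)))
    ; nonunits-sound = (λ u → unitˢ⇒≢₂0 u S.refl) ∷ [] }

  length-R-elements : length R-elements ≡ q ℕ.* q
  length-R-elements = ≡.trans (length-cartesian digits (allFin q) (allFin q))
    (≡.cong₂ ℕ._*_ (List.length-tabulate {n = q} id) (List.length-tabulate {n = q} id))

  length-R-nonunits : length R-nonunits ≡ q
  length-R-nonunits = ≡.trans (List.length-map _ (allFin q)) (List.length-tabulate {n = q} id)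

  length-S-elements : length (map rep (allFin q)) ≡ q
  length-S-elements = ≡.trans (List.length-map rep (allFin q)) (List.length-tabulate {n = q} id)

-- The hyperoval

module CubicForm (R : CommutativeRing 0ℓ 0ℓ) (q : ℕ) (chain : IsDyadicChainRing R q) where

  open CommutativeRing R using (Carrier; _+_; _*_; 0#; 1#)
  open IsDyadicChainRing chain
  open ResidueField R q chain
  private module S = CommutativeRing S
  open RingProperties S.ring using (x∙y⁻¹≈ε⇒x≈y; x≈y⇒x∙y⁻¹≈ε)
  open VectorAlgebra S S-4≈0 using (unit-cancelʳ) renaming (IsUnit to IsUnitˢ)
  open VectorSolver S 1 S-2≈0
  open import Relation.Binary.Reasoning.Setoid S.setoid

  unitˢ⊎≡₂0 : ∀ x → IsUnitˢ x ⊎ x ≡₂ 0#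
  unitˢ⊎≡₂0 x = [ inj₁ ∘ unit⇒unitˢ , inj₂ ]′ (unit⊎≡₂0 x)

  square≡₂0 : ∀ {x} → x * x ≡₂ 0# → x ≡₂ 0#
  square≡₂0 {x} xx≡0 = [ (λ ux → unit-cancelʳ ux xx≡0) , id ]′ (unitˢ⊎≡₂0 x)

  square-injective : ∀ {x y} → x * x ≡₂ y * y → x ≡₂ y
  square-injective {x} {y} xx≡yy = x∙y⁻¹≈ε⇒x≈y x y (square≡₂0 (S.trans
    (identity ((x , y , y) ∷ []) (λ { ((x , y , _) ∷ []) → (x ⊕ ⊝ y) ⊗ (x ⊕ ⊝ y) , x ⊗ x ⊕ ⊝ (y ⊗ y) }) S.refl)
    (x≈y⇒x∙y⁻¹≈ε xx≡yy)))

  index-cong : ∀ {x y} → x ≡₂ y → index x ≡ index y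
  index-cong {x} x≡y = index-≡₂ (S.trans (rep-index-≡₂ x) x≡y)

  index-injective : ∀ {x y} → index x ≡ index y → x ≡₂ y
  index-injective {x} {y} i≡j =
    S.trans (S.sym (rep-index-≡₂ x)) (S.trans (S.reflexive (≡.cong rep i≡j)) (rep-index-≡₂ y))

  rep-injective-≡₂ : ∀ {i j} → rep i ≡₂ rep j → i ≡ j
  rep-injective-≡₂ = rep-injective ∘ ≡₂⇒double

  -- Modulo 2 squaring is additive, hence injective; on a finite set it is then surjective.
  square-root : ∀ x → ∃ λ s → s * s ≡₂ x
  square-root x =
    let i , eq = injective⇒surjective (λ i → index (rep i * rep i))
          (rep-injective-≡₂ ∘ square-injective ∘ index-injective) (index x)
    in rep i , index-injective eq

  cube+id : Carrier → Carrier
  cube+id t = t * t * t + t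

  cube+id-cong : ∀ {s t} → s ≡₂ t → cube+id s ≡₂ cube+id t
  cube+id-cong s≡t = S.+-cong (S.*-cong (S.*-cong s≡t s≡t) s≡t) s≡t

  -- t³ + t takes the value 0 at both 0 and 1, so it is not injective, hence not surjective.

  cube+id-misses : ∃ λ c → ∀ t → ¬ cube+id t ≡₂ c
  cube+id-misses =
    let j , j∉image = Fin.¬∀⟶∃¬ q (λ j → ∃ λ i → f i ≡ j) (λ j → Fin.any? λ i → f i Fin.≟ j) not-surjective
    in rep j , λ t t³+t≡j → j∉image (index t , ≡.sym (index-≡₂
         (S.trans (S.sym t³+t≡j) (cube+id-cong (S.sym (rep-index-≡₂ t))))))
    where
    f : Fin q → Fin q
    f i = index (cube+id (rep i))
    f-index : ∀ {t} → cube+id t ≡₂ 0# → f (index t) ≡ index 0#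
    f-index {t} eq = index-cong (S.trans (cube+id-cong (rep-index-≡₂ t)) eq)
    not-surjective : ¬ (∀ j → ∃ λ i → f i ≡ j)
    not-surjective f-surj = 1≢₂0 (index-injective (surjective⇒injective f f-surj (≡.trans
      (f-index (identity [] (λ { [] → Κ 1 ⊗ Κ 1 ⊗ Κ 1 ⊕ Κ 1 , Κ 0 }) S.refl))
      (≡.sym (f-index (identity [] (λ { [] → Κ 0 ⊗ Κ 0 ⊗ Κ 0 ⊕ Κ 0 , Κ 0 }) S.refl))))))

  c : Carrier
  c = proj₁ cube+id-misses

  no-root : ∀ t → ¬ cube+id t ≡₂ c
  no-root = proj₂ cube+id-misses

  -- The value 0 is not missed by t³ + t, as it is taken at t = 0.
  c-unit : IsUnitˢ c
  c-unit = [ id , (λ c≡0 → contradiction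
    (S.trans (identity [] (λ { [] → Κ 0 ⊗ Κ 0 ⊗ Κ 0 ⊕ Κ 0 , Κ 0 }) S.refl) (S.sym c≡0)) (no-root 0#)) ]′ (unitˢ⊎≡₂0 c)

  d : Carrier
  d = proj₁ c-unit

  -- Norms of X + Yθ and of x + yθ + zθ², where θ³ + θ = c.

  N₂ : Carrier → Carrier → Carrier
  N₂ X Y = X * X * X + c * (Y * Y * Y) + X * (Y * Y)

  N₃ : Carrier → Carrier → Carrier → Carrier
  N₃ x y z = c * (x * y * z) + (x * x * x + x * (y * y) + x * (z * z)) + c * (y * y * y + c * (z * z * z) + y * (z * z))

  -- A zero with Y invertible would make X / Y a root of t³ + t = c.
  N₂-anisotropic : ∀ X Y → N₂ X Y ≡₂ 0# → X ≡₂ 0# × Y ≡₂ 0#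
  N₂-anisotropic X Y N≡0 = [ unit-case , zero-case ]′ (unitˢ⊎≡₂0 Y)
    where
    unit-case : IsUnitˢ Y → X ≡₂ 0# × Y ≡₂ 0#
    unit-case (i , Yi≡1) = contradiction (begin
      t * t * t + t
        ≈⟨ identity ((t , c , c) ∷ []) (λ { ((t , c , _) ∷ []) →
             t ⊗ t ⊗ t ⊕ t , t ⊗ t ⊗ t ⊕ c ⊗ (Κ 1 ⊗ Κ 1 ⊗ Κ 1) ⊕ t ⊗ (Κ 1 ⊗ Κ 1) ⊕ c }) S.refl ⟩
      t * t * t + c * (1# * 1# * 1#) + t * (1# * 1#) + c
        ≈⟨ S.+-congʳ (S.+-cong (S.+-congˡ (S.*-congˡ (S.*-cong (S.*-cong 1≡Yi 1≡Yi) 1≡Yi)))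
             (S.*-congˡ (S.*-cong 1≡Yi 1≡Yi))) ⟩
      t * t * t + c * ((Y * i) * (Y * i) * (Y * i)) + t * ((Y * i) * (Y * i)) + c
        ≈⟨ identity ((X , Y , i) ∷ (c , c , c) ∷ []) (λ { ((X , Y , i) ∷ (c , _) ∷ []) → let t = X ⊗ i in
             t ⊗ t ⊗ t ⊕ c ⊗ ((Y ⊗ i) ⊗ (Y ⊗ i) ⊗ (Y ⊗ i)) ⊕ t ⊗ ((Y ⊗ i) ⊗ (Y ⊗ i)) ⊕ c ,
             (X ⊗ X ⊗ X ⊕ c ⊗ (Y ⊗ Y ⊗ Y) ⊕ X ⊗ (Y ⊗ Y)) ⊗ (i ⊗ i ⊗ i) ⊕ c }) S.refl ⟩
      N₂ X Y * (i * i * i) + c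
        ≈⟨ S.+-congʳ (S.trans (S.*-congʳ N≡0) (S.zeroˡ _)) ⟩
      0# + c
        ≈⟨ S.+-identityˡ c ⟩
      c ∎) (no-root t)
      where
      t : Carrier
      t = X * i
      1≡Yi : 1# ≡₂ Y * i
      1≡Yi = S.sym Yi≡1
    zero-case : Y ≡₂ 0# → X ≡₂ 0# × Y ≡₂ 0#
    -- X times the norm is X⁴ up to a multiple of Y. The fourth power is reached, rather than the
    -- cube, because `square≡₂0` extracts square roots.
    zero-case Y≡0 = square≡₂0 (square≡₂0 (begin
      X * X * (X * X)
        ≈⟨ identity ((X , Y , c) ∷ []) (λ { ((X , Y , c) ∷ []) →
             X ⊗ X ⊗ (X ⊗ X) , X ⊗ (X ⊗ X ⊗ X ⊕ c ⊗ (Y ⊗ Y ⊗ Y) ⊕ X ⊗ (Y ⊗ Y)) ⊕ X ⊗ (c ⊗ (Y ⊗ Y) ⊕ X ⊗ Y) ⊗ Y }) S.refl ⟩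
      X * N₂ X Y + X * (c * (Y * Y) + X * Y) * Y
        ≈⟨ S.+-cong (S.*-congˡ N≡0) (S.*-congˡ Y≡0) ⟩
      X * 0# + X * (c * (Y * Y) + X * Y) * 0#
        ≈⟨ S.+-cong (S.zeroʳ X) (S.zeroʳ _) ⟩
      0# + 0#
        ≈⟨ S.+-identityʳ 0# ⟩
      0# ∎)) , Y≡0

  -- (x + yθ + zθ²)(y + zθ) = (xy + cz²) + (xz + y² + z²)θ
  N₃-anisotropic : ∀ x y z → N₃ x y z ≡₂ 0# → x ≡₂ 0# × y ≡₂ 0# × z ≡₂ 0#
  N₃-anisotropic x y z N≡0 = [ unit-case , zero-case ]′ (unitˢ⊎≡₂0 z)
    where
    X Y : Carrier
    X = x * y + c * (z * z)
    Y = x * z + y * y + z * z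
    X,Y≡0 : X ≡₂ 0# × Y ≡₂ 0#
    -- The factor y + zθ was chosen to cancel the coefficient of θ² in characteristic 2. The
    -- identity below is multiplicativity of the norm for this product.
    X,Y≡0 = N₂-anisotropic X Y (begin
      N₂ X Y
        ≈⟨ identity ((x , y , z) ∷ (c , c , c) ∷ []) (λ { ((x , y , z) ∷ (c , _) ∷ []) →
             let X = x ⊗ y ⊕ c ⊗ (z ⊗ z) ; Y = x ⊗ z ⊕ y ⊗ y ⊕ z ⊗ z in
             X ⊗ X ⊗ X ⊕ c ⊗ (Y ⊗ Y ⊗ Y) ⊕ X ⊗ (Y ⊗ Y) ,
             (c ⊗ (x ⊗ y ⊗ z) ⊕ (x ⊗ x ⊗ x ⊕ x ⊗ (y ⊗ y) ⊕ x ⊗ (z ⊗ z)) ⊕ c ⊗ (y ⊗ y ⊗ y ⊕ c ⊗ (z ⊗ z ⊗ z) ⊕ y ⊗ (z ⊗ z)))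
               ⊗ (y ⊗ y ⊗ y ⊕ c ⊗ (z ⊗ z ⊗ z) ⊕ y ⊗ (z ⊗ z)) }) S.refl ⟩
      N₃ x y z * N₂ y z ≈⟨ S.*-congʳ N≡0 ⟩
      0# * N₂ y z       ≈⟨ S.zeroˡ _ ⟩
      0#                ∎)
    unit-case : IsUnitˢ z → x ≡₂ 0# × y ≡₂ 0# × z ≡₂ 0#
    -- With t = y / z, the equation Y = 0 reads x / z = t² + 1, and X = 0 then becomes t³ + t = c.
    unit-case (i , zi≡1) = contradiction (begin
      t * t * t + t
        ≈⟨ identity ((t , c , c) ∷ []) (λ { ((t , c , _) ∷ []) →
             t ⊗ t ⊗ t ⊕ t , t ⊗ t ⊗ t ⊕ t ⊗ (Κ 1 ⊗ Κ 1) ⊕ c ⊗ (Κ 1 ⊗ Κ 1) ⊕ c }) S.refl ⟩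
      t * t * t + t * (1# * 1#) + c * (1# * 1#) + c
        ≈⟨ S.+-congʳ (S.+-cong (S.+-congˡ (S.*-congˡ (S.*-cong 1≡zi 1≡zi))) (S.*-congˡ (S.*-cong 1≡zi 1≡zi))) ⟩
      t * t * t + t * ((z * i) * (z * i)) + c * ((z * i) * (z * i)) + c
        ≈⟨ identity ((x , y , z) ∷ (c , i , i) ∷ []) (λ { ((x , y , z) ∷ (c , i , _) ∷ []) →
             let X = x ⊗ y ⊕ c ⊗ (z ⊗ z) ; Y = x ⊗ z ⊕ y ⊗ y ⊕ z ⊗ z ; t = y ⊗ i in
             t ⊗ t ⊗ t ⊕ t ⊗ ((z ⊗ i) ⊗ (z ⊗ i)) ⊕ c ⊗ ((z ⊗ i) ⊗ (z ⊗ i)) ⊕ c ,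
             (i ⊗ i) ⊗ X ⊕ (t ⊗ (i ⊗ i)) ⊗ Y ⊕ (x ⊗ t ⊗ i) ⊗ (Κ 1 ⊕ z ⊗ i) ⊕ c }) S.refl ⟩
      (i * i) * X + (t * (i * i)) * Y + (x * t * i) * (1# + z * i) + c
        ≈⟨ S.+-congʳ (S.+-cong (S.+-cong (S.*-congˡ (proj₁ X,Y≡0)) (S.*-congˡ (proj₂ X,Y≡0))) (S.*-congˡ (S.+-congˡ zi≡1))) ⟩
      (i * i) * 0# + (t * (i * i)) * 0# + (x * t * i) * (1# + 1#) + c
        ≈⟨ identity ((x , t , i) ∷ (c , c , c) ∷ []) (λ { ((x , t , i) ∷ (c , _) ∷ []) →
             (i ⊗ i) ⊗ Κ 0 ⊕ (t ⊗ (i ⊗ i)) ⊗ Κ 0 ⊕ (x ⊗ t ⊗ i) ⊗ (Κ 1 ⊕ Κ 1) ⊕ c , c }) S.refl ⟩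
      c ∎) (no-root t)
      where
      t : Carrier
      t = y * i
      1≡zi : 1# ≡₂ z * i
      1≡zi = S.sym zi≡1
    zero-case : z ≡₂ 0# → x ≡₂ 0# × y ≡₂ 0# × z ≡₂ 0#
    zero-case z≡0 =
      let x≡0 , y≡0 = N₂-anisotropic x y (begin
            N₂ x y
              ≈⟨ identity ((x , y , z) ∷ (c , c , c) ∷ []) (λ { ((x , y , z) ∷ (c , _) ∷ []) →
                   x ⊗ x ⊗ x ⊕ c ⊗ (y ⊗ y ⊗ y) ⊕ x ⊗ (y ⊗ y) ,
                   (c ⊗ (x ⊗ y ⊗ z) ⊕ (x ⊗ x ⊗ x ⊕ x ⊗ (y ⊗ y) ⊕ x ⊗ (z ⊗ z)) ⊕ c ⊗ (y ⊗ y ⊗ y ⊕ c ⊗ (z ⊗ z ⊗ z) ⊕ y ⊗ (z ⊗ z)))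
                     ⊕ (c ⊗ (x ⊗ y) ⊕ x ⊗ z ⊕ c ⊗ (c ⊗ (z ⊗ z) ⊕ y ⊗ z)) ⊗ z }) S.refl ⟩
            N₃ x y z + (c * (x * y) + x * z + c * (c * (z * z) + y * z)) * z
              ≈⟨ S.+-cong N≡0 (S.trans (S.*-congˡ z≡0) (S.zeroʳ _)) ⟩
            0# + 0# ≈⟨ S.+-identityʳ 0# ⟩
            0# ∎)
      in x≡0 , y≡0 , z≡0

module HyperovalFormulas {A : Set} (_+_ _*_ : A → A → A) (c d : A) where

  -- A lift of the coordinatewise square; it depends only on its argument mod 2.
  τ : A × A × A → A × A × A
  τ (x , y , z) =
    let u = d * (y * z) ; v = u + (z * x) ; w = v + (c * (x * y)) in
    (x * x) + (u + u) , (y * y) + (v + v) , (z * z) + (w + w)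

  -- Half of the polar form: τ (y + z) = τ y + τ z + 2 `mixed` y z. Modulo 2, and with b = y ⨯ z,
  -- the three correction terms are db₁, db₁ + b₂ and db₁ + b₂ + cb₃.
  mixed : A × A × A → A × A × A → A × A × A
  mixed (x , y , z) (x′ , y′ , z′) =
    let u = d * ((y * z′) + (z * y′)) ; v = u + ((z * x′) + (x * z′)) ; w = v + (c * ((x * y′) + (y * x′))) in
    (x * x′) + u , (y * y′) + v , (z * z′) + w

  -- The norm form `N₃` divided by c. The product xyz comes from the plain squares, and the rest is
  -- x²(dx) + y²(dx + y) + z²(dx + y + cz), one summand for each correction term of `mixed`.
  -- Conversely, the nested sums in `τ` are read off from these coefficients.
  cubic : A × A × A → A
  cubic (x , y , z) = (x * (y * z)) + ((d * ((x * (x * x)) + ((x * (y * y)) + (x * (z * z)))))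
    + ((y * (y * y)) + ((c * (z * (z * z))) + (y * (z * z)))))

module Hyperoval (R : CommutativeRing 0ℓ 0ℓ) (q : ℕ) (chain : IsDyadicChainRing R q) where

  open CommutativeRing R
  open IsDyadicChainRing chain
  open ResidueField R q chain
  open CubicForm R q chain
  private module S = CommutativeRing S
  open RingProperties ring using (x≈y⇒x∙y⁻¹≈ε)
  open Vectors R
  open Vectors S using () renaming
    (_≋_ to _≋₂_; ≋-refl to ≋₂-refl; ≋-sym to ≋₂-sym; ≋-trans to ≋₂-trans; ∙-cong to ∙-cong₂; ⨯-cong to ⨯-cong₂;
     ∘ᵥ-cong to ∘ᵥ-cong₂; +ᵥ-cong to +ᵥ-cong₂; *ᵥ-cong to *ᵥ-cong₂)
  open VectorAlgebra R 4≈0 using (Unimodular; unit⇒unimodular)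
  open VectorAlgebra S S-4≈0 using (unit-cancelʳ; unit-*) renaming
    (IsUnit to IsUnitˢ; _∥_ to _∥₂_; Unimodular to Unimodular₂; multiple⇒∥ to multiple⇒∥₂; cramer to cramer₂;
     *ᵥ-zero to *ᵥ-zero₂; +ᵥ-identityʳ to +ᵥ-identityʳ₂)
  private module S-plane = ProjectivePlane S S-local
  open S-plane public using () renaming (_∥?_ to _∥₂?_)
  private
    module Mod2 = VectorSolver S 1 S-2≈0
    module Mod4 = VectorSolver R 3 4≈0
    module Formal {n} = HyperovalFormulas {Expr ℕ n} Expr._⊕_ Expr._⊗_

  private
    -- If x = y + 2z, then x² and y² differ by a multiple of 4. A residue class thus determines the
    -- square in R itself.
    square-cong : ∀ {x y} → x ≡₂ y → x * x ≈ y * y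
    square-cong {x} {y} x≡y =
      let z , x-y≈2z = double≈0⇒even {x - y} (trans
            (identity ((x , y , y) ∷ []) (λ { ((x , y , _) ∷ []) → (x ⊕ ⊝ y) ⊕ (x ⊕ ⊝ y) , (x ⊕ x) ⊕ (⊝ (y ⊕ y)) }) refl)
            (x≈y⇒x∙y⁻¹≈ε (≡₂⇒double x≡y)))
          x≈y+2z = trans (identity ((x , y , y) ∷ []) (λ { ((x , y , _) ∷ []) → x , y ⊕ (x ⊕ ⊝ y) }) refl) (+-congˡ x-y≈2z)
      in trans (*-cong x≈y+2z x≈y+2z)
           (identity ((y , z , z) ∷ []) (λ { ((y , z , _) ∷ []) → (y ⊕ (z ⊕ z)) ⊗ (y ⊕ (z ⊕ z)) , y ⊗ y }) refl)
      where open Mod4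

  ≋⇒≋₂ : ∀ {u v} → u ≋ v → u ≋₂ v
  ≋⇒≋₂ (e , f , g) = ≈⇒≡₂ e , ≈⇒≡₂ f , ≈⇒≡₂ g

  unimodular⇒unimodular₂ : ∀ {v} → Unimodular v → Unimodular₂ v
  unimodular⇒unimodular₂ (e , ev≈1) = e , ≈⇒≡₂ ev≈1

  unimodular₂⇒unimodular : ∀ {v} → Unimodular₂ v → Unimodular v
  unimodular₂⇒unimodular (e , ev≡1) = unit⇒unimodular {e} (unitˢ⇒unit (1# , S.trans (S.*-identityʳ _) ev≡1))

  nonzero⇒unimodular₂ : ∀ {v} → ¬ v ≋₂ 0ᵥ → Unimodular₂ v
  nonzero⇒unimodular₂ {x , y , z} v≢0 =
    [ (λ (i , xi≡1) → (i , 0# , 0#) , S.trans (identity ((x , y , z) ∷ (i , i , i) ∷ [])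
        (λ { ((x , y , z) ∷ (i , _) ∷ []) → (i , Κ 0 , Κ 0) ⊙ (x , y , z) , x ⊗ i }) S.refl) xi≡1) , (λ x≡0 →
    [ (λ (i , yi≡1) → (0# , i , 0#) , S.trans (identity ((x , y , z) ∷ (i , i , i) ∷ [])
        (λ { ((x , y , z) ∷ (i , _) ∷ []) → (Κ 0 , i , Κ 0) ⊙ (x , y , z) , y ⊗ i }) S.refl) yi≡1) , (λ y≡0 →
    [ (λ (i , zi≡1) → (0# , 0# , i) , S.trans (identity ((x , y , z) ∷ (i , i , i) ∷ [])
        (λ { ((x , y , z) ∷ (i , _) ∷ []) → (Κ 0 , Κ 0 , i) ⊙ (x , y , z) , z ⊗ i }) S.refl) zi≡1) , (λ z≡0 →
    contradiction (x≡0 , y≡0 , z≡0) v≢0) ]′ (unitˢ⊎≡₂0 z)) ]′ (unitˢ⊎≡₂0 y)) ]′ (unitˢ⊎≡₂0 x)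
    where open Mod2

  open HyperovalFormulas _+_ _*_ c d public

  τ-cong : ∀ {u v} → u ≋₂ v → τ u ≋ τ v
  τ-cong (e , f , g) =
    +-cong (square-cong e) (≡₂⇒double u) , +-cong (square-cong f) (≡₂⇒double v) , +-cong (square-cong g) (≡₂⇒double w)
    where
    u = S.*-congˡ {d} (S.*-cong f g)
    v = S.+-cong u (S.*-cong g e)
    w = S.+-cong v (S.*-congˡ {c} (S.*-cong e f))

  τ-mod2 : ∀ v → τ v ≋₂ v ∘ᵥ v
  τ-mod2 v = identityᵥ (v ∷ (c , d , d) ∷ []) (λ { (v ∷ (c , d , _) ∷ []) → Formal.τ c d v , v ⊚ v }) ≋₂-refl
    where open Mod2

  τ-linear-combination : ∀ y z p s →
    τ (y *ᵥ p +ᵥ z *ᵥ s) ≋ τ y *ᵥ (p * p) +ᵥ τ z *ᵥ (s * s) +ᵥ mixed y z *ᵥ (p * s + p * s)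
  τ-linear-combination y z p s = identityᵥ (y ∷ z ∷ (c , d , d) ∷ (p , s , s) ∷ [])
    (λ { (y ∷ z ∷ (c , d , _) ∷ (p , s , _) ∷ []) →
      Formal.τ c d (y ⊡ p ⊞ z ⊡ s) ,
      Formal.τ c d y ⊡ (p ⊗ p) ⊞ Formal.τ c d z ⊡ (s ⊗ s) ⊞ Formal.mixed c d y z ⊡ (p ⊗ s ⊕ p ⊗ s) })
    ≋-refl
    where open Mod4

  τ-*ᵥ : ∀ v a → τ (v *ᵥ a) ≋ τ v *ᵥ (a * a)
  τ-*ᵥ v a = identityᵥ (v ∷ (c , d , a) ∷ [])
    (λ { (v ∷ (c , d , a) ∷ []) → Formal.τ c d (v ⊡ a) , Formal.τ c d v ⊡ (a ⊗ a) }) ≋-refl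
    where open Mod4

  mixed-det : ∀ y z → mixed y z ∙ ((y ∘ᵥ y) ⨯ (z ∘ᵥ z)) ≡₂ cubic (y ⨯ z)
  mixed-det y z = identity (y ∷ z ∷ (c , d , d) ∷ [])
    (λ { (y ∷ z ∷ (c , d , _) ∷ []) → Formal.mixed c d y z ⊙ ((y ⊚ y) ⊠ (z ⊚ z)) , Formal.cubic c d (y ⊠ z) }) S.refl
    where open Mod2

  cubic-anisotropic : ∀ v → cubic v ≡₂ 0# → v ≋₂ 0ᵥ
  cubic-anisotropic (x , y , z) λ≡0 = N₃-anisotropic x y z (begin
    c * (x * y * z) + (x * x * x + x * (y * y) + x * (z * z)) + c * (y * y * y + c * (z * z * z) + y * (z * z))
      ≈⟨ S.+-congʳ (S.+-congˡ (S.trans (S.sym (S.*-identityˡ _)) (S.*-congʳ (S.sym (proj₂ c-unit))))) ⟩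
    c * (x * y * z) + c * d * (x * x * x + x * (y * y) + x * (z * z)) + c * (y * y * y + c * (z * z * z) + y * (z * z))
      ≈⟨ identity ((x , y , z) ∷ (c , d , d) ∷ []) (λ { ((x , y , z) ∷ (c , d , _) ∷ []) →
        c ⊗ (x ⊗ y ⊗ z) ⊕ c ⊗ d ⊗ (x ⊗ x ⊗ x ⊕ x ⊗ (y ⊗ y) ⊕ x ⊗ (z ⊗ z)) ⊕ c ⊗ (y ⊗ y ⊗ y ⊕ c ⊗ (z ⊗ z ⊗ z) ⊕ y ⊗ (z ⊗ z)) ,
        c ⊗ Formal.cubic c d (x , y , z) }) S.refl ⟩
    c * cubic (x , y , z) ≈⟨ S.*-congˡ λ≡0 ⟩
    c * 0#                ≈⟨ S.zeroʳ c ⟩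
    0#                    ∎)
    where
    open Mod2
    open SetoidReasoning S.setoid

  -- Squaring is a ring homomorphism modulo 2 and so commutes with the determinant. A zero
  -- determinant upstairs therefore makes the residues x, y, z dependent.
  τ-det-mod2 : ∀ x y z → τ x ∙ (τ y ⨯ τ z) ≡₂ (x ∙ (y ⨯ z)) * (x ∙ (y ⨯ z))
  τ-det-mod2 x y z = S.trans (∙-cong₂ (τ-mod2 x) (⨯-cong₂ (τ-mod2 y) (τ-mod2 z)))
    (identity (x ∷ y ∷ z ∷ []) (λ { (x ∷ y ∷ z ∷ []) →
      (x ⊚ x) ⊙ ((y ⊚ y) ⊠ (z ⊚ z)) , (x ⊙ (y ⊠ z)) ⊗ (x ⊙ (y ⊠ z)) }) S.refl)
    where open Mod2

  -- If the classes of the three points are collinear, then τ x = τ (yp + zs), and the determinant is 2ps times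
  -- the cubic form at y ⨯ z.
  τ-noncollinear : ∀ x y z → ¬ y ∥₂ z → τ x ∙ (τ y ⨯ τ z) ≈ 0# → x ∥₂ y ⊎ x ∥₂ z
  τ-noncollinear x y z y∦z det≈0 =
    [ (λ up → [ (λ us → contradiction (both-units up us) y∦z) , (λ s≡0 → inj₁ (multiple⇒∥₂ {p}
        (≋₂-trans x≡yp+zs (≋₂-trans (+ᵥ-cong₂ ≋₂-refl (≋₂-trans (*ᵥ-cong₂ ≋₂-refl s≡0) (*ᵥ-zero₂ z))) (+ᵥ-identityʳ₂ _))))) ]′
        (unitˢ⊎≡₂0 s))
    , (λ p≡0 → inj₂ (multiple⇒∥₂ {s}
        (≋₂-trans x≡yp+zs (≋₂-trans (+ᵥ-cong₂ (≋₂-trans (*ᵥ-cong₂ ≋₂-refl p≡0) (*ᵥ-zero₂ y)) ≋₂-refl) (+ᵥ-identityˡ₂ _))))) ]′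
      (unitˢ⊎≡₂0 p)
    where
    +ᵥ-identityˡ₂ : ∀ v → 0ᵥ +ᵥ v ≋₂ v
    +ᵥ-identityˡ₂ (x , y , z) = S.+-identityˡ x , S.+-identityˡ y , S.+-identityˡ z
    b-unimodular : Unimodular₂ (y ⨯ z)
    b-unimodular = nonzero⇒unimodular₂ y∦z
    e : V
    e = proj₁ b-unimodular
    p s : Carrier
    p = e ∙ (x ⨯ z)
    s = e ∙ (y ⨯ x)
    coplanar : x ∙ (y ⨯ z) ≡₂ 0#
    coplanar = square≡₂0 (S.trans (S.sym (τ-det-mod2 x y z)) (≈⇒≡₂ det≈0))
    x≡yp+zs : x ≋₂ y *ᵥ p +ᵥ z *ᵥ s
    x≡yp+zs = ≋₂-trans (≋₂-sym (VectorAlgebra.*ᵥ-identity S S-4≈0 x))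
      (≋₂-trans (*ᵥ-cong₂ ≋₂-refl (S.sym (proj₂ b-unimodular)))
      (≋₂-trans (cramer₂ e y z x)
      (≋₂-trans (+ᵥ-cong₂ ≋₂-refl (≋₂-trans (*ᵥ-cong₂ (≋₂-refl {e}) coplanar) (*ᵥ-zero₂ e))) (+ᵥ-identityʳ₂ _))))
    M : Carrier
    M = mixed y z ∙ (τ y ⨯ τ z)
    doubled : (M * (p * s)) + (M * (p * s)) ≈ 0#
    -- Of the three terms of τ (yp + zs), only the mixed one survives in a determinant with τ y and
    -- τ z.
    doubled = trans
      (identity (τ y ∷ τ z ∷ mixed y z ∷ (p , s , s) ∷ []) (λ { (Y ∷ Z ∷ M ∷ (p , s , _) ∷ []) →
        ((M ⊙ (Y ⊠ Z)) ⊗ (p ⊗ s)) ⊕ ((M ⊙ (Y ⊠ Z)) ⊗ (p ⊗ s)) ,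
        (Y ⊡ (p ⊗ p) ⊞ Z ⊡ (s ⊗ s) ⊞ M ⊡ (p ⊗ s ⊕ p ⊗ s)) ⊙ (Y ⊠ Z) }) refl)
      (trans (∙-cong (≋-sym (≋-trans (τ-cong x≡yp+zs) (τ-linear-combination y z p s))) (≋-refl {τ y ⨯ τ z})) det≈0)
      where open Mod4
    both-units : IsUnitˢ p → IsUnitˢ s → y ∥₂ z
    -- From 2psM = 0, divide by 2 and by the units p and s: M vanishes modulo 2, and M is the cubic
    -- form at y ⨯ z.
    both-units up us = cubic-anisotropic (y ⨯ z) (S.trans
      (S.sym (S.trans (∙-cong₂ (≋₂-refl {mixed y z}) (⨯-cong₂ (τ-mod2 y) (τ-mod2 z))) (mixed-det y z)))
      (unit-cancelʳ (unit-* up us) (double≈0⇒≡₂0 doubled)))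

  open ProjectivePlane R R-local using (Pt)

  τ-unimodular : ∀ {x} → Unimodular₂ x → Unimodular (τ x)
  τ-unimodular {x} (e , ex≡1) = unimodular₂⇒unimodular (e ∘ᵥ e , S.trans (∙-cong₂ (≋₂-refl {e ∘ᵥ e}) (τ-mod2 x))
    (S.trans (identity (e ∷ x ∷ []) (λ { (e ∷ x ∷ []) → (e ⊚ e) ⊙ (x ⊚ x) , (e ⊙ x) ⊗ (e ⊙ x) }) S.refl)
    (S.trans (S.*-cong ex≡1 ex≡1) (S.*-identityʳ 1#))))
    where open Mod2

  ∘ᵥ-⨯-∘ᵥ : ∀ x y → (x ∘ᵥ x) ⨯ (y ∘ᵥ y) ≋₂ (x ⨯ y) ∘ᵥ (x ⨯ y)
  ∘ᵥ-⨯-∘ᵥ x y = identityᵥ (x ∷ y ∷ []) (λ { (x ∷ y ∷ []) → (x ⊚ x) ⊠ (y ⊚ y) , (x ⊠ y) ⊚ (x ⊠ y) }) ≋₂-refl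
    where open Mod2

  square≋₂0 : ∀ {v} → v ∘ᵥ v ≋₂ 0ᵥ → v ≋₂ 0ᵥ
  square≋₂0 (e , f , g) = square≡₂0 e , square≡₂0 f , square≡₂0 g

  τ-∥₂⁻¹ : ∀ x y → τ x ∥₂ τ y → x ∥₂ y
  τ-∥₂⁻¹ x y τx∥τy = square≋₂0 (≋₂-trans (≋₂-sym (∘ᵥ-⨯-∘ᵥ x y))
    (≋₂-trans (⨯-cong₂ (≋₂-sym (τ-mod2 x)) (≋₂-sym (τ-mod2 y))) τx∥τy))

  hyperoval : List Pt
  hyperoval = map (λ (x , ux) → τ x , τ-unimodular ux) S-plane.plane

  length-hyperoval : length hyperoval ≡ q ℕ.* q ℕ.+ (q ℕ.+ 1)
  length-hyperoval = ≡.trans (List.length-map _ S-plane.plane) (≡.trans S-plane.length-plane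
    (≡.cong₂ ℕ._+_ (≡.cong₂ ℕ._*_ length-S-elements length-S-elements)
      (≡.cong (ℕ._+ 1) (≡.trans (ℕ.+-identityʳ _) length-S-elements))))

  square-rootᵥ : ∀ v → ∃ λ s → s ∘ᵥ s ≋₂ v
  square-rootᵥ (x , y , z) =
    let a , aa≡x = square-root x ; b , bb≡y = square-root y ; e , ee≡z = square-root z
    in (a , b , e) , aa≡x , bb≡y , ee≡z

  -- Modulo 2, τ is the Frobenius map on coordinates, which permutes the points of the residue
  -- plane: τ x lies in the class of v exactly when x is the point of the square roots of the
  -- coordinates of v.
  hyperoval-count : ∀ {v} → Unimodular v → ∑[ t ∈ hyperoval ] 𝟙 (proj₁ t ∥₂? v) ≡ 1
  hyperoval-count {v} uv = ≡.trans (∑-map _ S-plane.plane _)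
    (≡.trans (∑-cong S-plane.plane λ (x , _) → 𝟙-cong (τ x ∥₂? v) (x ∥₂? s) (to x) (from x))
    (S-plane.plane-count s-unimodular))
    where
    open Mod2
    s : V
    s = proj₁ (square-rootᵥ v)
    ss≡v : s ∘ᵥ s ≋₂ v
    ss≡v = proj₂ (square-rootᵥ v)
    s-unimodular : Unimodular₂ s
    s-unimodular = nonzero⇒unimodular₂ λ s≡0 → let e , ev≡1 = unimodular⇒unimodular₂ uv in
      1≢₂0 (S.trans (S.sym ev≡1) (S.trans (∙-cong₂ (≋₂-refl {e}) (≋₂-trans (≋₂-sym ss≡v) (∘ᵥ-cong₂ s≡0 s≡0)))
        (identity (e ∷ []) (λ { (e ∷ []) → e ⊙ ((Κ 0 , Κ 0 , Κ 0) ⊚ (Κ 0 , Κ 0 , Κ 0)) , Κ 0 }) S.refl)))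
    squares : ∀ x → τ x ⨯ v ≋₂ (x ⨯ s) ∘ᵥ (x ⨯ s)
    squares x = ≋₂-trans (⨯-cong₂ (τ-mod2 x) (≋₂-sym ss≡v)) (∘ᵥ-⨯-∘ᵥ x s)
    to : ∀ x → τ x ∥₂ v → x ∥₂ s
    to x τx∥v = square≋₂0 (≋₂-trans (≋₂-sym (squares x)) τx∥v)
    from : ∀ x → x ∥₂ s → τ x ∥₂ v
    from x x∥s = ≋₂-trans (squares x) (≋₂-trans (∘ᵥ-cong₂ x∥s x∥s) (S.zeroˡ 0# , S.zeroˡ 0# , S.zeroˡ 0#))

-- Counting with pencils

module Pencil (R : CommutativeRing 0ℓ 0ℓ) (q : ℕ) (chain : IsDyadicChainRing R q) where

  open CommutativeRing R
  open IsDyadicChainRing chain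
  open ResidueField R q chain
  private module S = CommutativeRing S
  open RingProperties ring using (x∙y⁻¹≈ε⇒x≈y; -0#≈0#; -‿involutive)
  open Vectors R
  open VectorAlgebra R 4≈0
  open VectorSolver R 3 4≈0
  open VectorAlgebra S S-4≈0 using () renaming (Frame to Frame₂; module Frame to Frame₂)
  open Hyperoval R q chain using (_∥₂?_; ≋⇒≋₂; unimodular⇒unimodular₂)
  open FiniteLocalRing R-local using (_≟_)
  open ProjectivePlane R R-local

  private
    +≈0⇔ : ∀ {x y a b} → a ≈ x → b ≈ y → (a + b ≈ 0# → - x ≈ y) × (- x ≈ y → a + b ≈ 0#)
    +≈0⇔ {x} {y} a≈x b≈y =
      (λ a+b≈0 → x∙y⁻¹≈ε⇒x≈y _ _ (trans
        (identity ((x , y , y) ∷ []) (λ { ((x , y , _) ∷ []) → ⊝ x ⊕ ⊝ y , ⊝ (x ⊕ y) }) refl)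
        (trans (-‿cong (trans (sym (+-cong a≈x b≈y)) a+b≈0)) -0#≈0#))) ,
      (λ -x≈y → trans (+-cong a≈x (trans b≈y (sym -x≈y))) (-‿inverseʳ x))

    even-*-even : ∀ {x y z w} → x ≈ y + y → z ≈ w + w → x * z ≈ 0#
    even-*-even {y = y} {w = w} x≈2y z≈2w = trans (*-cong x≈2y z≈2w)
      (identity ((y , w , w) ∷ []) (λ { ((y , w , _) ∷ []) → (y ⊕ y) ⊗ (w ⊕ w) , Κ 0 }) refl)

    negated-unit : ∀ {x} → IsUnit x → IsUnit (- x)
    negated-unit {x} (y , xy≈1) = - y ,
      trans (identity ((x , y , y) ∷ []) (λ { ((x , y , _) ∷ []) → ⊝ x ⊗ ⊝ y , x ⊗ y }) refl) xy≈1

    even⇒nonunit : ∀ {x y} → x ≈ y + y → ¬ IsUnit x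
    even⇒nonunit x≈2y ux = unit⇒≢₂0 ux (even⇒≡₂0 x≈2y)

    negated-even : ∀ {x y} → x ≈ y + y → - x ≈ - y + - y
    negated-even {y = y} x≈2y = trans (-‿cong x≈2y)
      (identity ((y , y , y) ∷ []) (λ { ((y , _) ∷ []) → ⊝ (y ⊕ y) , ⊝ y ⊕ ⊝ y }) refl)

    both₂ : ∀ α β → Dec (α ≡₂ 0# × β ≡₂ 0#)
    both₂ α β = (α ≟ˢ 0#) ×-dec (β ≟ˢ 0#)

    both₀ : ∀ α β → Dec (α ≈ 0# × β ≈ 0#)
    both₀ α β = (α ≟ 0#) ×-dec (β ≟ 0#)

    E J : Carrier → Carrier → ℕ
    E α β = ∑[ e ∈ R-elements ] 𝟙 ((- α) ≟ (e * β))
    J α β = ∑[ e ∈ R-nonunits ] 𝟙 ((- β) ≟ (e * α))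

    -- Here α and β stand for A ∙ w and B ∙ w, where A and B form a frame of v. A member A + eB of
    -- the pencil is orthogonal to w when -α = eβ, and jA + B when -β = jα.
    Count : Carrier → Carrier → Set
    Count α β = E α β ℕ.+ J α β ℕ.+ 𝟙 (both₂ α β) ≡ 1 ℕ.+ (q ℕ.* 𝟙 (both₂ α β) ℕ.+ q ℕ.* q ℕ.* 𝟙 (both₀ α β))

    substitute : ∀ {e n₂ n₀ a c d} → e ≡ a → n₂ ≡ c → n₀ ≡ d →
      a ℕ.+ c ≡ 1 ℕ.+ (q ℕ.* c ℕ.+ q ℕ.* q ℕ.* d) → e ℕ.+ n₂ ≡ 1 ℕ.+ (q ℕ.* n₂ ℕ.+ q ℕ.* q ℕ.* n₀)
    substitute ≡.refl ≡.refl ≡.refl eq = eq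

    assemble : ∀ {e j n₂ n₀ a b c d} → e ≡ a → j ≡ b → n₂ ≡ c → n₀ ≡ d →
      a ℕ.+ b ℕ.+ c ≡ 1 ℕ.+ (q ℕ.* c ℕ.+ q ℕ.* q ℕ.* d) →
      e ℕ.+ j ℕ.+ n₂ ≡ 1 ℕ.+ (q ℕ.* n₂ ℕ.+ q ℕ.* q ℕ.* n₀)
    assemble e≡ j≡ = substitute (≡.cong₂ ℕ._+_ e≡ j≡)

    unit-arith : ∀ q → 1 ≡ 1 ℕ.+ (q ℕ.* 0 ℕ.+ q ℕ.* q ℕ.* 0)
    unit-arith = solve-∀

    neighbour-arith : ∀ q → q ℕ.+ 0 ℕ.+ 1 ≡ 1 ℕ.+ (q ℕ.* 1 ℕ.+ q ℕ.* q ℕ.* 0)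
    neighbour-arith = solve-∀

    zero-arith : ∀ q n → q ℕ.* q ℕ.* n ℕ.+ q ℕ.* 1 ℕ.+ 1 ≡ 1 ℕ.+ (q ℕ.* 1 ℕ.+ q ℕ.* q ℕ.* n)
    zero-arith = solve-∀

    count : ∀ α β → Count α β
    count α β = [ unit-β , (λ (b , β≈2b) → [ unit-α b β≈2b , even-α b β≈2b ]′ (unit⊎even α)) ]′ (unit⊎even β)
      where
      unit-β : IsUnit β → Count α β
      unit-β uβ = assemble (elements-solve (- α) uβ) (nonunits-unsolvable α (negated-unit uβ))
        (𝟙-no (both₂ α β) λ (_ , β≡0) → unit⇒≢₂0 uβ β≡0) (𝟙-no (both₀ α β) λ (_ , β≈0) → unit⇒≢₂0 uβ (≈⇒≡₂ β≈0))
        (unit-arith q)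
      unit-α : ∀ b → β ≈ b + b → IsUnit α → Count α β
      unit-α b β≈2b uα = assemble (elements-unsolvable (negated-unit uα) (even⇒nonunit β≈2b))
        (nonunits-solve (even⇒nonunit (negated-even β≈2b)) uα)
        (𝟙-no (both₂ α β) λ (α≡0 , _) → unit⇒≢₂0 uα α≡0) (𝟙-no (both₀ α β) λ (α≈0 , _) → unit⇒≢₂0 uα (≈⇒≡₂ α≈0))
        (unit-arith q)
      even-α : ∀ b → β ≈ b + b → (∃ λ a → α ≈ a + a) → Count α β
      even-α b β≈2b (a , α≈2a) = [ unit-b , even-b ]′ (unit⊎even b)
        where
        J-const : J α β ≡ q ℕ.* 𝟙 (β ≟ 0#)
        J-const = ≡.trans (∑-congᴬ (All.map nonunit R-nonunits-sound))
          (≡.trans (∑-const R-nonunits _) (≡.cong (ℕ._* 𝟙 (β ≟ 0#)) length-R-nonunits))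
          where
          nonunit : ∀ {j} → ¬ IsUnit j → 𝟙 ((- β) ≟ (j * α)) ≡ 𝟙 (β ≟ 0#)
          nonunit {j} ¬uj = 𝟙-cong (_ ≟ _) (_ ≟ _)
            (λ -β≈jα → trans (sym (-‿involutive β)) (trans (-‿cong (trans -β≈jα jα≈0)) -0#≈0#))
            (λ β≈0 → trans (-‿cong β≈0) (trans -0#≈0# (sym jα≈0)))
            where
            jα≈0 : j * α ≈ 0#
            jα≈0 = [ (λ uj → contradiction uj ¬uj) , (λ (k , j≈2k) → even-*-even j≈2k α≈2a) ]′ (unit⊎even j)
        both₂≡1 : 𝟙 (both₂ α β) ≡ 1
        both₂≡1 = 𝟙-yes (both₂ α β) (even⇒≡₂0 α≈2a , even⇒≡₂0 β≈2b)
        unit-b : IsUnit b → Count α β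
        -- After division by 2, -α = eβ is a congruence that fixes e modulo 2, which leaves q
        -- solutions. A nonunit j gives jα = 0, which differs from -β.
        unit-b (i , bi≈1) = assemble
          (≡.trans (∑-cong R-elements λ e → 𝟙-cong ((- α) ≟ (e * β)) (e ≟ˢ (- a * i)) (to e) (from e))
            (R-elements-count-≡₂ (- a * i)))
          (≡.trans J-const (≡.trans (≡.cong (q ℕ.*_) (𝟙-no (β ≟ 0#) β≉0)) (ℕ.*-zeroʳ q)))
          both₂≡1 (𝟙-no (both₀ α β) (β≉0 ∘ proj₂)) (neighbour-arith q)
          where
          β≉0 : ¬ β ≈ 0#
          β≉0 β≈0 = double-unit (i , bi≈1) (trans (sym β≈2b) β≈0)
          eβ : ∀ e → e * β ≈ e * b + e * b
          eβ e = trans (*-congˡ β≈2b) (distribˡ e b b)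
          to : ∀ e → - α ≈ e * β → e ≡₂ - a * i
          to e eq = S.trans (≈⇒≡₂ (trans (sym (*-identityʳ e)) (trans (*-congˡ (sym bi≈1)) (sym (*-assoc e b i)))))
            (S.*-congʳ (S.sym (double⇒≡₂ (trans (sym (negated-even α≈2a)) (trans eq (eβ e))))))
          from : ∀ e → e ≡₂ - a * i → - α ≈ e * β
          from e eq = trans (negated-even α≈2a) (trans (≡₂⇒double (S.sym (S.trans (S.*-congʳ eq)
            (≈⇒≡₂ (trans (*-assoc (- a) i b) (trans (*-congˡ (trans (*-comm i b) bi≈1)) (*-identityʳ (- a)))))))) (sym (eβ e)))
        even-b : (∃ λ y → b ≈ y + y) → Count α β
        -- Now β = 0. All q nonunits j are solutions, and the q² elements e are all solutions or
        -- none, depending on whether α = 0.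
        even-b (y , b≈2y) = assemble
          (≡.trans (∑-cong R-elements λ e → 𝟙-cong ((- α) ≟ (e * β)) (both₀ α β)
              (λ eq → trans (sym (-‿involutive α)) (trans (-‿cong (trans eq (trans (*-congˡ β≈0) (zeroʳ e)))) -0#≈0#) , β≈0)
              (λ (α≈0 , _) → trans (-‿cong α≈0) (trans -0#≈0# (sym (trans (*-congˡ β≈0) (zeroʳ e))))))
            (≡.trans (∑-const R-elements _) (≡.cong (ℕ._* 𝟙 (both₀ α β)) length-R-elements)))
          (≡.trans J-const (≡.cong (q ℕ.*_) (𝟙-yes (β ≟ 0#) β≈0))) both₂≡1 ≡.refl
          (zero-arith q (𝟙 (both₀ α β)))
          where
          β≈0 : β ≈ 0#
          β≈0 = trans β≈2b (double-even b≈2y)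

    residue-frame : ∀ {v} → Frame v → Frame₂ v
    residue-frame F = record
      { A = A ; B = B ; μ = μ ; μ-unit = unit⇒unitˢ μ-unit ; A⨯B = ≋⇒≋₂ A⨯B }
      where open Frame F

  -- The projective line over R in coordinates with respect to a frame of v: unimodular combinations
  -- of A and B up to units, with the first unit coefficient equal to 1.
  pencil : Pt → List Pt
  pencil (v , uv) = map (λ e → combination 1# e , combination-unimodular uv (inj₁ unit-1)) R-elements
                 ++ map (λ j → combination j 1# , combination-unimodular uv (inj₂ unit-1)) R-nonunits
    where open Frame (unimodular⇒frame uv)

  pencil-sound : ∀ v → All (λ u → proj₁ u ∙ proj₁ v ≈ 0#) (pencil v)
  pencil-sound (v , uv) = All.++⁺ (All.map⁺ (All.universal (λ e → combination-∙v 1# e) R-elements))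
                                  (All.map⁺ (All.universal (λ j → combination-∙v j 1#) R-nonunits))
    where open Frame (unimodular⇒frame uv)

  length-pencil : ∀ v → length (pencil v) ≡ q ℕ.* q ℕ.+ q
  length-pencil v = ≡.trans (List.length-++ (map _ R-elements))
    (≡.cong₂ ℕ._+_ (≡.trans (List.length-map _ R-elements) length-R-elements)
                   (≡.trans (List.length-map _ R-nonunits) length-R-nonunits))

  -- Two points have 1 common line if they are not neighbours, q if they are distinct neighbours,
  -- and q² + q if they are equal. The indicator on the left stands for the subtraction in 1 + q -
  -- 1. A frame of v is also a frame over the residue field, so A ∙ w and B ∙ w detect both
  -- relations.
  pencil-count : ∀ v w → (∑[ u ∈ pencil v ] 𝟙 ((proj₁ u ∙ w) ≟ 0#)) ℕ.+ 𝟙 (w ∥₂? proj₁ v) ≡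
    1 ℕ.+ (q ℕ.* 𝟙 (w ∥₂? proj₁ v) ℕ.+ q ℕ.* q ℕ.* 𝟙 (w ∥? proj₁ v))
  pencil-count (v , uv) w = substitute
    (≡.trans (∑-++ (map _ R-elements) _ _)
      (≡.cong₂ ℕ._+_
        (≡.trans (∑-map _ R-elements _) (∑-cong R-elements λ e → 𝟙-cong (_ ≟ _) (_ ≟ _)
          (λ eq → proj₁ (+≈0⇔ (*-identityˡ (A ∙ w)) (refl {e * (B ∙ w)})) (trans (sym (combination-∙ 1# e w)) eq))
          (λ eq → trans (combination-∙ 1# e w) (proj₂ (+≈0⇔ (*-identityˡ (A ∙ w)) (refl {e * (B ∙ w)})) eq))))
        (≡.trans (∑-map _ R-nonunits _) (∑-cong R-nonunits λ j → 𝟙-cong (_ ≟ _) (_ ≟ _)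
          (λ eq → proj₁ (+≈0⇔ (*-identityˡ (B ∙ w)) (refl {j * (A ∙ w)}))
            (trans (+-comm _ _) (trans (sym (combination-∙ j 1# w)) eq)))
          (λ eq → trans (combination-∙ j 1# w)
            (trans (+-comm _ _) (proj₂ (+≈0⇔ (*-identityˡ (B ∙ w)) (refl {j * (A ∙ w)})) eq)))))))
    (𝟙-cong (w ∥₂? v) (both₂ (A ∙ w) (B ∙ w)) (F₂.∥⇒orthogonal (unimodular⇒unimodular₂ uv))
      (λ (e , f) → F₂.orthogonal⇒∥ e f))
    (𝟙-cong (w ∥? v) (both₀ (A ∙ w) (B ∙ w)) (∥⇒orthogonal uv) (λ (e , f) → orthogonal⇒∥ e f))
    (count (A ∙ w) (B ∙ w))
    where
    open Frame (unimodular⇒frame uv)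
    module F₂ = Frame₂ (residue-frame (unimodular⇒frame uv))

-- Secants of the hyperoval and the dual arc

module DualArc (R : CommutativeRing 0ℓ 0ℓ) (q : ℕ) (chain : IsDyadicChainRing R q) where

  open CommutativeRing R
  open IsDyadicChainRing chain
  open ResidueField R q chain
  private module S = CommutativeRing S
  open RingProperties ring using (-0#≈0#)
  open Vectors R
  open VectorAlgebra R 4≈0
  open Vectors S using () renaming (≋-sym to ≋₂-sym; ≋-trans to ≋₂-trans)
  open VectorAlgebra S S-4≈0 using () renaming
    (_∥_ to _∥₂_; ∥-sym to ∥₂-sym; ∥⇒multiple to ∥₂⇒multiple;
     unimodular-cancel to unimodular₂-cancel; *ᵥ-identity to *ᵥ-identity₂)
  open Hyperoval R q chain
  open FiniteLocalRing R-local using (_≟_)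
  open ProjectivePlane R R-local
  open Pencil R q chain

  infix 4 _⟂?_
  _⟂?_ : (u w : Pt) → Dec (proj₁ u ∙ proj₁ w ≈ 0#)
  (u , _) ⟂? (w , _) = (u ∙ w) ≟ 0#

  𝟙-⟂-comm : ∀ u w → 𝟙 (u ⟂? w) ≡ 𝟙 (w ⟂? u)
  𝟙-⟂-comm u w = 𝟙-cong (u ⟂? w) (w ⟂? u)
    (trans (∙-comm (proj₁ w) (proj₁ u))) (trans (∙-comm (proj₁ u) (proj₁ w)))

  -- For p orthogonal to v take t = p ⨯ e, where e ∙ v = 1. Then v ⨯ t = p, so the vectors
  -- orthogonal to both v and t are the multiples of p. As p is unimodular, t is not a neighbour of
  -- v, and `pencil-count` leaves exactly one member of the pencil.
  pencil-unique : ∀ v p → ∑[ u ∈ pencil v ] 𝟙 (proj₁ u ∥? proj₁ p) ≡ 𝟙 (p ⟂? v)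
  pencil-unique L@(v , uv@(e , ev≈1)) P@(p , up) = by-cases (P ⟂? L)
    where
    by-cases : (P⟂L : Dec (p ∙ v ≈ 0#)) → ∑[ u ∈ pencil L ] 𝟙 (proj₁ u ∥? p) ≡ 𝟙 P⟂L
    by-cases (no pv≉0) = ≡.trans (∑-congᴬ (All.map (λ {u} uv≈0 → 𝟙-no (proj₁ u ∥? p)
      λ u∥p → pv≉0 (∥-resp-∙ (proj₂ u) (∥-sym u∥p) uv≈0)) (pencil-sound L))) (∑-zero (pencil L))
    by-cases (yes pv≈0) = ≡.trans
      (∑-congᴬ (All.map (λ {u} uv≈0 → 𝟙-cong (proj₁ u ∥? p) (_ ≟ 0#) (to u) (from u uv≈0)) (pencil-sound L)))
      (≡.trans (≡.sym (ℕ.+-identityʳ _))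
      (≡.trans (≡.cong ((∑[ u ∈ pencil L ] 𝟙 ((proj₁ u ∙ t) ≟ 0#)) ℕ.+_) (≡.sym not-neighbour))
      (≡.trans (pencil-count L t) (≡.trans (≡.cong₂ (λ a b → 1 ℕ.+ (q ℕ.* a ℕ.+ q ℕ.* q ℕ.* b)) not-neighbour not-equal)
        (vanish q)))))
      where
      vanish : ∀ q → 1 ℕ.+ (q ℕ.* 0 ℕ.+ q ℕ.* q ℕ.* 0) ≡ 1
      vanish = solve-∀
      t : V
      t = p ⨯ e
      v⨯t : v ⨯ t ≋ p
      v⨯t = ≋-trans (⨯-⨯ v p e) (≋-trans (+ᵥ-cong (≋-trans (*ᵥ-cong ≋-refl (trans (∙-comm v e) ev≈1)) (*ᵥ-identity p))
        (≋-trans (*ᵥ-cong (≋-refl {e}) (trans (-‿cong (trans (∙-comm v p) pv≈0)) -0#≈0#)) (*ᵥ-zero e))) (+ᵥ-identityʳ p))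
      t∦v : ¬ t ∥₂ v
      t∦v t∥v = 1≢₂0 (unimodular₂-cancel (unimodular⇒unimodular₂ up) (≋₂-trans (*ᵥ-identity₂ p)
        (≋₂-trans (≋₂-sym (≋⇒≋₂ v⨯t)) (∥₂-sym t∥v))))
      not-neighbour : 𝟙 (t ∥₂? v) ≡ 0
      not-neighbour = 𝟙-no (t ∥₂? v) t∦v
      not-equal : 𝟙 (t ∥? v) ≡ 0
      not-equal = 𝟙-no (t ∥? v) (t∦v ∘ ≋⇒≋₂)
      to : ∀ (u : Pt) → proj₁ u ∥ p → proj₁ u ∙ t ≈ 0#
      to u u∥p = ∥-resp-∙ up u∥p (VectorSolver.identity R 3 4≈0 (p ∷ e ∷ [])
        (λ { (p ∷ e ∷ []) → p ⊙ (p ⊠ e) , Κ 0 }) refl)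
        where open VectorSolver R 3 4≈0
      from : ∀ (u : Pt) → proj₁ u ∙ v ≈ 0# → proj₁ u ∙ t ≈ 0# → proj₁ u ∥ p
      from (u , _) uv≈0 ut≈0 = ≋-trans (⨯-cong (≋-refl {u}) (≋-sym v⨯t)) (≋-trans (⨯-⨯ u v t)
        (≋-trans (+ᵥ-cong (≋-trans (*ᵥ-cong (≋-refl {v}) ut≈0) (*ᵥ-zero v))
          (≋-trans (*ᵥ-cong (≋-refl {t}) (trans (-‿cong uv≈0) -0#≈0#)) (*ᵥ-zero t))) (+ᵥ-identityʳ _)))

  -- The points of the plane on the line v^⊥ and the pencil of v are two transversals of the same classes.
  ∑-pencil : ∀ v (f : Pt → ℕ) → (∀ {u p} → proj₁ u ∥ proj₁ p → f u ≡ f p) →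
    ∑[ p ∈ plane ] (𝟙 (p ⟂? v) ℕ.* f p) ≡ ∑ (pencil v) f
  ∑-pencil v f f-resp = begin
    ∑[ p ∈ plane ] (𝟙 (p ⟂? v) ℕ.* f p)
      ≡⟨ ∑-cong plane (λ p → ≡.trans (≡.cong (ℕ._* f p) (≡.sym (pencil-unique v p))) (≡.sym (∑-*ʳ (pencil v) (f p) _))) ⟩
    ∑[ p ∈ plane ] ∑[ u ∈ pencil v ] (𝟙 (proj₁ u ∥? proj₁ p) ℕ.* f p)
      ≡⟨ ∑-swap plane (pencil v) _ ⟩
    ∑[ u ∈ pencil v ] ∑[ p ∈ plane ] (𝟙 (proj₁ u ∥? proj₁ p) ℕ.* f p)
      ≡⟨ ∑-cong (pencil v) (λ u → ∑-cong plane λ p → respects u p (proj₁ u ∥? proj₁ p) (proj₁ p ∥? proj₁ u)) ⟩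
    ∑[ u ∈ pencil v ] ∑[ p ∈ plane ] (𝟙 (proj₁ p ∥? proj₁ u) ℕ.* f u)
      ≡⟨ ∑-cong (pencil v) (λ u → ≡.trans (∑-*ʳ plane (f u) _)
           (≡.trans (≡.cong (ℕ._* f u) (plane-count (proj₂ u))) (ℕ.*-identityˡ (f u)))) ⟩
    ∑ (pencil v) f ∎
    where
    open ≡.≡-Reasoning
    respects : ∀ u p (d : Dec (proj₁ u ∥ proj₁ p)) (d′ : Dec (proj₁ p ∥ proj₁ u)) → 𝟙 d ℕ.* f p ≡ 𝟙 d′ ℕ.* f u
    respects u p (yes u∥p) d′ = ≡.cong₂ ℕ._*_ (≡.sym (𝟙-yes d′ (∥-sym u∥p))) (≡.sym (f-resp u∥p))
    respects u p (no u∦p)  d′ = ≡.cong (ℕ._* f u) (≡.sym (𝟙-no d′ (u∦p ∘ ∥-sym)))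

  secancy : Pt → ℕ
  secancy u = ∑[ t ∈ hyperoval ] 𝟙 (t ⟂? u)

  secancy-resp : ∀ {u p} → proj₁ u ∥ proj₁ p → secancy u ≡ secancy p
  secancy-resp {u} {p} u∥p = ∑-cong hyperoval λ t → 𝟙-cong (t ⟂? u) (t ⟂? p)
    (λ tu≈0 → trans (∙-comm (proj₁ t) (proj₁ p)) (∥-resp-∙ (proj₂ u) (∥-sym u∥p) (trans (∙-comm (proj₁ u) (proj₁ t)) tu≈0)))
    (λ tp≈0 → trans (∙-comm (proj₁ t) (proj₁ u)) (∥-resp-∙ (proj₂ p) u∥p (trans (∙-comm (proj₁ p) (proj₁ t)) tp≈0)))

  multiplicity : Pt → ℕ
  multiplicity v = ∑[ t ∈ hyperoval ] 𝟙 (proj₁ t ∥? proj₁ v)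

  -- Incidences between the lines through v and the hyperoval, counted at the points t by
  -- `pencil-count`. Exactly one t is in the neighbour class of v; `multiplicity` tells whether it
  -- equals v.
  ∑-pencil-secancy : ∀ v → ∑ (pencil v) secancy ≡ q ℕ.* q ℕ.+ 2 ℕ.* q ℕ.+ q ℕ.* q ℕ.* multiplicity v
  ∑-pencil-secancy v = ℕ.+-cancelʳ-≡ 1 _ _ (begin
    ∑ (pencil v) secancy ℕ.+ 1
      ≡⟨ ≡.cong₂ ℕ._+_ (∑-swap (pencil v) hyperoval _) (≡.sym (hyperoval-count (proj₂ v))) ⟩
    (∑[ t ∈ hyperoval ] ∑[ u ∈ pencil v ] 𝟙 (t ⟂? u)) ℕ.+ (∑[ t ∈ hyperoval ] 𝟙 (proj₁ t ∥₂? proj₁ v))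
      ≡⟨ ∑-+ hyperoval _ _ ⟨
    ∑[ t ∈ hyperoval ] ((∑[ u ∈ pencil v ] 𝟙 (t ⟂? u)) ℕ.+ 𝟙 (proj₁ t ∥₂? proj₁ v))
      ≡⟨ ∑-cong hyperoval (λ t → ≡.trans (≡.cong (ℕ._+ 𝟙 (proj₁ t ∥₂? proj₁ v))
           (∑-cong (pencil v) (𝟙-⟂-comm t)))
           (pencil-count v (proj₁ t))) ⟩
    ∑[ t ∈ hyperoval ] (1 ℕ.+ (q ℕ.* 𝟙 (proj₁ t ∥₂? proj₁ v) ℕ.+ q ℕ.* q ℕ.* 𝟙 (proj₁ t ∥? proj₁ v)))
      ≡⟨ ≡.trans (∑-+ hyperoval _ _) (≡.cong₂ ℕ._+_ (≡.trans (∑-const hyperoval 1) (≡.cong (ℕ._* 1) length-hyperoval))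
           (≡.trans (∑-+ hyperoval _ _) (≡.cong₂ ℕ._+_
             (≡.trans (∑-*ˡ hyperoval q _) (≡.cong (q ℕ.*_) (hyperoval-count (proj₂ v))))
             (∑-*ˡ hyperoval (q ℕ.* q) _)))) ⟩
    (q ℕ.* q ℕ.+ (q ℕ.+ 1)) ℕ.* 1 ℕ.+ (q ℕ.* 1 ℕ.+ q ℕ.* q ℕ.* multiplicity v)
      ≡⟨ arith q (multiplicity v) ⟩
    q ℕ.* q ℕ.+ 2 ℕ.* q ℕ.+ q ℕ.* q ℕ.* multiplicity v ℕ.+ 1 ∎)
    where
    open ≡.≡-Reasoning
    arith : ∀ q m → (q ℕ.* q ℕ.+ (q ℕ.+ 1)) ℕ.* 1 ℕ.+ (q ℕ.* 1 ℕ.+ q ℕ.* q ℕ.* m) ≡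
      q ℕ.* q ℕ.+ 2 ℕ.* q ℕ.+ q ℕ.* q ℕ.* m ℕ.+ 1
    arith = solve-∀

  private
    module S-plane = ProjectivePlane S S-local

    τ-point : S-plane.Pt → Pt
    τ-point (x , ux) = τ x , τ-unimodular ux

    ∑-hyperoval : ∀ f → ∑ hyperoval f ≡ ∑ S-plane.plane (f ∘ τ-point)
    ∑-hyperoval = ∑-map τ-point S-plane.plane

  -- If all points x with τ x on the line lie in one class, there is at most one. Otherwise fix two
  -- of them in different classes: by `τ-noncollinear` any other one lies in one of these classes,
  -- and each class contains a single point.
  secancy≤2 : ∀ u → secancy u ≤ 2
  secancy≤2 u = ≡.subst (_≤ 2) (≡.sym (∑-hyperoval (λ t → 𝟙 (t ⟂? u)))) (bounded _ ≡.refl)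
    where
    points : List S-plane.Pt
    points = S-plane.plane
    on? : ∀ x → Dec (proj₁ (τ-point x) ∙ proj₁ u ≈ 0#)
    on? x = τ-point x ⟂? u
    third : ∀ x₀ → Dec (Any (λ x → proj₁ (τ-point x) ∙ proj₁ u ≈ 0# × ¬ proj₁ x ∥₂ proj₁ x₀) points)
    third x₀ = Any.any? (λ x → on? x ×-dec ¬? (proj₁ x ∥₂? proj₁ x₀)) points
    bounded : ∀ n → n ≡ ∑[ x ∈ points ] 𝟙 (on? x) → n ≤ 2
    bounded zero    eq = z≤n
    bounded (suc n) eq = ≡.subst (_≤ 2) (≡.sym eq)
      (from-first (Any.satisfied (count>0 on? points (≡.subst (1 ≤_) eq (s≤s z≤n)))))
      where
      from-first : (∃ λ x₀ → proj₁ (τ-point x₀) ∙ proj₁ u ≈ 0#) → ∑[ x ∈ points ] 𝟙 (on? x) ≤ 2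
      from-first (x₀ , on₀) = by-second (third x₀)
        where
        by-second : Dec (Any (λ x → proj₁ (τ-point x) ∙ proj₁ u ≈ 0# × ¬ proj₁ x ∥₂ proj₁ x₀) points) →
          ∑[ x ∈ points ] 𝟙 (on? x) ≤ 2
        by-second (no none) = ℕ.≤-trans
          (ℕ.≤-trans (∑-monoᴬ (All.map (λ {x} ¬other → 𝟙-mono (on? x) (proj₁ x ∥₂? proj₁ x₀)
              (λ on → Dec.decidable-stable (proj₁ x ∥₂? proj₁ x₀) λ x∦x₀ → ¬other (on , x∦x₀))) (All.¬Any⇒All¬ points none)))
            (ℕ.≤-reflexive (S-plane.plane-count (proj₂ x₀))))
          (s≤s z≤n)
        by-second (yes some) = let x₁ , on₁ , x₁∦x₀ = Any.satisfied some in ℕ.≤-trans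
          (∑-mono points λ x → 𝟙-⊎ (on? x) (proj₁ x ∥₂? proj₁ x₁) (proj₁ x ∥₂? proj₁ x₀)
            λ on → τ-noncollinear (proj₁ x) (proj₁ x₁) (proj₁ x₀) x₁∦x₀ (concurrent⇒det≈0 (proj₂ u) on on₁ on₀))
          (ℕ.≤-reflexive (≡.trans (∑-+ points _ _)
            (≡.cong₂ ℕ._+_ (S-plane.plane-count (proj₂ x₁)) (S-plane.plane-count (proj₂ x₀)))))

  -- Modulo 2, τ separates points; conversely, neighbours have the same image because τ (xa) = τ x
  -- a².
  multiplicity-τ : ∀ x → multiplicity (τ-point x) ≡ 1
  multiplicity-τ X₀@(x₀ , u₀@(e , ex≡1)) = ≡.trans (∑-hyperoval _)
    (≡.trans (∑-cong S-plane.plane λ X@(x , _) → 𝟙-cong (τ x ∥? τ x₀) (x ∥₂? x₀)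
      (λ τx∥τx₀ → τ-∥₂⁻¹ x x₀ (≋⇒≋₂ τx∥τx₀)) (λ x∥x₀ → multiple⇒∥ {a x * a x}
        (≋-trans (τ-cong (∥₂⇒multiple {e} ex≡1 x∥x₀)) (τ-*ᵥ x₀ (a x)))))
    (S-plane.plane-count u₀))
    where
    a : V → Carrier
    a x = e ∙ x

  -- The q² + q lines through τ x have secancies at most 2 with sum 2(q² + q), so all of them are 2.
  -- The given u is parallel to one of the vectors in the pencil.
  secancy≡2 : ∀ u x → proj₁ (τ-point x) ∙ proj₁ u ≈ 0# → secancy u ≡ 2
  secancy≡2 u x xu≈0 =
    let p , p≡2 , p∥u = All×Any⇒∃ all-2 through-u in ≡.trans (secancy-resp {u} {p} (∥-sym p∥u)) p≡2
    where
    all-2 : All (λ p → secancy p ≡ 2) (pencil (τ-point x))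
    all-2 = ∑-≡⇒All-≡ (pencil (τ-point x)) secancy≤2 (begin
      ∑ (pencil (τ-point x)) secancy                        ≡⟨ ∑-pencil-secancy (τ-point x) ⟩
      q ℕ.* q ℕ.+ 2 ℕ.* q ℕ.+ q ℕ.* q ℕ.* multiplicity (τ-point x)
        ≡⟨ ≡.cong (λ m → q ℕ.* q ℕ.+ 2 ℕ.* q ℕ.+ q ℕ.* q ℕ.* m) (multiplicity-τ x) ⟩
      q ℕ.* q ℕ.+ 2 ℕ.* q ℕ.+ q ℕ.* q ℕ.* 1                 ≡⟨ arith q ⟩
      (q ℕ.* q ℕ.+ q) ℕ.* 2                                 ≡⟨ ≡.cong (ℕ._* 2) (length-pencil (τ-point x)) ⟨
      length (pencil (τ-point x)) ℕ.* 2                     ≡⟨ ∑-const (pencil (τ-point x)) 2 ⟨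
      ∑ (pencil (τ-point x)) (const 2)                      ∎)
      where
      open ≡.≡-Reasoning
      arith : ∀ q → q ℕ.* q ℕ.+ 2 ℕ.* q ℕ.+ q ℕ.* q ℕ.* 1 ≡ (q ℕ.* q ℕ.+ q) ℕ.* 2
      arith = solve-∀
    through-u : Any (λ p → proj₁ p ∥ proj₁ u) (pencil (τ-point x))
    through-u = count>0 (λ p → proj₁ p ∥? proj₁ u) (pencil (τ-point x)) (ℕ.≤-reflexive (≡.sym (≡.trans
      (pencil-unique (τ-point x) u)
      (𝟙-yes (u ⟂? τ-point x) (trans (∙-comm (proj₁ u) (τ (proj₁ x))) xu≈0)))))

  external? : ∀ u → Dec (secancy u ≡ 0)
  external? u = secancy u ℕ.≟ 0

  -- The dichotomy between external lines and secants as a linear equation, in which form it can be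
  -- summed over the plane or over a pencil.
  secancy-0-2 : ∀ u → secancy u ℕ.+ 2 ℕ.* 𝟙 (external? u) ≡ 2
  secancy-0-2 u = go (secancy u) ≡.refl
    where
    go : ∀ n → n ≡ secancy u → secancy u ℕ.+ 2 ℕ.* 𝟙 (external? u) ≡ 2
    go zero    eq = ≡.cong₂ (λ a b → a ℕ.+ 2 ℕ.* b) (≡.sym eq) (𝟙-yes (external? u) (≡.sym eq))
    go (suc n) eq =
      let x , on = Any.satisfied (count>0 (λ x → τ-point x ⟂? u) S-plane.plane
            (ℕ.≤-trans (s≤s z≤n) (ℕ.≤-reflexive (≡.trans eq (∑-hyperoval λ t → 𝟙 (t ⟂? u))))))
      in ≡.cong₂ (λ a b → a ℕ.+ 2 ℕ.* b) (secancy≡2 u x on)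
           (𝟙-no (external? u) λ eq₀ → ℕ.0≢1+n (≡.trans (≡.sym eq₀) (≡.sym eq)))

  dualArc : List Pt
  dualArc = filter external? plane

  private
    length-filter : ∑[ p ∈ plane ] 𝟙 (external? p) ≡ length dualArc
    length-filter = ≡.trans (≡.trans (∑-cong plane λ p → ≡.sym (ℕ.*-identityʳ _)) (≡.sym (∑-filter external? plane (const 1))))
      (≡.trans (∑-const dualArc 1) (ℕ.*-identityʳ _))

  -- Summing `secancy-0-2` over the q⁴ + q³ + q² lines and counting the incidences at the hyperoval
  -- gives 2|arc| = 2(q⁴ + q³ + q²) - (q² + q + 1)(q² + q) = q⁴ - q.
  length-dualArc : 2 ℕ.* length dualArc ℕ.+ q ≡ q ℕ.* q ℕ.* (q ℕ.* q)
  length-dualArc = ℕ.+-cancelˡ-≡ ((q ℕ.* q ℕ.+ (q ℕ.+ 1)) ℕ.* (q ℕ.* q ℕ.+ q)) _ _ (begin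
    (q ℕ.* q ℕ.+ (q ℕ.+ 1)) ℕ.* (q ℕ.* q ℕ.+ q) ℕ.+ (2 ℕ.* length dualArc ℕ.+ q)
      ≡⟨ ℕ.+-assoc ((q ℕ.* q ℕ.+ (q ℕ.+ 1)) ℕ.* (q ℕ.* q ℕ.+ q)) _ q ⟨
    (q ℕ.* q ℕ.+ (q ℕ.+ 1)) ℕ.* (q ℕ.* q ℕ.+ q) ℕ.+ 2 ℕ.* length dualArc ℕ.+ q
      ≡⟨ ≡.cong (ℕ._+ q) (≡.cong₂ ℕ._+_ (≡.sym total-secancy) (≡.cong (2 ℕ.*_) (≡.sym length-filter))) ⟩
    ∑ plane secancy ℕ.+ 2 ℕ.* (∑[ p ∈ plane ] 𝟙 (external? p)) ℕ.+ q
      ≡⟨ ≡.cong (ℕ._+ q) (≡.trans (≡.cong (∑ plane secancy ℕ.+_) (≡.sym (∑-*ˡ plane 2 _))) (≡.sym (∑-+ plane _ _))) ⟩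
    (∑[ p ∈ plane ] (secancy p ℕ.+ 2 ℕ.* 𝟙 (external? p))) ℕ.+ q
      ≡⟨ ≡.cong (ℕ._+ q) (≡.trans (∑-cong plane secancy-0-2) (≡.trans (∑-const plane 2) (≡.cong (ℕ._* 2) length-plane))) ⟩
    (length R-elements ℕ.* length R-elements ℕ.+
      (length R-nonunits ℕ.* length R-elements ℕ.+ length R-nonunits ℕ.* length R-nonunits)) ℕ.* 2 ℕ.+ q
      ≡⟨ ≡.cong₂ (λ m n → (m ℕ.* m ℕ.+ (n ℕ.* m ℕ.+ n ℕ.* n)) ℕ.* 2 ℕ.+ q) length-R-elements length-R-nonunits ⟩
    (q ℕ.* q ℕ.* (q ℕ.* q) ℕ.+ (q ℕ.* (q ℕ.* q) ℕ.+ q ℕ.* q)) ℕ.* 2 ℕ.+ q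
      ≡⟨ arith q ⟩
    (q ℕ.* q ℕ.+ (q ℕ.+ 1)) ℕ.* (q ℕ.* q ℕ.+ q) ℕ.+ q ℕ.* q ℕ.* (q ℕ.* q) ∎)
    where
    open ≡.≡-Reasoning
    arith : ∀ q → (q ℕ.* q ℕ.* (q ℕ.* q) ℕ.+ (q ℕ.* (q ℕ.* q) ℕ.+ q ℕ.* q)) ℕ.* 2 ℕ.+ q ≡
      (q ℕ.* q ℕ.+ (q ℕ.+ 1)) ℕ.* (q ℕ.* q ℕ.+ q) ℕ.+ q ℕ.* q ℕ.* (q ℕ.* q)
    arith = solve-∀
    total-secancy : ∑ plane secancy ≡ (q ℕ.* q ℕ.+ (q ℕ.+ 1)) ℕ.* (q ℕ.* q ℕ.+ q)
    total-secancy = begin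
      ∑[ p ∈ plane ] ∑[ t ∈ hyperoval ] 𝟙 (t ⟂? p) ≡⟨ ∑-swap plane hyperoval _ ⟩
      ∑[ t ∈ hyperoval ] ∑[ p ∈ plane ] 𝟙 (t ⟂? p)
        ≡⟨ ∑-cong hyperoval (λ t → ∑-cong plane λ p → ≡.trans (𝟙-⟂-comm t p) (≡.sym (ℕ.*-identityʳ _))) ⟩
      ∑[ t ∈ hyperoval ] ∑[ p ∈ plane ] (𝟙 (p ⟂? t) ℕ.* 1)
        ≡⟨ ∑-cong hyperoval (λ t → ≡.trans (∑-pencil t (const 1) (λ _ → ≡.refl)) (≡.trans (∑-const (pencil t) 1)
             (≡.trans (ℕ.*-identityʳ _) (length-pencil t)))) ⟩
      ∑[ t ∈ hyperoval ] (q ℕ.* q ℕ.+ q) ≡⟨ ∑-const hyperoval _ ⟩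
      length hyperoval ℕ.* (q ℕ.* q ℕ.+ q) ≡⟨ ≡.cong (ℕ._* (q ℕ.* q ℕ.+ q)) length-hyperoval ⟩
      (q ℕ.* q ℕ.+ (q ℕ.+ 1)) ℕ.* (q ℕ.* q ℕ.+ q) ∎

  -- Sum `secancy-0-2` over the pencil of v and compare with `∑-pencil-secancy`: the number N of
  -- external lines through v satisfies 2N = q² - q²m, with m the multiplicity of v. The lines that
  -- miss the arc are thus the points of the hyperoval.
  dualArc-line : ∀ v → ∑[ p ∈ dualArc ] 𝟙 (p ⟂? v) ≡ 0 ⊎ 2 ℕ.* (∑[ p ∈ dualArc ] 𝟙 (p ⟂? v)) ≡ q ℕ.* q
  dualArc-line v = by-cases (multiplicity v) ≡.refl multiplicity≤1
    where
    open ≡.≡-Reasoning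
    N : ℕ
    N = ∑[ p ∈ dualArc ] 𝟙 (p ⟂? v)
    N≡ : N ≡ ∑[ u ∈ pencil v ] 𝟙 (external? u)
    N≡ = begin
      ∑[ p ∈ dualArc ] 𝟙 (p ⟂? v)                        ≡⟨ ∑-filter external? plane _ ⟩
      ∑[ p ∈ plane ] (𝟙 (external? p) ℕ.* 𝟙 (p ⟂? v))    ≡⟨ ∑-cong plane (λ p → ℕ.*-comm (𝟙 (external? p)) _) ⟩
      ∑[ p ∈ plane ] (𝟙 (p ⟂? v) ℕ.* 𝟙 (external? p))
        ≡⟨ ∑-pencil v (λ p → 𝟙 (external? p)) (λ {u} {p} u∥p → 𝟙-cong (external? u) (external? p)
             (≡.trans (secancy-resp {p} {u} (∥-sym u∥p))) (≡.trans (secancy-resp {u} {p} u∥p))) ⟩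
      ∑[ u ∈ pencil v ] 𝟙 (external? u)                  ∎
    multiplicity≤1 : multiplicity v ≤ 1
    multiplicity≤1 = ℕ.≤-trans (∑-mono hyperoval λ t → 𝟙-mono (proj₁ t ∥? proj₁ v) (proj₁ t ∥₂? proj₁ v) ≋⇒≋₂)
      (ℕ.≤-reflexive (hyperoval-count (proj₂ v)))
    balance : q ℕ.* q ℕ.+ 2 ℕ.* q ℕ.+ q ℕ.* q ℕ.* multiplicity v ℕ.+ 2 ℕ.* N ≡ (q ℕ.* q ℕ.+ q) ℕ.* 2
    balance = begin
      q ℕ.* q ℕ.+ 2 ℕ.* q ℕ.+ q ℕ.* q ℕ.* multiplicity v ℕ.+ 2 ℕ.* N
        ≡⟨ ≡.cong₂ ℕ._+_ (≡.sym (∑-pencil-secancy v)) (≡.trans (≡.cong (2 ℕ.*_) N≡) (≡.sym (∑-*ˡ (pencil v) 2 _))) ⟩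
      ∑ (pencil v) secancy ℕ.+ (∑[ u ∈ pencil v ] (2 ℕ.* 𝟙 (external? u)))
        ≡⟨ ∑-+ (pencil v) _ _ ⟨
      ∑[ u ∈ pencil v ] (secancy u ℕ.+ 2 ℕ.* 𝟙 (external? u))
        ≡⟨ ≡.trans (∑-cong (pencil v) secancy-0-2) (∑-const (pencil v) 2) ⟩
      length (pencil v) ℕ.* 2 ≡⟨ ≡.cong (ℕ._* 2) (length-pencil v) ⟩
      (q ℕ.* q ℕ.+ q) ℕ.* 2 ∎
    by-cases : ∀ m → multiplicity v ≡ m → m ≤ 1 → N ≡ 0 ⊎ 2 ℕ.* N ≡ q ℕ.* q
    by-cases 0 eq _ = inj₂ (ℕ.+-cancelˡ-≡ (q ℕ.* q ℕ.+ 2 ℕ.* q ℕ.+ q ℕ.* q ℕ.* 0) _ _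
      (≡.trans (≡.cong (λ m → q ℕ.* q ℕ.+ 2 ℕ.* q ℕ.+ q ℕ.* q ℕ.* m ℕ.+ 2 ℕ.* N) (≡.sym eq)) (≡.trans balance (arith q))))
      where
      arith : ∀ q → (q ℕ.* q ℕ.+ q) ℕ.* 2 ≡ q ℕ.* q ℕ.+ 2 ℕ.* q ℕ.+ q ℕ.* q ℕ.* 0 ℕ.+ q ℕ.* q
      arith = solve-∀
    by-cases 1 eq _ = inj₁ (ℕ.*-cancelˡ-≡ N 0 2 (ℕ.+-cancelˡ-≡ (q ℕ.* q ℕ.+ 2 ℕ.* q ℕ.+ q ℕ.* q ℕ.* 1) _ _
      (≡.trans (≡.cong (λ m → q ℕ.* q ℕ.+ 2 ℕ.* q ℕ.+ q ℕ.* q ℕ.* m ℕ.+ 2 ℕ.* N) (≡.sym eq)) (≡.trans balance (arith q)))))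
      where
      arith : ∀ q → (q ℕ.* q ℕ.+ q) ℕ.* 2 ≡ q ℕ.* q ℕ.+ 2 ℕ.* q ℕ.+ q ℕ.* q ℕ.* 1 ℕ.+ 0
      arith = solve-∀
    by-cases (suc (suc m)) eq (s≤s ())

  -- Parallel entries are counted in the sum over the arc, which is at most the sum over `plane`,
  -- and that is 1.
  dualArc-distinct : ∀ i j → let p = proj₁ (lookup dualArc i) ; p′ = proj₁ (lookup dualArc j) in
    p ∥ p′ → i ≡ j
  dualArc-distinct i j p∥p′ = count≤1⇒unique (λ p → proj₁ p ∥? proj₁ p′) dualArc
    (ℕ.≤-trans (ℕ.≤-reflexive (∑-filter external? plane _))
    (ℕ.≤-trans (∑-mono plane λ p → drop (external? p) _) (ℕ.≤-reflexive (plane-count (proj₂ p′)))))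
    i j p∥p′ (⨯-self (proj₁ p′))
    where
    p′ : Pt
    p′ = lookup dualArc j
    drop : ∀ {A : Set} (d : Dec A) n → 𝟙 d ℕ.* n ≤ n
    drop (yes _) n = ℕ.≤-reflexive (ℕ.+-identityʳ n)
    drop (no _)  n = z≤n

-- The upper bound for arcs

dense-class-bound : ∀ q .{{_ : ℕ.NonZero q}} k u m n s → 1 ≤ m → 2 ℕ.* n ≡ q ℕ.* q → q ℕ.* q < 2 ℕ.* u ℕ.+ q →
  s ℕ.+ u ≡ k ℕ.+ (q ℕ.* u ℕ.+ q ℕ.* q ℕ.* m) → s ≤ (q ℕ.* q ℕ.+ q) ℕ.* n →
  2 ℕ.* k ℕ.+ q ≤ q ℕ.* q ℕ.* (q ℕ.* q)
-- Writing q - 1 as r, `balance` becomes s = k + ru + q²m. Inserting 2u ≥ q² - q and m ≥ 1 leaves 2k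
-- ≤ (q² + q)q² - (q - 1)(q² - q) - 2q² = q⁴ - q.
dense-class-bound q@(suc r) k u m n s 1≤m 2n≡q² dense balance s≤ =
  ℕ.+-cancelʳ-≤ (q ℕ.* q ℕ.* q ℕ.+ q ℕ.* q) _ _ (begin
    2 ℕ.* k ℕ.+ q ℕ.+ (q ℕ.* q ℕ.* q ℕ.+ q ℕ.* q)
      ≡⟨ arith₁ r k ⟩
    2 ℕ.* k ℕ.+ q ℕ.+ 2 ℕ.* (q ℕ.* q) ℕ.+ r ℕ.* (q ℕ.* q)
      ≤⟨ ℕ.+-monoʳ-≤ (2 ℕ.* k ℕ.+ q ℕ.+ 2 ℕ.* (q ℕ.* q)) (ℕ.*-monoʳ-≤ r (ℕ.<⇒≤ dense)) ⟩
    2 ℕ.* k ℕ.+ q ℕ.+ 2 ℕ.* (q ℕ.* q) ℕ.+ r ℕ.* (2 ℕ.* u ℕ.+ q)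
      ≡⟨ arith₂ r k u ⟩
    2 ℕ.* (k ℕ.+ r ℕ.* u ℕ.+ q ℕ.* q ℕ.* 1) ℕ.+ q ℕ.* q
      ≤⟨ ℕ.+-monoˡ-≤ (q ℕ.* q) (ℕ.*-monoʳ-≤ 2 (ℕ.+-monoʳ-≤ (k ℕ.+ r ℕ.* u) (ℕ.*-monoʳ-≤ (q ℕ.* q) 1≤m))) ⟩
    2 ℕ.* (k ℕ.+ r ℕ.* u ℕ.+ q ℕ.* q ℕ.* m) ℕ.+ q ℕ.* q
      ≡⟨ ≡.cong (λ s → 2 ℕ.* s ℕ.+ q ℕ.* q) s≡ ⟨
    2 ℕ.* s ℕ.+ q ℕ.* q
      ≤⟨ ℕ.+-monoˡ-≤ (q ℕ.* q) (ℕ.*-monoʳ-≤ 2 s≤) ⟩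
    2 ℕ.* ((q ℕ.* q ℕ.+ q) ℕ.* n) ℕ.+ q ℕ.* q
      ≡⟨ ≡.cong (ℕ._+ q ℕ.* q) (arith₃ (q ℕ.* q ℕ.+ q) n) ⟩
    (q ℕ.* q ℕ.+ q) ℕ.* (2 ℕ.* n) ℕ.+ q ℕ.* q
      ≡⟨ ≡.cong (λ x → (q ℕ.* q ℕ.+ q) ℕ.* x ℕ.+ q ℕ.* q) 2n≡q² ⟩
    (q ℕ.* q ℕ.+ q) ℕ.* (q ℕ.* q) ℕ.+ q ℕ.* q
      ≡⟨ arith₄ q ⟩
    q ℕ.* q ℕ.* (q ℕ.* q) ℕ.+ (q ℕ.* q ℕ.* q ℕ.+ q ℕ.* q) ∎)
  where
  open ℕ.≤-Reasoning
  s≡ : s ≡ k ℕ.+ r ℕ.* u ℕ.+ q ℕ.* q ℕ.* m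
  s≡ = ℕ.+-cancelʳ-≡ u _ _ (≡.trans balance (arith k r u (q ℕ.* q ℕ.* m)))
    where
    arith : ∀ k r u x → k ℕ.+ ((u ℕ.+ r ℕ.* u) ℕ.+ x) ≡ k ℕ.+ r ℕ.* u ℕ.+ x ℕ.+ u
    arith = solve-∀
  arith₁ : ∀ r k → let q = 1 ℕ.+ r in
    2 ℕ.* k ℕ.+ q ℕ.+ (q ℕ.* q ℕ.* q ℕ.+ q ℕ.* q) ≡ 2 ℕ.* k ℕ.+ q ℕ.+ 2 ℕ.* (q ℕ.* q) ℕ.+ r ℕ.* (q ℕ.* q)
  arith₁ = solve-∀
  arith₂ : ∀ r k u → let q = 1 ℕ.+ r in
    2 ℕ.* k ℕ.+ q ℕ.+ 2 ℕ.* (q ℕ.* q) ℕ.+ r ℕ.* (2 ℕ.* u ℕ.+ q) ≡ 2 ℕ.* (k ℕ.+ r ℕ.* u ℕ.+ q ℕ.* q ℕ.* 1) ℕ.+ q ℕ.* q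
  arith₂ = solve-∀
  arith₃ : ∀ a n → 2 ℕ.* (a ℕ.* n) ≡ a ℕ.* (2 ℕ.* n)
  arith₃ = solve-∀
  arith₄ : ∀ q → (q ℕ.* q ℕ.+ q) ℕ.* (q ℕ.* q) ℕ.+ q ℕ.* q ≡ q ℕ.* q ℕ.* (q ℕ.* q) ℕ.+ (q ℕ.* q ℕ.* q ℕ.+ q ℕ.* q)
  arith₄ = solve-∀

module Maximality (R : CommutativeRing 0ℓ 0ℓ) (q : ℕ) (chain : IsDyadicChainRing R q) where

  open CommutativeRing R
  open IsDyadicChainRing chain
  open ResidueField R q chain
  open Vectors R
  open VectorAlgebra R 4≈0
  open VectorAlgebra S S-4≈0 using () renaming (∥-sym to ∥₂-sym; ∥-trans to ∥₂-trans)
  open Hyperoval R q chain using (_∥₂?_; hyperoval; hyperoval-count; length-hyperoval; unimodular⇒unimodular₂)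
  open ProjectivePlane R R-local
  open Pencil R q chain
  open DualArc R q chain using (_⟂?_; 𝟙-⟂-comm)

  -- The hyperoval appears here as a system of representatives of the q² + q + 1 neighbour classes.
  -- If no class is dense, summing 2u ≤ q² - q over it gives 2k ≤ (q² + q + 1)(q² - q) = q⁴ - q.
  arc-bound : ∀ (points : List Pt) n → 2 ℕ.* n ≡ q ℕ.* q → (∀ w → ∑[ p ∈ points ] 𝟙 (p ⟂? w) ≤ n) →
    2 ℕ.* length points ℕ.+ q ≤ q ℕ.* q ℕ.* (q ℕ.* q)
  arc-bound points n 2n≡q² line-bound = by-cases (Any.any? (λ t → q ℕ.* q ℕ.<? 2 ℕ.* class t ℕ.+ q) hyperoval)
    where
    open ℕ.≤-Reasoning
    k : ℕ
    k = length points
    class : Pt → ℕ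
    class t = ∑[ p ∈ points ] 𝟙 (proj₁ p ∥₂? proj₁ t)
    ∑-class : ∑ hyperoval class ≡ k
    ∑-class = ≡.trans (∑-swap hyperoval points _) (≡.trans (∑-cong points λ p → ≡.trans
        (∑-cong hyperoval λ t → 𝟙-cong (proj₁ p ∥₂? proj₁ t) (proj₁ t ∥₂? proj₁ p) ∥₂-sym ∥₂-sym) (hyperoval-count (proj₂ p)))
      (≡.trans (∑-const points 1) (ℕ.*-identityʳ k)))
    class-resp : ∀ {p t : Pt} → VectorAlgebra._∥_ S S-4≈0 (proj₁ p) (proj₁ t) → class p ≡ class t
    class-resp {p} {t} p∥t = ∑-cong points λ x → 𝟙-cong (proj₁ x ∥₂? proj₁ p) (proj₁ x ∥₂? proj₁ t)
      (λ x∥p → ∥₂-trans (unimodular⇒unimodular₂ (proj₂ p)) x∥p p∥t)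
      (λ x∥t → ∥₂-trans (unimodular⇒unimodular₂ (proj₂ t)) x∥t (∥₂-sym p∥t))
    through : ∀ (p : Pt) → 1 ≤ (∑[ x ∈ points ] 𝟙 (proj₁ x ∥? proj₁ p)) → q ℕ.* q < 2 ℕ.* class p ℕ.+ q →
      2 ℕ.* k ℕ.+ q ≤ q ℕ.* q ℕ.* (q ℕ.* q)
    through p 1≤m dense = dense-class-bound q {{Fin.nonZeroIndex (index 0#)}} k (class p) _ n
      (∑[ u ∈ pencil p ] ∑[ x ∈ points ] 𝟙 (x ⟂? u))
      1≤m 2n≡q² dense
      (begin-equality
        (∑[ u ∈ pencil p ] ∑[ x ∈ points ] 𝟙 (x ⟂? u)) ℕ.+ class p
          ≡⟨ ≡.cong (ℕ._+ class p) (∑-swap (pencil p) points _) ⟩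
        (∑[ x ∈ points ] ∑[ u ∈ pencil p ] 𝟙 (x ⟂? u)) ℕ.+ class p
          ≡⟨ ∑-+ points _ _ ⟨
        ∑[ x ∈ points ] ((∑[ u ∈ pencil p ] 𝟙 (x ⟂? u)) ℕ.+ 𝟙 (proj₁ x ∥₂? proj₁ p))
          ≡⟨ ∑-cong points (λ x → ≡.trans (≡.cong (ℕ._+ 𝟙 (proj₁ x ∥₂? proj₁ p))
               (∑-cong (pencil p) (𝟙-⟂-comm x)))
               (pencil-count p (proj₁ x))) ⟩
        ∑[ x ∈ points ] (1 ℕ.+ (q ℕ.* 𝟙 (proj₁ x ∥₂? proj₁ p) ℕ.+ q ℕ.* q ℕ.* 𝟙 (proj₁ x ∥? proj₁ p)))
          ≡⟨ ≡.trans (∑-+ points _ _) (≡.cong₂ ℕ._+_ (≡.trans (∑-const points 1) (ℕ.*-identityʳ k))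
               (≡.trans (∑-+ points _ _) (≡.cong₂ ℕ._+_ (∑-*ˡ points q _) (∑-*ˡ points (q ℕ.* q) _)))) ⟩
        k ℕ.+ (q ℕ.* class p ℕ.+ q ℕ.* q ℕ.* (∑[ x ∈ points ] 𝟙 (proj₁ x ∥? proj₁ p))) ∎)
      (begin
        ∑[ u ∈ pencil p ] ∑[ x ∈ points ] 𝟙 (x ⟂? u) ≤⟨ ∑-mono (pencil p) line-bound ⟩
        ∑[ u ∈ pencil p ] n                          ≡⟨ ∑-const (pencil p) n ⟩
        length (pencil p) ℕ.* n                      ≡⟨ ≡.cong (ℕ._* n) (length-pencil p) ⟩
        (q ℕ.* q ℕ.+ q) ℕ.* n                        ∎)
    q≤q² : ∀ q → q ≤ q ℕ.* q
    q≤q² zero    = z≤n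
    q≤q² (suc r) = ℕ.m≤m+n (suc r) _
    inhabited : ∀ (t : Pt) → q ℕ.* q < 2 ℕ.* class t ℕ.+ q → 1 ≤ class t
    inhabited t dense with class t
    ... | zero  = contradiction dense (ℕ.≤⇒≯ (q≤q² q))
    ... | suc _ = s≤s z≤n
    by-cases : Dec (Any (λ t → q ℕ.* q < 2 ℕ.* class t ℕ.+ q) hyperoval) → 2 ℕ.* k ℕ.+ q ≤ q ℕ.* q ℕ.* (q ℕ.* q)
    by-cases (yes some) =
      -- The representative t need not be a point of the arc, but a dense class contains some point
      -- p of it. Counting the lines through p gains the term q²m with m ≥ 1.
      let t , dense = Any.satisfied some
          p∈ = count>0 (λ p → proj₁ p ∥₂? proj₁ t) points (inhabited t dense)
          p , 1≤m , p∥t = Any×self⇒∃ p∈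
      in through p 1≤m (≡.subst (λ u → q ℕ.* q < 2 ℕ.* u ℕ.+ q) (≡.sym (class-resp {p} {t} p∥t)) dense)
      where
      Any×self⇒∃ : ∀ {P : Pt → Set} → Any P points → ∃ λ p → 1 ≤ (∑[ x ∈ points ] 𝟙 (proj₁ x ∥? proj₁ p)) × P p
      Any×self⇒∃ = All×Any⇒∃ (All.tabulate λ {p} p∈ → Any⇒count>0 (λ x → proj₁ x ∥? proj₁ p)
        (Any.map (λ { ≡.refl → ⨯-self (proj₁ p) }) p∈))
    by-cases (no none) = ℕ.+-cancelʳ-≤ (q ℕ.* (q ℕ.* q ℕ.+ q)) _ _ (begin
      2 ℕ.* k ℕ.+ q ℕ.+ q ℕ.* (q ℕ.* q ℕ.+ q)
        ≡⟨ arith₁ k q ⟩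
      2 ℕ.* k ℕ.+ (q ℕ.* q ℕ.+ (q ℕ.+ 1)) ℕ.* q
        ≡⟨ ≡.cong₂ (λ a b → 2 ℕ.* a ℕ.+ b ℕ.* q) ∑-class length-hyperoval ⟨
      2 ℕ.* ∑ hyperoval class ℕ.+ length hyperoval ℕ.* q
        ≡⟨ ≡.trans (∑-+ hyperoval _ _) (≡.cong₂ ℕ._+_ (∑-*ˡ hyperoval 2 class) (∑-const hyperoval q)) ⟨
      ∑[ t ∈ hyperoval ] (2 ℕ.* class t ℕ.+ q)
        ≤⟨ ∑-monoᴬ (All.map ℕ.≮⇒≥ (All.¬Any⇒All¬ hyperoval none)) ⟩
      ∑[ t ∈ hyperoval ] (q ℕ.* q)
        ≡⟨ ≡.trans (∑-const hyperoval (q ℕ.* q)) (≡.cong (ℕ._* (q ℕ.* q)) length-hyperoval) ⟩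
      (q ℕ.* q ℕ.+ (q ℕ.+ 1)) ℕ.* (q ℕ.* q)
        ≡⟨ arith₂ q ⟩
      q ℕ.* q ℕ.* (q ℕ.* q) ℕ.+ q ℕ.* (q ℕ.* q ℕ.+ q) ∎)
      where
      arith₁ : ∀ k q → 2 ℕ.* k ℕ.+ q ℕ.+ q ℕ.* (q ℕ.* q ℕ.+ q) ≡ 2 ℕ.* k ℕ.+ (q ℕ.* q ℕ.+ (q ℕ.+ 1)) ℕ.* q
      arith₁ = solve-∀
      arith₂ : ∀ q → (q ℕ.* q ℕ.+ (q ℕ.+ 1)) ℕ.* (q ℕ.* q) ≡ q ℕ.* q ℕ.* (q ℕ.* q) ℕ.+ q ℕ.* (q ℕ.* q ℕ.+ q)
      arith₂ = solve-∀

-- The Galois ring is a chain ring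

quotient-≈ : ∀ (R : CommutativeRing 0ℓ 0ℓ) a → let open CommutativeRing in
  ∀ {x y} → _≈_ R x y → _≈_ (R /⟨ a ⟩) x y
quotient-≈ R a {x} {y} x≈y = congruent (0# ,ᵈ trans (zeroˡ a) (sym (x≈y⇒x∙y⁻¹≈ε x≈y)))
  where
  open CommutativeRing R
  open Quotient R a using (congruent)
  open Divisibility *-rawMagma using () renaming (_,_ to _,ᵈ_)
  open RingProperties ring using (x≈y⇒x∙y⁻¹≈ε)

-- Division by monic polynomials and Bezout identities

module PolynomialDivision (A : CommutativeRing 0ℓ 0ℓ) (4≈0 : 4 kills A [X]) where

  open CommutativeRing A
  open Polynomial A hiding (commutativeRing)
  open _≈ₚ_ public
  private module P = CommutativeRing (A [X])
  open VectorSolver (A [X]) 3 4≈0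
  open RingProperties ring using (-0#≈0#)
  open import Relation.Binary.Reasoning.Setoid setoid

  coeff-+ : ∀ f g n → coeff (f +ₚ g) n ≈ coeff f n + coeff g n
  coeff-+ []      g       n       = sym (+-identityˡ _)
  coeff-+ (a ∷ f) []      n       = sym (+-identityʳ _)
  coeff-+ (a ∷ f) (b ∷ g) zero    = refl
  coeff-+ (a ∷ f) (b ∷ g) (suc n) = coeff-+ f g n

  coeff-neg : ∀ f n → coeff (-ₚ f) n ≈ - coeff f n
  coeff-neg []      n       = sym -0#≈0#
  coeff-neg (a ∷ f) zero    = refl
  coeff-neg (a ∷ f) (suc n) = coeff-neg f n

  coeff-· : ∀ a f n → coeff (a · f) n ≈ a * coeff f n
  coeff-· a []      n       = sym (zeroʳ a)
  coeff-· a (b ∷ f) zero    = refl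
  coeff-· a (b ∷ f) (suc n) = coeff-· a f n

  DegreeBelow : ℕ → Poly → Set
  DegreeBelow r f = ∀ n → r ≤ n → coeff f n ≈ 0#

  length-bounds-degree : ∀ f → DegreeBelow (length f) f
  length-bounds-degree []      n       _         = refl
  length-bounds-degree (a ∷ f) (suc n) (s≤s r≤n) = length-bounds-degree f n r≤n

  degreeBelow-resp : ∀ {r f g} → f ≈ₚ g → DegreeBelow r f → DegreeBelow r g
  degreeBelow-resp f≈g f<r n r≤n = trans (sym (coeff≈ f≈g n)) (f<r n r≤n)

  module _ {r : ℕ} {h : Poly} (h-monic : IsMonicOfDegree r h) where

    private
      hᵣ≈1 : coeff h r ≈ 1#
      hᵣ≈1 = proj₁ h-monic

      h-above : ∀ n → r < n → coeff h n ≈ 0#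
      h-above = proj₂ h-monic

    -- The leading coefficient of a multiple of a monic h is that of the factor, over any ring. By
    -- induction the tail of k vanishes first, and then coefficient r of the product is the constant
    -- term of k. This makes remainders modulo h unique.
    degreeBelow-multiple⇒0 : ∀ k → DegreeBelow r (k *ₚ h) → k ≈ₚ []
    degreeBelow-multiple⇒0 []      below = P.refl
    degreeBelow-multiple⇒0 (a ∷ k) below = coeffwise λ { zero → a≈0 ; (suc n) → coeff≈ k≈0 n }
      where
      k≈0 : k ≈ₚ []
      k≈0 = degreeBelow-multiple⇒0 k λ n r≤n → begin
        coeff (k *ₚ h) n                             ≈⟨ +-identityˡ _ ⟨
        0# + coeff (k *ₚ h) n                        ≈⟨ +-congʳ (trans (*-congˡ (h-above (suc n) (s≤s r≤n))) (zeroʳ a)) ⟨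
        a * coeff h (suc n) + coeff (k *ₚ h) n       ≈⟨ +-congʳ (coeff-· a h (suc n)) ⟨
        coeff (a · h) (suc n) + coeff (0# ∷ k *ₚ h) (suc n) ≈⟨ coeff-+ (a · h) (0# ∷ k *ₚ h) (suc n) ⟨
        coeff ((a ∷ k) *ₚ h) (suc n)                 ≈⟨ below (suc n) (ℕ.m≤n⇒m≤1+n r≤n) ⟩
        0#                                           ∎
      0∷kh≈0 : (0# ∷ k *ₚ h) ≈ₚ []
      0∷kh≈0 = coeffwise λ { zero → refl ; (suc n) → coeff≈ (P.trans (P.*-congʳ {h} k≈0) P.refl) n }
      a≈0 : a ≈ 0#
      a≈0 = trans (sym (*-identityʳ a)) (trans (*-congˡ (sym hᵣ≈1)) (trans (sym (coeff-· a h r))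
        (trans (sym (+-identityʳ _)) (trans (+-congˡ (sym (coeff≈ 0∷kh≈0 r)))
        (trans (sym (coeff-+ (a · h) (0# ∷ k *ₚ h) r)) (below r ℕ.≤-refl))))))

    -- Horner's scheme: the remainder of the tail, multiplied by X, has degree at most r, and
    -- subtracting the right multiple of h clears coefficient r.
    divide : ∀ f → ∃ λ k → ∃ λ g → f ≈ₚ k *ₚ h +ₚ g × DegreeBelow r g
    divide []      = [] , [] , P.refl , λ _ _ → refl
    divide (a ∷ f) with k , g , f≈kh+g , g<r ← divide f =
      t ∷ k , (a ∷ g) +ₚ -ₚ (t · h) , equation , below
      where
      t : Carrier
      t = coeff (a ∷ g) r
      equation : (a ∷ f) ≈ₚ t · h +ₚ (0# ∷ k *ₚ h) +ₚ ((a ∷ g) +ₚ -ₚ (t · h))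
      equation = P.trans (coeffwise λ { zero → sym (+-identityˡ a) ; (suc n) → coeff≈ f≈kh+g n })
        (identity ((0# ∷ k *ₚ h , a ∷ g , t · h) ∷ [])
          (λ { ((x , y , z) ∷ []) → x ⊕ y , (z ⊕ x) ⊕ (y ⊕ ⊝ z) }) P.refl)
      remainder-coeff : ∀ n → coeff ((a ∷ g) +ₚ -ₚ (t · h)) n ≈ coeff (a ∷ g) n - t * coeff h n
      remainder-coeff n = trans (coeff-+ (a ∷ g) (-ₚ (t · h)) n)
        (+-congˡ (trans (coeff-neg (t · h) n) (-‿cong (coeff-· t h n))))
      above : ∀ n → r < n → coeff (a ∷ g) n ≈ 0#
      above (suc n) (s≤s r≤n) = g<r n r≤n
      below : DegreeBelow r ((a ∷ g) +ₚ -ₚ (t · h))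
      below n r≤n with ℕ.m≤n⇒m<n∨m≡n r≤n
      ... | inj₁ r<n = trans (remainder-coeff n) (trans
        (+-cong (above n r<n) (trans (-‿cong (trans (*-congˡ (h-above n r<n)) (zeroʳ t))) -0#≈0#)) (+-identityʳ 0#))
      ... | inj₂ ≡.refl = trans (remainder-coeff n)
        (trans (+-congˡ (-‿cong (trans (*-congˡ hᵣ≈1) (*-identityʳ t)))) (-‿inverseʳ t))

  record Bezout (a b : Poly) : Set where
    constructor bezout
    field
      {g u v s t} : Poly
      combination : g ≈ₚ u *ₚ a +ₚ v *ₚ b
      a≈sg        : a ≈ₚ s *ₚ g
      b≈tg        : b ≈ₚ t *ₚ g

  module Euclid (zero⊎one : ∀ x → x ≈ 0# ⊎ x ≈ 1#) where

    private
      step : ∀ {a b k c} → a ≈ₚ k *ₚ b +ₚ c → Bezout b c → Bezout a b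
      step {a} {b} {k} {c} a≈kb+c (bezout {g} {u} {v} {s} {t} g≈ b≈sg c≈tg) =
        bezout {g = g} {v} {u +ₚ -ₚ (v *ₚ k)} {k *ₚ s +ₚ t} {s}
        (P.trans g≈ (P.trans
          (identity ((u , v , k) ∷ (b , c , c) ∷ []) (λ { ((u , v , k) ∷ (b , c , _) ∷ []) →
            u ⊗ b ⊕ v ⊗ c , v ⊗ (k ⊗ b ⊕ c) ⊕ (u ⊕ ⊝ (v ⊗ k)) ⊗ b }) P.refl)
          (P.+-congʳ (P.*-congˡ {v} (P.sym a≈kb+c)))))
        (P.trans a≈kb+c (P.trans (P.+-cong (P.*-congˡ {k} b≈sg) c≈tg)
          (identity ((s , t , k) ∷ (g , g , g) ∷ []) (λ { ((s , t , k) ∷ (g , _) ∷ []) →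
            k ⊗ (s ⊗ g) ⊕ t ⊗ g , (k ⊗ s ⊕ t) ⊗ g }) P.refl)))
        b≈sg

    -- The recursion is on a degree bound for b. As coefficients are 0 or 1, either the bound can be
    -- lowered or b is monic and can be divided by.
    euclid : ∀ n a b → DegreeBelow n b → Bezout a b
    euclid zero a b b≈0 = bezout {g = a} {1ₚ} {0ₚ} {1ₚ} {0ₚ}
      (identity ((a , b , b) ∷ []) (λ { ((a , b , _) ∷ []) → a , Κ 1 ⊗ a ⊕ Κ 0 ⊗ b }) P.refl)
      (P.sym (P.*-identityˡ a)) (coeffwise λ n → b≈0 n z≤n)
    euclid (suc m) a b b<1+m with zero⊎one (coeff b m)
    ... | inj₁ bₘ≈0 = euclid m a b λ n m≤n → [ b<1+m n , (λ { ≡.refl → bₘ≈0 }) ]′ (ℕ.m≤n⇒m<n∨m≡n m≤n)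
    ... | inj₂ bₘ≈1 with k , c , a≈kb+c , c<m ← divide {m} {b} (bₘ≈1 , b<1+m) a =
      step {k = k} a≈kb+c (euclid m b c c<m)

module GaloisRings where

  import Algebra.Definitions.RawSemiring as SemiringDefinitions
  open import Data.Fin.Base using (toℕ; fromℕ<; remQuot)
  open import Data.Integer.Base as ℤ using (ℤ; +_; -[1+_])
  open import Data.Integer.DivMod using (_%ℕ_; _/ℕ_; a≡a%ℕn+[a/ℕn]*n; n%ℕd<d)
  import Data.Integer.Properties as ℤ
  import Data.Integer.Tactic.RingSolver as ℤ-solver

  private
    module Z₂ = CommutativeRing (ℤ/ 2)
    module Z₄ = CommutativeRing (ℤ/ 4)
    module P₂ = Polynomial (ℤ/ 2)
    module P₄ = Polynomial (ℤ/ 4)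
    module F₂[X] = CommutativeRing 𝔽₂[X]
    module Z₄[X] = CommutativeRing ℤ₄[X]
    module Q₂ = Quotient ℤ.+-*-commutativeRing (+ 2)
    module Q₄ = Quotient ℤ.+-*-commutativeRing (+ 4)

  open Divisibility (CommutativeRing.*-rawMagma ℤ.+-*-commutativeRing) using () renaming (_,_ to _,ᶻ_)

  4≈0-ℤ₄[X] : P₄._≈ₚ_ (+ 4 ∷ []) []
  4≈0-ℤ₄[X] = P₄.coeffwise λ { zero → Q₄.congruent (+ 1 ,ᶻ ≡.refl) ; (suc n) → Z₄.refl }

  4≈0-𝔽₂[X] : P₂._≈ₚ_ (+ 4 ∷ []) []
  4≈0-𝔽₂[X] = P₂.coeffwise λ { zero → Q₂.congruent (+ 2 ,ᶻ ≡.refl) ; (suc n) → Z₂.refl }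

  private
    module D₂ = PolynomialDivision (ℤ/ 2) 4≈0-𝔽₂[X]
    module D₄ = PolynomialDivision (ℤ/ 4) 4≈0-ℤ₄[X]

  -- Doubling induces a map from ℤ/2 to ℤ/4; `halve-mod4` is its injectivity. Statements modulo 2
  -- can thus be read from doubles in the Galois ring.
  double-mod4 : ∀ {a b} → a Z₂.≈ b → a ℤ.+ a Z₄.≈ b ℤ.+ b
  double-mod4 {a} {b} (Q₂.congruent (k ,ᶻ eq)) = Q₄.congruent (k ,ᶻ
    ≡.trans (quadruple k) (≡.trans (≡.cong₂ ℤ._+_ eq eq) (regroup a b)))
    where
    quadruple : ∀ k → k ℤ.* + 4 ≡ k ℤ.* + 2 ℤ.+ k ℤ.* + 2
    quadruple = ℤ-solver.solve-∀
    regroup : ∀ a b → (a ℤ.- b) ℤ.+ (a ℤ.- b) ≡ (a ℤ.+ a) ℤ.- (b ℤ.+ b)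
    regroup = ℤ-solver.solve-∀

  halve-mod4 : ∀ {a b} → a ℤ.+ a Z₄.≈ b ℤ.+ b → a Z₂.≈ b
  halve-mod4 {a} {b} (Q₄.congruent (k ,ᶻ eq)) = Q₂.congruent (k ,ᶻ
    ℤ.*-cancelˡ-≡ (+ 2) (k ℤ.* + 2) (a ℤ.- b) (≡.trans (quadruple k) (≡.trans eq (regroup a b))))
    where
    quadruple : ∀ k → + 2 ℤ.* (k ℤ.* + 2) ≡ k ℤ.* + 4
    quadruple = ℤ-solver.solve-∀
    regroup : ∀ a b → (a ℤ.+ a) ℤ.- (b ℤ.+ b) ≡ + 2 ℤ.* (a ℤ.- b)
    regroup = ℤ-solver.solve-∀

  bit : ℤ → Fin 2
  bit a = fromℕ< (n%ℕd<d a 2)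

  bit-mod2 : ∀ a → a Z₂.≈ + toℕ (bit a)
  bit-mod2 a = Q₂.congruent (a /ℕ 2 ,ᶻ ≡.sym (≡.trans
    (≡.cong₂ (λ x y → x ℤ.- + y) (a≡a%ℕn+[a/ℕn]*n a 2) (Fin.toℕ-fromℕ< (n%ℕd<d a 2)))
    (cancel (+ (a %ℕ 2)) (a /ℕ 2 ℤ.* + 2))))
    where
    cancel : ∀ x y → x ℤ.+ y ℤ.- x ≡ y
    cancel = ℤ-solver.solve-∀

  0≢1-mod2 : ¬ + 0 Z₂.≈ + 1
  0≢1-mod2 (Q₂.congruent (+ zero ,ᶻ ()))
  0≢1-mod2 (Q₂.congruent (+ suc k ,ᶻ ()))
  0≢1-mod2 (Q₂.congruent (-[1+ k ] ,ᶻ ()))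

  bit-injective : ∀ (i j : Fin 2) → + toℕ i Z₂.≈ + toℕ j → i ≡ j
  bit-injective zero       zero       eq = ≡.refl
  bit-injective zero       (suc zero) eq = contradiction eq 0≢1-mod2
  bit-injective (suc zero) zero       eq = contradiction (Z₂.sym eq) 0≢1-mod2
  bit-injective (suc zero) (suc zero) eq = ≡.refl

  zero⊎one-mod2 : ∀ a → a Z₂.≈ + 0 ⊎ a Z₂.≈ + 1
  zero⊎one-mod2 a = go (bit a) (bit-mod2 a)
    where
    go : ∀ (i : Fin 2) → a Z₂.≈ + toℕ i → a Z₂.≈ + 0 ⊎ a Z₂.≈ + 1
    go zero       eq = inj₁ eq
    go (suc zero) eq = inj₂ eq

  -- ℤ₄[X] and 𝔽₂[X] have the same operations on representatives.

  +-₂₄ : ∀ f g → f P₂.+ₚ g ≡ f P₄.+ₚ g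
  +-₂₄ []      g       = ≡.refl
  +-₂₄ (a ∷ f) []      = ≡.refl
  +-₂₄ (a ∷ f) (b ∷ g) = ≡.cong (a ℤ.+ b ∷_) (+-₂₄ f g)

  *-₂₄ : ∀ f g → f P₂.*ₚ g ≡ f P₄.*ₚ g
  *-₂₄ []      g = ≡.refl
  *-₂₄ (a ∷ f) g = ≡.trans (+-₂₄ (map (a ℤ.*_) g) _) (≡.cong (λ k → map (a ℤ.*_) g P₄.+ₚ (+ 0 ∷ k)) (*-₂₄ f g))

  lift-zero : ∀ f → f P₂.≈ₚ [] → ∃ λ m → f P₄.≈ₚ m P₄.+ₚ m
  lift-zero []      eq = [] , Z₄[X].refl
  lift-zero (a ∷ f) eq =
    let m , f≈2m = lift-zero f (P₂.coeffwise λ n → P₂._≈ₚ_.coeff≈ eq (suc n))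
        k , a≡2k = half (P₂._≈ₚ_.coeff≈ eq zero)
    in k ∷ m , P₄.coeffwise λ { zero → Z₄.reflexive a≡2k ; (suc n) → P₄._≈ₚ_.coeff≈ f≈2m n }
    where
    half : a Z₂.≈ + 0 → ∃ λ k → a ≡ k ℤ.+ k
    half (Q₂.congruent (k ,ᶻ eq)) = k , ≡.trans (≡.sym (ℤ.+-identityʳ a)) (≡.trans (≡.sym eq) (twice k))
      where
      twice : ∀ k → k ℤ.* + 2 ≡ k ℤ.+ k
      twice = ℤ-solver.solve-∀

  lift-≈ : ∀ f g → f P₂.≈ₚ g → ∃ λ m → f P₄.≈ₚ g P₄.+ₚ (m P₄.+ₚ m)
  lift-≈ f g f≈g =
    let m , eq = lift-zero (f P₄.+ₚ P₄.-ₚ g) (F₂[X].trans (F₂[X].reflexive (≡.sym (+-₂₄ f (P₂.-ₚ g)))) (x≈y⇒x∙y⁻¹≈ε f≈g))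
    in m , Z₄[X].trans
      (identity ((f , g , g) ∷ []) (λ { ((f , g , _) ∷ []) → f , g ⊕ (f ⊕ ⊝ g) }) Z₄[X].refl) (Z₄[X].+-congˡ {g} eq)
    where
    open RingProperties F₂[X].ring using (x≈y⇒x∙y⁻¹≈ε)
    open VectorSolver ℤ₄[X] 3 4≈0-ℤ₄[X]

  -- The polynomials of degree below r with coefficients 0 and 1, which represent the residue field;
  -- `encode` reads off the index from the parities of the coefficients.
  bits : ∀ r → Fin (2 ^ r) → List ℤ
  bits zero    i = []
  bits (suc r) i = let b , j = remQuot {2} (2 ^ r) i in + toℕ b ∷ bits r j

  encode : ∀ r → (ℕ → ℤ) → Fin (2 ^ r)
  encode zero    a = zero
  encode (suc r) a = combine (bit (a 0)) (encode r (a ∘ suc))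

  bits-combine : ∀ r b j → bits (suc r) (combine b j) ≡ + toℕ b ∷ bits r j
  bits-combine r b j = ≡.cong (λ (b , j) → + toℕ b ∷ bits r j) (Fin.remQuot-combine {2} {2 ^ r} b j)

  bits-encode : ∀ r a n → n < r → P₄.coeff (bits r (encode r a)) n Z₂.≈ a n
  bits-encode (suc r) a n n<1+r = Z₂.trans
    (Z₂.reflexive (≡.cong (λ f → P₄.coeff f n) (bits-combine r (bit (a 0)) (encode r (a ∘ suc))))) (go n n<1+r)
    where
    go : ∀ n → n < suc r → P₄.coeff (+ toℕ (bit (a 0)) ∷ bits r (encode r (a ∘ suc))) n Z₂.≈ a n
    go zero    _         = Z₂.sym (bit-mod2 (a 0))
    go (suc n) (s≤s n<r) = bits-encode r (a ∘ suc) n n<r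

  bits-below : ∀ r i → D₄.DegreeBelow r (bits r i)
  bits-below zero    i n       _         = Z₄.refl
  bits-below (suc r) i (suc n) (s≤s r≤n) = bits-below r (proj₂ (remQuot {2} (2 ^ r) i)) n r≤n

  bits-injective : ∀ r i j → (∀ n → P₄.coeff (bits r i) n Z₂.≈ P₄.coeff (bits r j) n) → i ≡ j
  bits-injective zero    zero zero eq = ≡.refl
  bits-injective (suc r) i    j    eq = ≡.trans (≡.sym (Fin.combine-remQuot {2} (2 ^ r) i)) (≡.trans
    (≡.cong₂ combine (bit-injective (proj₁ (remQuot {2} (2 ^ r) i)) (proj₁ (remQuot {2} (2 ^ r) j)) (eq 0))
      (bits-injective r (proj₂ (remQuot {2} (2 ^ r) i)) (proj₂ (remQuot {2} (2 ^ r) j)) (eq ∘ suc)))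
    (Fin.combine-remQuot {2} (2 ^ r) j))

  module _ {r : ℕ} {h : List ℤ} (r≥1 : r ≥ 1) (modulus : IsGaloisModulus r h) where

    open IsGaloisModulus modulus

    private
      G : CommutativeRing 0ℓ 0ℓ
      G = GaloisRing h

      module G = CommutativeRing G
      module Q = Quotient ℤ₄[X] h
      open Divisibility Z₄[X].*-rawMagma using () renaming (_,_ to _,ᵈ_)
      open RingProperties Z₄[X].ring using (x∙y⁻¹≈ε⇒x≈y; x≈y⇒x∙y⁻¹≈ε)
      open P₄ using (_+ₚ_; _*ₚ_; -ₚ_; 1ₚ)

      ≈⇒≈G : ∀ {f g} → f P₄.≈ₚ g → f G.≈ g
      ≈⇒≈G = quotient-≈ ℤ₄[X] h

      4≈0-G : 1ₚ +ₚ 1ₚ +ₚ 1ₚ +ₚ 1ₚ G.≈ []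
      4≈0-G = ≈⇒≈G 4≈0-ℤ₄[X]

      module Solver₄ = VectorSolver ℤ₄[X] 3 4≈0-ℤ₄[X]
      module SolverG = VectorSolver G 3 4≈0-G

      multiple≈0 : ∀ k → k *ₚ h G.≈ []
      multiple≈0 k = Q.congruent (k ,ᵈ identity ((k , h , h) ∷ [])
        (λ { ((k , h , _) ∷ []) → k ⊗ h , k ⊗ h ⊕ ⊝ Κ 0 }) Z₄[X].refl)
        where open Solver₄

      reduced-≈ : ∀ {f g} → D₄.DegreeBelow r f → D₄.DegreeBelow r g → f G.≈ g → f P₄.≈ₚ g
      reduced-≈ {f} {g} f<r g<r (Q.congruent (k ,ᵈ kh≈f-g)) = x∙y⁻¹≈ε⇒x≈y f g (Z₄[X].trans (Z₄[X].sym kh≈f-g)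
        (Z₄[X].*-congʳ {h} (D₄.degreeBelow-multiple⇒0 monic k (D₄.degreeBelow-resp (Z₄[X].sym kh≈f-g) λ n r≤n →
          Z₄.trans (D₄.coeff-+ f (-ₚ g) n) (Z₄.trans (Z₄.+-cong (f<r n r≤n)
            (Z₄.trans (D₄.coeff-neg g n) (Z₄.-‿cong (g<r n r≤n)))) Z₄.refl)))))

      double : ∀ f n → P₄.coeff (f +ₚ f) n Z₄.≈ P₄.coeff f n ℤ.+ P₄.coeff f n
      double f n = D₄.coeff-+ f f n

      double-below : ∀ {f} → D₄.DegreeBelow r f → D₄.DegreeBelow r (f +ₚ f)
      double-below {f} f<r n r≤n = Z₄.trans (double f n) (Z₄.trans (Z₄.+-cong (f<r n r≤n) (f<r n r≤n)) Z₄.refl)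

      2≉0 : ¬ 1ₚ +ₚ 1ₚ G.≈ []
      2≉0 2≈0 = contradiction (halve-mod4 (P₄._≈ₚ_.coeff≈
        (reduced-≈ {1ₚ +ₚ 1ₚ} {[]} two-below (λ _ _ → Z₄.refl) 2≈0) 0)) (0≢1-mod2 ∘ Z₂.sym)
        where
        -- As r ≥ 1, the constant 2 is its own remainder modulo h and is compared with 0
        -- coefficientwise.
        two-below : D₄.DegreeBelow r (1ₚ +ₚ 1ₚ)
        two-below zero    r≤0 = contradiction (ℕ.≤-trans r≥1 r≤0) λ ()
        two-below (suc n) _   = Z₄.refl

      remainder : ∀ f → ∃ λ k → ∃ λ g → f P₄.≈ₚ k *ₚ h +ₚ g × D₄.DegreeBelow r g
      remainder = D₄.divide monic

      index : List ℤ → Fin (2 ^ r)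
      index f = encode r (P₄.coeff (proj₁ (proj₂ (remainder f))))

      rep-index : ∀ f → bits r (index f) +ₚ bits r (index f) G.≈ f +ₚ f
      rep-index f =
        let k , g , f≈kh+g , g<r = remainder f
            rep≈g : bits r (index f) +ₚ bits r (index f) P₄.≈ₚ g +ₚ g
            rep≈g = P₄.coeffwise λ n → Z₄.trans (double (bits r (index f)) n)
              (Z₄.trans (digits n g<r (ℕ.<-≤-connex n r)) (Z₄.sym (double g n)))
            f≈g : f G.≈ g
            f≈g = G.trans (≈⇒≈G f≈kh+g) (G.trans (G.+-congʳ {g} (multiple≈0 k)) (G.+-identityˡ g))
        in G.trans (≈⇒≈G rep≈g) (G.sym (G.+-cong f≈g f≈g))
        where
        digits : ∀ n → let g = proj₁ (proj₂ (remainder f)) ; b = P₄.coeff (bits r (index f)) n in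
          D₄.DegreeBelow r g → n < r ⊎ r ≤ n → b ℤ.+ b Z₄.≈ P₄.coeff g n ℤ.+ P₄.coeff g n
        digits n g<r (inj₁ n<r) = double-mod4 (bits-encode r _ n n<r)
        digits n g<r (inj₂ r≤n) = Z₄.+-cong b≈g b≈g
          where b≈g = Z₄.trans (bits-below r (index f) n r≤n) (Z₄.sym (g<r n r≤n))

      rep-injective : ∀ {i j} → bits r i +ₚ bits r i G.≈ bits r j +ₚ bits r j → i ≡ j
      rep-injective {i} {j} eq = bits-injective r i j λ n → halve-mod4 (Z₄.trans (Z₄.sym (double (bits r i) n))
        (Z₄.trans (P₄._≈ₚ_.coeff≈ (reduced-≈
            (double-below {bits r i} (bits-below r i)) (double-below {bits r j} (bits-below r j)) eq) n)
          (double (bits r j) n)))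

      -- Let g be a common divisor of h and f modulo 2 that is also a combination of them. Since h
      -- is irreducible modulo 2, either h divides g and hence f, so that f is even in the quotient,
      -- or g is a unit and f is invertible modulo 2.
      unit⊎even : ∀ f → (∃ λ y → f *ₚ y G.≈ 1ₚ) ⊎ (∃ λ y → f G.≈ y +ₚ y)
      unit⊎even f = from-bezout (D₂.Euclid.euclid zero⊎one-mod2 (length f) h f (D₂.length-bounds-degree f))
        where
        open Divisibility F₂[X].*-rawMagma using (_∣_) renaming (_,_ to _,ᵖ_)
        from-bezout : D₂.Bezout h f → (∃ λ y → f *ₚ y G.≈ 1ₚ) ⊎ (∃ λ y → f G.≈ y +ₚ y)
        from-bezout (D₂.bezout {g} {u} {v} {s} {t} g≈uh+vf h≈sg f≈tg) =
          [ (λ s∣1 → inj₂ (even s∣1)) , (λ g∣1 → inj₁ (unit g∣1)) ]′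
            (SemiringDefinitions.Irreducible.split-∣1 irreducible-mod2 {s} {g} h≈sg)
          where
          even : s ∣ P₂.1ₚ → ∃ λ y → f G.≈ y +ₚ y
          even (w ,ᵖ ws≈1) =
            let k = t P₂.*ₚ w
                m , f≈kh+2m = lift-≈ f (k *ₚ h) (F₂[X].trans f≈kh (F₂[X].reflexive (*-₂₄ k h)))
            in m , G.trans (≈⇒≈G f≈kh+2m) (G.trans (G.+-congʳ {m +ₚ m} (multiple≈0 k)) (G.+-identityˡ (m +ₚ m)))
            where
            open VectorSolver 𝔽₂[X] 3 4≈0-𝔽₂[X]
            f≈kh : f P₂.≈ₚ (t P₂.*ₚ w) P₂.*ₚ h
            f≈kh = F₂[X].trans f≈tg (F₂[X].trans (F₂[X].*-congˡ {t} (F₂[X].trans (F₂[X].sym (F₂[X].*-identityˡ g))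
              (F₂[X].*-congʳ {g} (F₂[X].sym ws≈1))))
              (F₂[X].trans (identity ((t , w , s) ∷ (g , g , g) ∷ []) (λ { ((t , w , s) ∷ (g , _) ∷ []) →
                  t ⊗ (w ⊗ s ⊗ g) , t ⊗ w ⊗ (s ⊗ g) }) F₂[X].refl)
                (F₂[X].*-congˡ {t P₂.*ₚ w} (F₂[X].sym h≈sg))))
          unit : g ∣ P₂.1ₚ → ∃ λ y → f *ₚ y G.≈ 1ₚ
          unit (w ,ᵖ wg≈1) =
            let k = w P₂.*ₚ u ; y = w P₂.*ₚ v
                m , fy+kh≈1+2m = lift-≈ (f *ₚ y +ₚ k *ₚ h) 1ₚ (F₂[X].trans
                  (F₂[X].reflexive (≡.sym (≡.trans (+-₂₄ (f P₂.*ₚ y) (k P₂.*ₚ h)) (≡.cong₂ _+ₚ_ (*-₂₄ f y) (*-₂₄ k h))))) fy+kh≈1)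
                fy≈1+2m : f *ₚ y G.≈ 1ₚ +ₚ (m +ₚ m)
                fy≈1+2m = G.trans (G.sym (G.trans (G.+-congˡ {f *ₚ y} (multiple≈0 k)) (G.+-identityʳ (f *ₚ y)))) (≈⇒≈G fy+kh≈1+2m)
            -- An inverse y modulo 2 gives fy = 1 + 2m, and 1 + 2m is its own inverse because 4 = 0.
            in y *ₚ (1ₚ +ₚ (m +ₚ m)) , G.trans (G.sym (G.*-assoc f y (1ₚ +ₚ (m +ₚ m))))
                 (G.trans (G.*-congʳ {1ₚ +ₚ (m +ₚ m)} fy≈1+2m)
                   (SolverG.identity ((m , m , m) ∷ []) (λ { ((m , _) ∷ []) → (Κ 1 ⊕ (m ⊕ m)) ⊗ (Κ 1 ⊕ (m ⊕ m)) , Κ 1 }) G.refl))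
            where
            open VectorSolver 𝔽₂[X] 3 4≈0-𝔽₂[X]
            fy+kh≈1 : f P₂.*ₚ (w P₂.*ₚ v) P₂.+ₚ (w P₂.*ₚ u) P₂.*ₚ h P₂.≈ₚ P₂.1ₚ
            fy+kh≈1 = F₂[X].trans (identity ((f , w , v) ∷ (u , h , h) ∷ []) (λ { ((f , w , v) ∷ (u , h , _) ∷ []) →
                f ⊗ (w ⊗ v) ⊕ w ⊗ u ⊗ h , w ⊗ (u ⊗ h ⊕ v ⊗ f) }) F₂[X].refl)
              (F₂[X].trans (F₂[X].*-congˡ {w} (F₂[X].sym g≈uh+vf)) wg≈1)

    galoisRing-chain : IsDyadicChainRing (GaloisRing h) (2 ^ r)
    galoisRing-chain = record
      { 4≈0 = 4≈0-G ; 2≉0 = 2≉0 ; unit⊎even = unit⊎even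
      ; rep = bits r ; index = index ; rep-index = rep-index ; rep-injective = rep-injective }

open GaloisRings using (galoisRing-chain)

-- The projective Hjelmslev plane

∣S∣≡count : ∀ {k} (S : Subset k) {P : Fin k → Set} (P? : ∀ j → Dec (P j)) → (∀ j → j ∈ˢ S ⇔ P j) →
  ∣ S ∣ ≡ ∑[ j ∈ allFin k ] 𝟙 (P? j)
∣S∣≡count []      P? S⇔P = ≡.refl
∣S∣≡count {suc k} (b ∷ S) {P} P? S⇔P = ≡.trans (split b (S⇔P zero)) (≡.sym (∑-allFin-suc k (𝟙 ∘ P?)))
  where
  tail : ∣ S ∣ ≡ ∑[ j ∈ allFin k ] 𝟙 (P? (suc j))
  tail = ∣S∣≡count S (P? ∘ suc) λ j → mk⇔ (Equivalence.to (S⇔P (suc j)) ∘ there)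
    (λ p → case-there (Equivalence.from (S⇔P (suc j)) p))
    where
    case-there : ∀ {j} → suc j ∈ˢ (b ∷ S) → j ∈ˢ S
    case-there (there j∈S) = j∈S
  split : ∀ b → (zero ∈ˢ (b ∷ S) ⇔ P zero) → ∣ b ∷ S ∣ ≡ 𝟙 (P? zero) ℕ.+ (∑[ j ∈ allFin k ] 𝟙 (P? (suc j)))
  split true  0⇔ = ≡.cong₂ ℕ._+_ (≡.sym (𝟙-yes (P? zero) (Equivalence.to 0⇔ here))) tail
  split false 0⇔ = ≡.cong₂ ℕ._+_ (≡.sym (𝟙-no (P? zero) λ p → absurd (Equivalence.from 0⇔ p))) tail
    where
    absurd : ¬ zero ∈ˢ (false ∷ S)
    absurd ()

decidable⇒subset : ∀ {k} {P : Fin k → Set} → (∀ j → Dec (P j)) → ∃ λ (S : Subset k) → ∀ j → j ∈ˢ S ⇔ P j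
decidable⇒subset {k} {P} P? = Vec.tabulate (does ∘ P?) , λ j → mk⇔
  (λ j∈S → witness (P? j) (≡.trans (≡.sym (Vec.lookup∘tabulate (does ∘ P?) j)) (Vec.[]=⇒lookup j∈S)))
  (λ p → Vec.lookup⇒[]= j _ (≡.trans (Vec.lookup∘tabulate (does ∘ P?) j) (Dec.dec-true (P? j) p)))
  where
  witness : ∀ {Q : Set} (Q? : Dec Q) → does Q? ≡ true → Q
  witness (yes q) _ = q

module HjelmslevPlane (R : CommutativeRing 0ℓ 0ℓ) (q : ℕ) (chain : IsDyadicChainRing R q) where

  open CommutativeRing R
  open IsDyadicChainRing chain
  open ResidueField R q chain
  open Vectors R
  open VectorAlgebra R 4≈0
  open Hyperoval R q chain using (nonzero⇒unimodular₂; unimodular₂⇒unimodular)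
  open ProjectivePlane R R-local
  open DualArc R q chain
  open Maximality R q chain using (arc-bound)

  private
    Π : IncidenceStructure _ _ _ _
    Π = PHG₂ ring
    open IncidenceStructure Π using (Point; Line; _I_)
    open Arcs Π

    twice : ∀ {x} → x ≡₂ 0# → x * (1# + 1#) ≈ 0#
    twice x≡0 = trans (trans (distribˡ _ 1# 1#) (+-cong (*-identityʳ _) (*-identityʳ _))) (≡₂0⇒double≈0 x≡0)

  toPoint : Pt → Point
  toPoint (v , uv) = record
    { Member    = λ x → ∃ λ a → x ≋ v *ᵥ a
    ; resp      = λ x≋y (a , x≋va) → a , ≋-trans (≋-sym x≋y) x≋va
    ; 0-closed  = 0# , ≋-sym (*ᵥ-zero v)
    ; +-closed  = λ (a , x≋va) (b , y≋vb) → a + b , ≋-trans (+ᵥ-cong x≋va y≋vb) (≋-sym (*ᵥ-distribˡ v a b))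
    ; *ᵣ-closed = λ (a , x≋va) b → a * b , ≋-trans (*ᵥ-cong x≋va refl) (*ᵥ-assoc v a b)
    } , (λ _ → v) , record
    { contained   = λ _ → 1# , ≋-sym (*ᵥ-identity v)
    ; spanning    = λ (a , x≋va) → (λ _ → a) , ≋-trans x≋va (≋-sym (+ᵥ-identityʳ _))
    ; independent = λ a va≋0 → λ { 0F → unimodular-cancel uv (≋-trans (≋-sym (+ᵥ-identityʳ _)) va≋0) }
    }
    where
    *ᵥ-distribˡ : ∀ v a b → v *ᵥ (a + b) ≋ v *ᵥ a +ᵥ v *ᵥ b
    *ᵥ-distribˡ (x , y , z) a b = distribˡ x a b , distribˡ y a b , distribˡ z a b

  -- If the basis vector were zero modulo 2, it would be killed by 2, against independence, as 2 ≠
  -- 0.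
  fromPoint : Point → Pt
  fromPoint (N , b , basis) = b 0F , unimodular₂⇒unimodular (nonzero⇒unimodular₂ λ (e , f , g) →
    2≉0 (independent (const (1# + 1#)) (≋-trans (+ᵥ-identityʳ _) (twice e , twice f , twice g)) 0F))
    where
    open IsBasis basis

  Member-fromPoint : ∀ (P : Point) {x} → Submodule.Member (proj₁ P) x → ∃ λ a → x ≋ proj₁ (fromPoint P) *ᵥ a
  Member-fromPoint (N , b , basis) x∈P = let a , x≋ = IsBasis.spanning basis x∈P in a 0F , ≋-trans x≋ (+ᵥ-identityʳ _)

  private
    toLine-module : Pt → Submodule (R³ ring) 0ℓ
    toLine-module (w , _) = record
      { Member    = λ x → x ∙ w ≈ 0#
      ; resp      = λ x≋y xw≈0 → trans (∙-cong (≋-sym x≋y) ≋-refl) xw≈0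
      ; 0-closed  = trans (∙-comm 0ᵥ w) (∙-zeroʳ w)
      ; +-closed  = λ {x} {y} xw≈0 yw≈0 → trans (identity (x ∷ y ∷ w ∷ [])
          (λ { (x ∷ y ∷ w ∷ []) → (x ⊞ y) ⊙ w , x ⊙ w ⊕ y ⊙ w }) refl) (trans (+-cong xw≈0 yw≈0) (+-identityʳ 0#))
      ; *ᵣ-closed = λ {x} xw≈0 a → trans (*ᵥ-∙ x w a) (trans (*-congʳ xw≈0) (zeroˡ a)) }
      where open VectorSolver R 3 4≈0

  toLine : Pt → Line
  toLine (w , uw) = toLine-module (w , uw) , (λ { 0F → A ; 1F → B }) , record
    { contained   = λ { 0F → A∙v ; 1F → B∙v }
    ; spanning    = λ xw≈0 → let s , t , x≋ = spanning uw xw≈0 in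
        (λ { 0F → s ; 1F → t }) , ≋-trans x≋ (+ᵥ-cong ≋-refl (≋-sym (+ᵥ-identityʳ _)))
    ; independent = λ a c≋0 → let s≈0 , t≈0 = independent uw (≋-trans (+ᵥ-cong ≋-refl (≋-sym (+ᵥ-identityʳ _))) c≋0) in
        λ { 0F → s≈0 ; 1F → t≈0 } }
    where open Frame (unimodular⇒frame uw)

  module _ (L : Line) where

    private
      b : Fin 2 → V
      b = proj₁ (proj₂ L)
      open IsBasis (proj₂ (proj₂ L))
      open Submodule (proj₁ L)

      w : V
      w = b 0F ⨯ b 1F

      -- A basis of L is a frame of its cross product w, with μ = 1. So L is all of the orthogonal
      -- complement of w, and not only contained in it.
      L-frame : Frame w
      L-frame = record { A = b 0F ; B = b 1F ; μ = 1# ; μ-unit = unit-1 ; A⨯B = ≋-sym (*ᵥ-identity w) }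

      independent₂ : ∀ s t → b 0F *ᵥ s +ᵥ b 1F *ᵥ t ≋ 0ᵥ → s ≈ 0# × t ≈ 0#
      independent₂ s t c≋0 = let zeros = independent (λ { 0F → s ; 1F → t })
                                   (≋-trans (+ᵥ-cong ≋-refl (+ᵥ-identityʳ _)) c≋0)
                             in zeros 0F , zeros 1F

      -- If 2w = 0 then 2b₁ = 0, by independence applied to t ⨯ (2w) = 0 for each coordinate vector t.
      w-unimodular : Unimodular w
      w-unimodular = unimodular₂⇒unimodular (nonzero⇒unimodular₂ λ (e , f , g) →
        2≉0 (proj₂ (independent₂ 0# (1# + 1#) (≋-trans
          (+ᵥ-cong (*ᵥ-zero (b 0F)) (2b₁≋0 (twice e , twice f , twice g))) (+ᵥ-identityʳ 0ᵥ)))))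
        where
        open VectorSolver R 3 4≈0
        2t∙b₁≈0 : ∀ t → w *ᵥ (1# + 1#) ≋ 0ᵥ → (t *ᵥ (1# + 1#)) ∙ b 1F ≈ 0#
        2t∙b₁≈0 t 2w≋0 = proj₁ (independent₂ _ _ (≋-trans (≋-sym (⨯-⨯ (t *ᵥ (1# + 1#)) (b 0F) (b 1F)))
          (≋-trans (*ᵥ-⨯ t w (1# + 1#)) (≋-trans (≋-sym (⨯-*ᵥ t w (1# + 1#)))
          (≋-trans (⨯-cong (≋-refl {t}) 2w≋0) (⨯-zeroʳ t))))))
        2b₁≋0 : w *ᵥ (1# + 1#) ≋ 0ᵥ → b 1F *ᵥ (1# + 1#) ≋ 0ᵥ
        2b₁≋0 2w≋0 =
          trans (identity (b 1F ∷ []) (λ { (b@(x , _) ∷ []) → x ⊗ (Κ 1 ⊕ Κ 1) , ((Κ 1 , Κ 0 , Κ 0) ⊡ (Κ 1 ⊕ Κ 1)) ⊙ b }) refl)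
            (2t∙b₁≈0 (1# , 0# , 0#) 2w≋0) ,
          trans (identity (b 1F ∷ []) (λ { (b@(_ , y , _) ∷ []) → y ⊗ (Κ 1 ⊕ Κ 1) , ((Κ 0 , Κ 1 , Κ 0) ⊡ (Κ 1 ⊕ Κ 1)) ⊙ b }) refl)
            (2t∙b₁≈0 (0# , 1# , 0#) 2w≋0) ,
          trans (identity (b 1F ∷ []) (λ { (b@(_ , _ , z) ∷ []) → z ⊗ (Κ 1 ⊕ Κ 1) , ((Κ 0 , Κ 0 , Κ 1) ⊡ (Κ 1 ⊕ Κ 1)) ⊙ b }) refl)
            (2t∙b₁≈0 (0# , 0# , 1#) 2w≋0)

    fromLine : Pt
    fromLine = w , w-unimodular

    Member⇒orthogonal : ∀ {x} → Member x → x ∙ w ≈ 0#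
    Member⇒orthogonal x∈L = let a , x≋ = spanning x∈L in
      trans (∙-cong (≋-trans x≋ (+ᵥ-cong ≋-refl (+ᵥ-identityʳ _))) (≋-refl {w}))
        (Frame.combination-∙v L-frame (a 0F) (a 1F))

    orthogonal⇒Member : ∀ {x} → x ∙ w ≈ 0# → Member x
    orthogonal⇒Member xw≈0 = let s , t , x≋ = Frame.spanning L-frame w-unimodular xw≈0 in
      resp (≋-sym x≋) (+-closed (*ᵣ-closed (contained 0F) s) (*ᵣ-closed (contained 1F) t))

  incidence : ∀ P L → (proj₁ (fromPoint P) ∙ proj₁ (fromLine L) ≈ 0#) ⇔ (P I L)
  incidence P@(N , b , basis) L = mk⇔
    (λ vw≈0 {x} x∈P → let a , x≋va = Member-fromPoint P x∈P in orthogonal⇒Member L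
      (trans (∙-cong x≋va ≋-refl) (trans (*ᵥ-∙ _ _ a) (trans (*-congʳ vw≈0) (zeroˡ a)))))
    (λ P⊆L → Member⇒orthogonal L (P⊆L (IsBasis.contained basis 0F)))

  incidence-toLine : ∀ P w → (proj₁ (fromPoint P) ∙ proj₁ w ≈ 0#) ⇔ (P I toLine w)
  incidence-toLine P@(N , b , basis) w = mk⇔
    (λ vw≈0 {x} x∈P → let a , x≋va = Member-fromPoint P x∈P in
      trans (∙-cong x≋va ≋-refl) (trans (*ᵥ-∙ _ _ a) (trans (*-congʳ vw≈0) (zeroˡ a))))
    (λ P⊆L → P⊆L (IsBasis.contained basis 0F))

  dualArc-pointSet : PointSet (length dualArc)
  dualArc-pointSet = record
    { point    = toPoint ∘ lookup dualArc
    ; distinct = λ {i} {j} (P⊆P′ , _) → dualArc-distinct i j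
        (let a , v≋v′a = P⊆P′ (1# , ≋-sym (*ᵥ-identity _)) in multiple⇒∥ {a} v≋v′a) }

  dualArc-meets : ∀ n → 2 ℕ.* n ≡ q ℕ.* q → ∀ L →
    MeetsInPoints dualArc-pointSet L 0 ⊎ MeetsInPoints dualArc-pointSet L n
  dualArc-meets n 2n≡q² L =
    [ (λ N≡0 → inj₁ (meets N≡0)) , (λ 2N≡q² → inj₂ (meets (ℕ.*-cancelˡ-≡ _ n 2 (≡.trans 2N≡q² (≡.sym 2n≡q²))))) ]′
      (dualArc-line (fromLine L))
    where
    on? : ∀ j → Dec (proj₁ (lookup dualArc j) ∙ proj₁ (fromLine L) ≈ 0#)
    on? j = lookup dualArc j ⟂? fromLine L
    meets : ∀ {m} → ∑[ p ∈ dualArc ] 𝟙 (p ⟂? fromLine L) ≡ m → MeetsInPoints dualArc-pointSet L m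
    meets N≡m = let S , S⇔ = decidable⇒subset on? in
      S , (λ j → mk⇔ (Equivalence.to (incidence (toPoint (lookup dualArc j)) L) ∘ Equivalence.to (S⇔ j))
                     (Equivalence.from (S⇔ j) ∘ Equivalence.from (incidence (toPoint (lookup dualArc j)) L))) ,
      ≡.trans (∣S∣≡count S on? S⇔) (≡.trans (≡.sym (∑-lookup dualArc λ p → 𝟙 (p ⟂? fromLine L))) N≡m)

  pointSet-bound : ∀ {k} n → 2 ℕ.* n ≡ q ℕ.* q → ArcExists k n → 2 ℕ.* k ℕ.+ q ≤ q ℕ.* q ℕ.* (q ℕ.* q)
  pointSet-bound {k} n 2n≡q² (K , arc) = ≡.subst (λ k → 2 ℕ.* k ℕ.+ q ≤ q ℕ.* q ℕ.* (q ℕ.* q))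
    (≡.trans (List.length-map _ (allFin k)) (List.length-tabulate {n = k} id))
    (arc-bound (map vector (allFin k)) n 2n≡q² λ w → ℕ.≤-trans (ℕ.≤-reflexive (∑-map vector (allFin k) _)) (line-bound w))
    where
    vector : Fin k → Pt
    vector j = fromPoint (PointSet.point K j)
    line-bound : ∀ w → ∑[ j ∈ allFin k ] 𝟙 (vector j ⟂? w) ≤ n
    line-bound w = let s , (S , S⇔ , ∣S∣≡s) , s≤n = arc (toLine w) in
      ℕ.≤-trans (ℕ.≤-reflexive (≡.trans (≡.sym (∣S∣≡count S (λ j → vector j ⟂? w)
        (λ j → mk⇔ (Equivalence.from (incidence-toLine (PointSet.point K j) w) ∘ Equivalence.to (S⇔ j))
                   (Equivalence.from (S⇔ j) ∘ Equivalence.to (incidence-toLine (PointSet.point K j) w))))) ∣S∣≡s)) s≤n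

-- Exact halves of q² and of q⁴ - q

even-square : ∀ r → r ≥ 1 → 2 ℕ.* ((2 ^ r) ^ 2 / 2) ≡ 2 ^ r ℕ.* 2 ^ r
even-square (suc r) _ = ≡.trans (ℕ.*-comm 2 ((2 ^ suc r) ^ 2 / 2)) (≡.trans
  -- The exponent is positive, so q is even and q² / 2 is an exact quotient.
  (m/n*n≡m {(2 ^ suc r) ^ 2} {2} (ℕ.divides (2 ^ r ℕ.* (2 ℕ.* 2 ^ r)) (regroup (2 ^ r))))
  (≡.cong (2 ^ suc r ℕ.*_) (ℕ.*-identityʳ (2 ^ suc r))))
  where
  regroup : ∀ s → (2 ℕ.* s) ℕ.* ((2 ℕ.* s) ℕ.* 1) ≡ s ℕ.* (2 ℕ.* s) ℕ.* 2
  regroup = solve-∀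

private
  fourth-power : ∀ q → q ^ 4 ≡ q ℕ.* q ℕ.* (q ℕ.* q)
  fourth-power = regroup
    where
    regroup : ∀ q → q ℕ.* (q ℕ.* (q ℕ.* (q ℕ.* 1))) ≡ q ℕ.* q ℕ.* (q ℕ.* q)
    regroup = solve-∀

  halve : ∀ k → 2 ℕ.* k / 2 ≡ k
  halve k = ≡.trans (≡.cong (_/ 2) (ℕ.*-comm 2 k)) (m*n/n≡m k 2)

theorem3p11 : ∀ (r : ℕ) → r ≥ 1 →
  ∀ (h : CommutativeRing.Carrier ℤ₄[X]) → IsGaloisModulus r h →
  let q = 2 ^ r
      open Arcs (PHG₂ (CommutativeRing.ring (GaloisRing h))) in
  (∃ λ (K : PointSet ((q ^ 4 ∸ q) / 2)) →
     IsArc K (q ^ 2 / 2) ×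
     (∀ L → MeetsInPoints K L 0 ⊎ MeetsInPoints K L (q ^ 2 / 2)))
  × MaxArcSize (q ^ 2 / 2) ((q ^ 4 ∸ q) / 2)
theorem3p11 r r≥1 h modulus = arc , record
  { attained = proj₁ arc , proj₁ (proj₂ arc)
  -- The bound 2k + q ≤ q⁴ becomes 2k ≤ q⁴ ∸ q, and division by 2 is monotone.
  ; maximal  = λ k K → ≡.subst (_≤ (q ^ 4 ∸ q) / 2) (halve k) (/-monoˡ-≤ 2 (ℕ.m+n≤o⇒m≤o∸n (2 ℕ.* k)
      (≡.subst (2 ℕ.* k ℕ.+ q ≤_) (≡.sym (fourth-power q)) (pointSet-bound (q ^ 2 / 2) 2n≡q² K)))) }
  where
  q : ℕ
  q = 2 ^ r
  chain : IsDyadicChainRing (GaloisRing h) q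
  chain = galoisRing-chain r≥1 modulus
  open HjelmslevPlane (GaloisRing h) q chain
  open DualArc (GaloisRing h) q chain using (dualArc; length-dualArc)
  open Arcs (PHG₂ (CommutativeRing.ring (GaloisRing h)))
  2n≡q² : 2 ℕ.* (q ^ 2 / 2) ≡ q ℕ.* q
  2n≡q² = even-square r r≥1
  size : length dualArc ≡ (q ^ 4 ∸ q) / 2
  -- Because 2|arc| + q = q⁴, both the truncated difference and the quotient are exact.
  size = ≡.trans (≡.sym (halve (length dualArc))) (≡.cong (_/ 2) (≡.trans (≡.sym (ℕ.m+n∸n≡m (2 ℕ.* length dualArc) q))
    (≡.cong (_∸ q) (≡.trans length-dualArc (≡.sym (fourth-power q))))))
  arc : ∃ λ (K : PointSet ((q ^ 4 ∸ q) / 2)) → IsArc K (q ^ 2 / 2) ×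
    (∀ L → MeetsInPoints K L 0 ⊎ MeetsInPoints K L (q ^ 2 / 2))
  arc = ≡.subst
    (λ k → ∃ λ (K : PointSet k) → IsArc K (q ^ 2 / 2) ×
      (∀ L → MeetsInPoints K L 0 ⊎ MeetsInPoints K L (q ^ 2 / 2)))
    size
    (dualArc-pointSet ,
     (λ L → [ (λ meets → 0 , meets , z≤n) , (λ meets → q ^ 2 / 2 , meets , ℕ.≤-refl) ]′ (meets L)) ,
     meets)
    where
    meets : ∀ L → MeetsInPoints dualArc-pointSet L 0 ⊎ MeetsInPoints dualArc-pointSet L (q ^ 2 / 2)
    meets = dualArc-meets (q ^ 2 / 2) 2n≡q²
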